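{- Let $p\geq 3$ be a prime and $H_p$ the Heisenberg group over $\mathbb Z_p$ (presented as $\{x^ay^bz^c:0\le a,b,c<p\}$ with $x^p=y^p=z^p=1$, $xz=zx$, $yz=zy$, $yx=xyz$). For $F=\sum_{0\le i,j,k<p}a_{ijk}x^iy^jz^k$ with $a_{ijk}\in\mathbb Z$, if $p\mid M_{H_p}(F)$ then $p^{p^2+3}\mid M_{H_p}(F)$. Moreover, there exists such an $F$ with $p^{p^2+3}\parallel M_{H_p}(F)$.
   Context: $M_{H_p}(F)=\det(a_{gh^{ -1}})_{g,h\in H_p}$ is the group determinant of $H_p$ evaluated at the coefficients of $F$, where $a_g=a_{ijk}$ for $g=x^iy^jz^k$. $p^e\parallel N$ means $p^e\mid N$ and $p^{e+1}\nmid N$. -}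

module Defs where

open import Data.Nat as ℕ using (ℕ; zero; suc; NonZero)
open import Data.Integer using (ℤ; +_; _+_; _*_; -_; _-_)
open import Data.Integer.DivMod using (_%ℕ_; n%ℕd<d)
open import Data.Fin using (Fin; zero; suc; toℕ; fromℕ<; punchIn; remQuot)
open import Data.Product using (_×_; _,_)

sumFin : ∀ n → (Fin n → ℤ) → ℤ
sumFin zero    f = + 0
sumFin (suc n) f = f zero + sumFin n (λ i → f (suc i))

sign : ℕ → ℤ
sign zero    = + 1
sign (suc k) = - sign k

det : ∀ n → (Fin n → Fin n → ℤ) → ℤ
det zero    A = + 1
det (suc n) A =
  sumFin (suc n) λ i → sign (toℕ i) * (A i zero * det n (λ r c → A (punchIn i r) (suc c)))

modFin : (p : ℕ) .{{_ : NonZero p}} → ℤ → Fin p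
modFin p z = fromℕ< (n%ℕd<d z p)

-- Elements of H_p: x^a y^b z^c is encoded by (a , b , c), a, b, c ∈ Fin p.
-- Multiplication: x^a y^b z^c · x^d y^e z^f = x^(a+d) y^(b+e) z^(c+f+bd)  (from yx = xyz).
Hp : ℕ → Set
Hp p = Fin p × Fin p × Fin p

Hmul : (p : ℕ) .{{_ : NonZero p}} → Hp p → Hp p → Hp p
Hmul p (a , b , c) (d , e , f) =
  ( modFin p (+ toℕ a + + toℕ d)
  , modFin p (+ toℕ b + + toℕ e)
  , modFin p (+ toℕ c + + toℕ f + + toℕ b * + toℕ d))

Hinv : (p : ℕ) .{{_ : NonZero p}} → Hp p → Hp p
Hinv p (d , e , f) =
  ( modFin p (- + toℕ d)
  , modFin p (- + toℕ e)
  , modFin p (- + toℕ f + + toℕ d * + toℕ e))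

decode : (p : ℕ) → Fin (p ℕ.* (p ℕ.* p)) → Hp p
decode p i with remQuot {p} (p ℕ.* p) i
... | a , j with remQuot {p} p j
...   | b , c = a , b , c

Coeffs : ℕ → Set
Coeffs p = Fin p → Fin p → Fin p → ℤ

coeff : (p : ℕ) → Coeffs p → Hp p → ℤ
coeff p F (a , b , c) = F a b c

M : (p : ℕ) .{{_ : NonZero p}} → Coeffs p → ℤ
M p F = det (p ℕ.* (p ℕ.* p))
  (λ i j → coeff p F (Hmul p (decode p i) (Hinv p (decode p j))))

{-# OPTIONS --safe #-}
module Submission where

-- Let z be the central generator of H_p. Commutators in ℤ[H_p] are divisible by 1 - z, so Jacobson's formula for (a + b)^p
-- shows that F^p is congruent to an integer n ≡ ε(F) modulo p and (1 - z)^(p-1), where ε is the augmentation. The regular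
-- representation is an extension of that of H_p/⟨z⟩ = Z_p² by the part C on which 1 + z + … + z^(p-1) vanishes, and
-- (1 - z)^(p-1) is divisible by p on C. Hence p divides M(F) only if p divides ε(F); in that case F^p = pU on C, which has
-- rank p²(p-1), and p^(p(p-1)) divides the determinant of F on C. Over Z_p², choose a quotient ⟨t⟩ of order p such that the
-- image of F has derivative ≡ 0 (mod p) at t = 1. This image is pA + (t-1)²B, its p-th power is divisible by p², and its
-- determinant by p³; on the remaining part, of rank p(p-1), again F^p = pY, where p | ε(Y), and the determinant is divisible
-- by p^p. The total exponent is p(p-1) + 3 + p = p² + 3.
--
-- Equality holds for F = 1 - αx⁻¹y^μ - βx⁻¹y^(μ+1) with α = μ + 1, β = p - μ and suitable μ. On C the two monomials A and B
-- satisfy AB = zBA, so (A + B)^p = A^p + B^p = α^p + β^p, and F^p is p times a unit modulo p as soon as p² does not divide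
-- 1 - α^p - β^p. Over Z_p², eliminating x leaves the determinant of 1 - (αt^μ + βt^(μ+1))^p over Z_p = ⟨t⟩.

open import Defs using (sumFin; sign; det; modFin; Hmul; Hinv; decode; Coeffs; coeff; M)
open import Data.Nat as ℕ using (ℕ; zero; suc)
import Data.Nat.Properties as ℕₚ
import Data.Integer as Int
open import Data.Integer as ℤ using (ℤ; +_; -[1+_])
import Data.Integer.Properties as ℤₚ
open import Data.Integer.Divisibility.Signed as ℤˢ using (divides) renaming (_∣_ to _∣ˢ_)
open import Data.Integer.Tactic.RingSolver using (solve-∀)
open import Data.Fin as Fin using (Fin; zero; suc; toℕ; punchIn; punchOut; _↑ˡ_; _↑ʳ_)
import Data.Fin.Properties as Finₚ
open import Data.Product using (_×_; _,_; ∃; proj₁; proj₂)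
open import Data.Sum using (_⊎_; inj₁; inj₂)
open import Data.Empty using (⊥; ⊥-elim)
open import Function using (_∘_; _$_; id; case_of_)
open import Relation.Nullary using (¬_; Dec; yes; no)
open import Relation.Binary.Definitions using (tri<; tri≈; tri>)
open import Relation.Binary.PropositionalEquality as ≡ using (_≡_; _≢_; refl; sym; trans; cong; cong₂; subst; module ≡-Reasoning)
open import Data.Bool using (Bool; true; false; if_then_else_)
open import Data.List as List using (List; []; _∷_; _++_)
import Data.List.Properties as Listₚ
open import Data.Vec as Vec using (Vec; []; _∷_)
open import Relation.Binary.Structures using (IsEquivalence)
open import Relation.Binary.Bundles using (Setoid)
import Relation.Binary.Reasoning.Setoid as SetoidReasoning
import Data.Nat.Divisibility as ℕᵈ
open import Data.Nat.Primality using (Prime; euclidsLemma; prime⇒irreducible)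
open import Data.Nat.Coprimality using (Coprime; coprime-Bézout)
open import Data.Nat.GCD using (module Bézout)
import Data.Nat.Tactic.RingSolver as ℕSolver
open import Data.Integer.DivMod using (_%ℕ_; _/ℕ_; n%ℕd<d; a≡a%ℕn+[a/ℕn]*n)


-- Cyclotomic integers never appear: every part is an integral matrix representation, and a group
-- ring element is one expression evaluated in all of them, so identities proved in ℤ[H_p] can be
-- moved to each part. The exponents arise by rounding up. If e^p = p^k Y on a part of rank N, then
-- D = det e satisfies D^p = p^(kN) det Y. Once p | ε(Y), also p | det Y, and when p divides kN this
-- one surplus p forces a whole further factor p in D. Hence 2 + 1 = 3 over Z_p (N = p, k = 2) and
-- (p-1) + 1 = p on the rest of Z_p² (N = p(p-1), k = 1). A suitable quotient ⟨t⟩ exists because the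
-- derivative at t = 1 depends linearly, modulo p, on the projection Z_p² → Z_p, and a linear form
-- on a plane has a nonzero zero. For an arbitrary projection the same reasoning gives only p² over
-- Z_p. In the example, a double root of 1 - αt^μ - βt^(μ+1) at t = 1 modulo p forces α ≡ μ + 1 and
-- β ≡ -μ, so μ is the only freedom left for the condition on C.

-- Finite sums of integers

module FinSums where
  open Int using (_+_; _*_; -_; _-_)

  sumFin-cong : ∀ n {f g : Fin n → ℤ} → (∀ i → f i ≡ g i) → sumFin n f ≡ sumFin n g
  sumFin-cong zero    h = refl
  sumFin-cong (suc n) h = cong₂ _+_ (h zero) (sumFin-cong n (h ∘ suc))

  sumFin-zero : ∀ n {f : Fin n → ℤ} → (∀ i → f i ≡ + 0) → sumFin n f ≡ + 0
  sumFin-zero zero    h = refl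
  sumFin-zero (suc n) h = trans (cong₂ _+_ (h zero) (sumFin-zero n (h ∘ suc))) refl

  interchange : ∀ a b c d → (a + b) + (c + d) ≡ (a + c) + (b + d)
  interchange = solve-∀

  sumFin-+ : ∀ n (f g : Fin n → ℤ) → sumFin n (λ i → f i + g i) ≡ sumFin n f + sumFin n g
  sumFin-+ zero    f g = refl
  sumFin-+ (suc n) f g = trans (cong₂ _+_ {f zero + g zero} refl (sumFin-+ n (f ∘ suc) (g ∘ suc)))
    (interchange (f zero) (g zero) _ _)

  sumFin-*ˡ : ∀ n (x : ℤ) (f : Fin n → ℤ) → sumFin n (λ i → x * f i) ≡ x * sumFin n f
  sumFin-*ˡ zero    x f = sym (ℤₚ.*-zeroʳ x)
  sumFin-*ˡ (suc n) x f = trans (cong₂ _+_ {x * f zero} refl (sumFin-*ˡ n x (f ∘ suc)))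
    (sym (ℤₚ.*-distribˡ-+ x (f zero) _))

  sumFin-*ʳ : ∀ n (x : ℤ) (f : Fin n → ℤ) → sumFin n (λ i → f i * x) ≡ sumFin n f * x
  sumFin-*ʳ n x f = trans (sumFin-cong n (λ i → ℤₚ.*-comm (f i) x))
    (trans (sumFin-*ˡ n x f) (ℤₚ.*-comm x _))

  sumFin-swap : ∀ m n (f : Fin m → Fin n → ℤ) →
    sumFin m (λ i → sumFin n (f i)) ≡ sumFin n (λ j → sumFin m (λ i → f i j))
  sumFin-swap zero    n f = sym (sumFin-zero n (λ _ → refl))
  sumFin-swap (suc m) n f = trans (cong₂ _+_ {sumFin n (f zero)} refl (sumFin-swap m n (f ∘ suc)))
    (sym (sumFin-+ n (f zero) _))

  sumFin-single : ∀ n (r : Fin n) {f : Fin n → ℤ} → (∀ i → i ≢ r → f i ≡ + 0) → sumFin n f ≡ f r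
  sumFin-single (suc n) zero    {f} h =
    trans (cong₂ _+_ {f zero} refl (sumFin-zero n (λ i → h (suc i) λ ()))) (ℤₚ.+-identityʳ _)
  sumFin-single (suc n) (suc r) {f} h =
    trans (cong₂ _+_ (h zero λ ()) (sumFin-single n r (λ i ne → h (suc i) (ne ∘ Finₚ.suc-injective))))
      (ℤₚ.+-identityˡ _)

  sumFin-pair : ∀ n (a b : Fin n) {f : Fin n → ℤ} → a ≢ b →
    (∀ i → i ≢ a → i ≢ b → f i ≡ + 0) → sumFin n f ≡ f a + f b
  sumFin-pair (suc n) zero    zero    a≢b h = ⊥-elim (a≢b refl)
  sumFin-pair (suc n) zero    (suc b) {f} a≢b h = cong₂ _+_ {f zero} refl
    (sumFin-single n b (λ i ne → h (suc i) (λ ()) (ne ∘ Finₚ.suc-injective)))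
  sumFin-pair (suc n) (suc a) zero    {f} a≢b h = trans (cong₂ _+_ {f zero} refl
    (sumFin-single n a (λ i ne → h (suc i) (ne ∘ Finₚ.suc-injective) (λ ()))))
    (ℤₚ.+-comm (f zero) _)
  sumFin-pair (suc n) (suc a) (suc b) a≢b h = trans (cong₂ _+_ (h zero (λ ()) (λ ()))
    (sumFin-pair n a b (a≢b ∘ cong suc)
      (λ i p q → h (suc i) (p ∘ Finₚ.suc-injective) (q ∘ Finₚ.suc-injective)))) (ℤₚ.+-identityˡ _)

  sumFin-++ : ∀ m n (f : Fin (m ℕ.+ n) → ℤ) →
    sumFin (m ℕ.+ n) f ≡ sumFin m (λ i → f (i ↑ˡ n)) + sumFin n (λ i → f (m ↑ʳ i))
  sumFin-++ zero    n f = sym (ℤₚ.+-identityˡ _)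
  sumFin-++ (suc m) n f = trans (cong₂ _+_ {f zero} refl (sumFin-++ m n (f ∘ suc)))
    (sym (ℤₚ.+-assoc (f zero) _ _))

open FinSums

-- Determinants by expansion along the first column: multilinearity, alternation, products, blocks

module Determinants where
  open Int using (_+_; _*_; -_; _-_)

  Square : ℕ → Set
  Square n = Fin n → Fin n → ℤ

  minor : ∀ {n} → Square (suc n) → Fin (suc n) → Square n
  minor A i r c = A (punchIn i r) (suc c)

  det-cong : ∀ n {A B : Square n} → (∀ i j → A i j ≡ B i j) → det n A ≡ det n B
  det-cong zero    h = refl
  det-cong (suc n) h = sumFin-cong (suc n) λ i →
    cong (sign (toℕ i) *_) (cong₂ _*_ (h i zero) (det-cong n (λ r c → h (punchIn i r) (suc c))))

  RowCongruent : ∀ {n} → (Square n → ℤ) → Set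
  RowCongruent f = ∀ {A B} → (∀ i j → A i j ≡ B i j) → f A ≡ f B

  -- Additivity and homogeneity in row `r` are merged into one identity, so that a single case
  -- distinction on the row proves both.
  RowLinear : ∀ {n} → (Square n → ℤ) → Set
  RowLinear {n} f = ∀ r x (A B C : Square n) →
    (∀ j → A r j ≡ x * B r j + C r j) →
    (∀ i → i ≢ r → ∀ j → A i j ≡ B i j) → (∀ i → i ≢ r → ∀ j → A i j ≡ C i j) →
    f A ≡ x * f B + f C

  Alternating : ∀ {n} → (Square n → ℤ) → Set
  Alternating {n} f = ∀ a b → a ≢ b → (A : Square n) → (∀ j → A a j ≡ A b j) → f A ≡ + 0

  private
    lin₁ : ∀ s x b c d → s * ((x * b + c) * d) ≡ x * (s * (b * d)) + s * (c * d)
    lin₁ = solve-∀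
    lin₂ : ∀ s x a d e → s * (a * (x * d + e)) ≡ x * (s * (a * d)) + s * (a * e)
    lin₂ = solve-∀

  -- In the expansion along the first column, the term of row `r` has a linear entry and a minor
  -- free of that row; every other term has a constant entry and a minor that is linear in the row
  -- by induction.
  det-rowLinear : ∀ n → RowLinear (det n)
  det-rowLinear (suc n) r x A B C hr hB hC =
    trans (sumFin-cong (suc n) term)
      (trans (sumFin-+ (suc n) (λ i → x * T B i) (T C)) (cong (_+ det (suc n) C) (sumFin-*ˡ (suc n) x (T B))))
    where
    T : Square (suc n) → Fin (suc n) → ℤ
    T M i = sign (toℕ i) * (M i zero * det n (minor M i))
    term : ∀ i → sign (toℕ i) * (A i zero * det n (minor A i))
      ≡ x * (sign (toℕ i) * (B i zero * det n (minor B i))) + sign (toℕ i) * (C i zero * det n (minor C i))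
    term i with i Fin.≟ r
    ... | yes refl = begin
      sign (toℕ i) * (A i zero * det n (minor A i))
        ≡⟨ cong (λ y → sign (toℕ i) * (y * det n (minor A i))) (hr zero) ⟩
      sign (toℕ i) * ((x * B i zero + C i zero) * det n (minor A i))
        ≡⟨ lin₁ (sign (toℕ i)) x (B i zero) (C i zero) _ ⟩
      x * (sign (toℕ i) * (B i zero * det n (minor A i))) + sign (toℕ i) * (C i zero * det n (minor A i))
        ≡⟨ cong₂ (λ y z → x * (sign (toℕ i) * (B i zero * y)) + sign (toℕ i) * (C i zero * z))
            (det-cong n (λ k c → hB (punchIn i k) (Finₚ.punchInᵢ≢i i k) (suc c)))
            (det-cong n (λ k c → hC (punchIn i k) (Finₚ.punchInᵢ≢i i k) (suc c))) ⟩
      _ ∎ where open ≡-Reasoning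
    ... | no i≢r = begin
      sign (toℕ i) * (A i zero * det n (minor A i))
        ≡⟨ cong (λ y → sign (toℕ i) * (A i zero * y))
             (det-rowLinear n (punchOut i≢r) x (minor A i) (minor B i) (minor C i)
               (λ j → subst (λ k → A k (suc j) ≡ x * B k (suc j) + C k (suc j)) (sym (Finₚ.punchIn-punchOut i≢r)) (hr (suc j)))
               (λ k ne j → hB (punchIn i k) (off k ne) (suc j)) (λ k ne j → hC (punchIn i k) (off k ne) (suc j))) ⟩
      sign (toℕ i) * (A i zero * (x * det n (minor B i) + det n (minor C i)))
        ≡⟨ lin₂ (sign (toℕ i)) x (A i zero) _ _ ⟩
      x * (sign (toℕ i) * (A i zero * det n (minor B i))) + sign (toℕ i) * (A i zero * det n (minor C i))
        ≡⟨ cong₂ (λ y z → x * (sign (toℕ i) * (y * det n (minor B i))) + sign (toℕ i) * (z * det n (minor C i)))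
             (hB i i≢r zero) (hC i i≢r zero) ⟩
      _ ∎
      where
      open ≡-Reasoning
      off : ∀ k → k ≢ punchOut i≢r → punchIn i k ≢ r
      off k ne eq = ne (Finₚ.punchIn-injective i k (punchOut i≢r)
        (trans eq (sym (Finₚ.punchIn-punchOut i≢r))))

  -- An inductive form of `toℕ b ≡ suc (toℕ a)`. It follows the recursion of `punchIn` and
  -- `punchOut`, so deleting a third row visibly keeps the two rows adjacent.
  data Adjacent : ∀ {n} → Fin n → Fin n → Set where
    zero : ∀ {n} → Adjacent {suc (suc n)} zero (suc zero)
    suc  : ∀ {n} {a b : Fin n} → Adjacent a b → Adjacent (suc a) (suc b)

  adjacent⇒≢ : ∀ {n} {a b : Fin n} → Adjacent a b → a ≢ b
  adjacent⇒≢ (suc h) eq = adjacent⇒≢ h (Finₚ.suc-injective eq)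

  toℕ-adjacent : ∀ {n} {a b : Fin n} → Adjacent a b → toℕ b ≡ suc (toℕ a)
  toℕ-adjacent zero    = refl
  toℕ-adjacent (suc h) = cong suc (toℕ-adjacent h)

  adjacent-punchOut : ∀ {n} {a b i : Fin (suc n)} → Adjacent a b → (p : i ≢ a) (q : i ≢ b) →
    Adjacent (punchOut p) (punchOut q)
  adjacent-punchOut {i = zero}  zero p q = ⊥-elim (p refl)
  adjacent-punchOut {i = suc zero} zero p q = ⊥-elim (q refl)
  adjacent-punchOut {n = suc (suc n)} {i = suc (suc i)} zero p q = zero
  adjacent-punchOut {i = zero}  (suc h) p q = h
  adjacent-punchOut {n = suc n} {i = suc i} (suc h) p q = suc (adjacent-punchOut h (p ∘ cong suc) (q ∘ cong suc))

  -- Deleting either of two neighbours leaves the same list of rows, up to the one that survives. If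
  -- the two rows agree, the two minors are therefore equal.
  punchIn-adjacent : ∀ {n} {a b : Fin (suc n)} → Adjacent a b → ∀ r →
    (punchIn a r ≡ punchIn b r) ⊎ (punchIn a r ≡ b × punchIn b r ≡ a)
  punchIn-adjacent zero    zero    = inj₂ (refl , refl)
  punchIn-adjacent zero    (suc r) = inj₁ refl
  punchIn-adjacent (suc h) zero    = inj₁ refl
  punchIn-adjacent (suc h) (suc r) with punchIn-adjacent h r
  ... | inj₁ eq        = inj₁ (cong suc eq)
  ... | inj₂ (eq , eq') = inj₂ (cong suc eq , cong suc eq')

  private
    cancel : ∀ s a d → s * (a * d) + (- s) * (a * d) ≡ + 0
    cancel = solve-∀

  -- Adjacency gives the two surviving terms opposite signs and equal minors; every other minor
  -- still contains both equal rows.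
  det-adjacent : ∀ n {a b : Fin n} → Adjacent a b → (A : Square n) → (∀ j → A a j ≡ A b j) → det n A ≡ + 0
  det-adjacent (suc n) {a} {b} h A eq = trans
    (sumFin-pair (suc n) a b (adjacent⇒≢ h) vanish)
    (trans (cong₂ (λ x y → sign (toℕ a) * (A a zero * det n (minor A a)) + x * y)
      (cong sign (toℕ-adjacent h)) (cong₂ _*_ (sym (eq zero)) (det-cong n minors)))
      (cancel (sign (toℕ a)) (A a zero) _))
    where
    minors : ∀ r c → minor A b r c ≡ minor A a r c
    minors r c with punchIn-adjacent h r
    ... | inj₁ e         = cong (λ k → A k (suc c)) (sym e)
    ... | inj₂ (e , e') = trans (cong (λ k → A k (suc c)) e')
      (trans (eq (suc c)) (cong (λ k → A k (suc c)) (sym e)))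
    vanish : ∀ i → i ≢ a → i ≢ b → sign (toℕ i) * (A i zero * det n (minor A i)) ≡ + 0
    vanish i p q = trans (cong (λ y → sign (toℕ i) * (A i zero * y))
      (det-adjacent n (adjacent-punchOut h p q) (minor A i) λ c →
        trans (cong (λ k → A k (suc c)) (Finₚ.punchIn-punchOut p))
          (trans (eq (suc c)) (cong (λ k → A k (suc c)) (sym (Finₚ.punchIn-punchOut q))))))
      (trans (cong (sign (toℕ i) *_) (ℤₚ.*-zeroʳ (A i zero))) (ℤₚ.*-zeroʳ (sign (toℕ i))))

  infixl 20 _⟪_≔_⟫
  _⟪_≔_⟫ : ∀ {n} → Square n → Fin n → (Fin n → ℤ) → Square n
  (A ⟪ r ≔ v ⟫) i with i Fin.≟ r
  ... | yes _ = v
  ... | no _  = A i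

  at-updated : ∀ {n} (A : Square n) r v j → (A ⟪ r ≔ v ⟫) r j ≡ v j
  at-updated A r v j with r Fin.≟ r
  ... | yes _ = refl
  ... | no ne = ⊥-elim (ne refl)

  off-updated : ∀ {n} (A : Square n) r v i → i ≢ r → ∀ j → (A ⟪ r ≔ v ⟫) i j ≡ A i j
  off-updated A r v i ne j with i Fin.≟ r
  ... | yes e = ⊥-elim (ne e)
  ... | no _  = refl

  module Swapping {n} (f : Square n → ℤ) (f-cong : RowCongruent f) (f-lin : RowLinear f) where

    linear-at : ∀ A r x u v w → (∀ j → u j ≡ x * v j + w j) →
      f (A ⟪ r ≔ u ⟫) ≡ x * f (A ⟪ r ≔ v ⟫) + f (A ⟪ r ≔ w ⟫)
    linear-at A r x u v w h = f-lin r x _ _ _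
      (λ j → trans (at-updated A r u j) (trans (h j)
        (sym (cong₂ (λ y z → x * y + z) (at-updated A r v j) (at-updated A r w j)))))
      (λ i ne j → trans (off-updated A r u i ne j) (sym (off-updated A r v i ne j)))
      (λ i ne j → trans (off-updated A r u i ne j) (sym (off-updated A r w i ne j)))

    Vanishes : Fin n → Fin n → Set
    Vanishes a b = (A : Square n) → (∀ j → A a j ≡ A b j) → f A ≡ + 0

    private
      expand : ∀ a b c d → + 1 * (+ 1 * a + b) + (+ 1 * c + d) ≡ (a + d) + (c + b)
      expand = solve-∀
      minus : ∀ b c → (+ 0 + + 0) + (b + c) ≡ + 0 → b ≡ - c
      minus b c h = trans (rearrange b c) (trans (cong (_- c) h) (ℤₚ.+-identityˡ (- c)))
        where
        rearrange : ∀ b c → b ≡ ((+ 0 + + 0) + (b + c)) - c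
        rearrange = solve-∀

    -- Polarisation: expand `f` at the matrix with `u + v` in both rows.
    swap-rows : ∀ a b → a ≢ b → Vanishes a b → ∀ A u v →
      f (A ⟪ a ≔ u ⟫ ⟪ b ≔ v ⟫) ≡ - f (A ⟪ a ≔ v ⟫ ⟪ b ≔ u ⟫)
    swap-rows a b a≢b van A u v = minus _ _ (trans
      (sym (cong₂ (λ x y → (x + y) + (f (R u v) + f (R v u))) (same u) (same v)))
      (trans (sym (expand (f (R u u)) (f (R v u)) (f (R u v)) (f (R v v)))) (trans (sym total) (same w))))
      where
      R : (Fin n → ℤ) → (Fin n → ℤ) → Square n
      R x y = A ⟪ a ≔ x ⟫ ⟪ b ≔ y ⟫
      w : Fin n → ℤ
      w j = + 1 * u j + v j
      same : ∀ x → f (R x x) ≡ + 0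
      same x = van (R x x) λ j → trans (off-updated _ b x a a≢b j)
        (trans (at-updated A a x j) (sym (at-updated _ b x j)))
      first : ∀ y → f (R w y) ≡ + 1 * f (R u y) + f (R v y)
      first y = f-lin a (+ 1) _ _ _
        (λ j → trans (off-updated _ b y a a≢b j) (trans (at-updated A a w j)
          (sym (cong₂ (λ p q → + 1 * p + q)
            (trans (off-updated _ b y a a≢b j) (at-updated A a u j))
            (trans (off-updated _ b y a a≢b j) (at-updated A a v j))))))
        (λ i ne j → other u i ne j) (λ i ne j → other v i ne j)
        where
        other : ∀ x i → i ≢ a → ∀ j → R w y i j ≡ R x y i j
        other x i ne j with i Fin.≟ b
        ... | yes _ = refl
        ... | no _  = trans (off-updated A a w i ne j) (sym (off-updated A a x i ne j))
      total : f (R w w) ≡ + 1 * (+ 1 * f (R u u) + f (R v u)) + (+ 1 * f (R u v) + f (R v v))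
      total = trans (linear-at _ b (+ 1) w u v (λ j → refl))
        (cong₂ (λ x y → + 1 * x + y) (first u) (first v))

    swapped : ∀ a b → a ≢ b → Vanishes a b → ∀ A → f A ≡ - f (A ⟪ a ≔ A b ⟫ ⟪ b ≔ A a ⟫)
    swapped a b a≢b van A = trans (f-cong same) (swap-rows a b a≢b van A (A a) (A b))
      where
      same : ∀ i j → A i j ≡ (A ⟪ a ≔ A a ⟫ ⟪ b ≔ A b ⟫) i j
      same i j with i Fin.≟ b
      ... | yes refl = refl
      ... | no _ with i Fin.≟ a
      ...   | yes refl = refl
      ...   | no _     = refl

    module _ (f-adj : ∀ {a b} → Adjacent a b → Vanishes a b) where

      private
        step : ∀ {n} (b : Fin n) {m} → toℕ b ≡ suc m → ∃ λ b' → Adjacent b' b × toℕ b' ≡ m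
        step (suc zero) refl = zero , zero , refl
        step (suc (suc b)) {suc m} eq with step (suc b) (ℕₚ.suc-injective eq)
        ... | b' , h , e = suc b' , suc h , cong suc e

      -- Induction on the distance of the rows: exchanging `b` with its predecessor costs a sign and
      -- brings the equal rows closer together.
      vanishes-below : ∀ d a b → toℕ b ≡ suc d ℕ.+ toℕ a → Vanishes a b
      vanishes-below d a b eq A h with step b eq
      vanishes-below zero a b eq A h | b' , adj , e with Finₚ.toℕ-injective e
      ... | refl = f-adj adj A h
      vanishes-below (suc d) a b eq A h | b' , adj , e =
        trans (swapped b' b (adjacent⇒≢ adj) (f-adj adj) A)
          (cong -_ (vanishes-below d a b' e _ λ j →
            trans (off-updated _ b (A b') a a≢b j) (trans (off-updated A b' (A b) a a≢b' j)
              (trans (h j) (sym (trans (off-updated _ b (A b') b' (adjacent⇒≢ adj) j) (at-updated A b' (A b) j)))))))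
        where
        a≢b : a ≢ b
        a≢b refl = ℕₚ.m≢1+n+m (toℕ a) eq
        a≢b' : a ≢ b'
        a≢b' refl = ℕₚ.m≢1+n+m (toℕ a) e

      alternating : Alternating f
      alternating a b a≢b A h with ℕₚ.<-cmp (toℕ a) (toℕ b)
      ... | tri< lt _ _ = vanishes-below (toℕ b ℕ.∸ suc (toℕ a)) a b
              (trans (sym (ℕₚ.m∸n+n≡m lt)) (ℕₚ.+-suc _ _)) A h
      ... | tri≈ _ e _  = ⊥-elim (a≢b (Finₚ.toℕ-injective e))
      ... | tri> _ _ gt = vanishes-below (toℕ a ℕ.∸ suc (toℕ b)) b a
              (trans (sym (ℕₚ.m∸n+n≡m gt)) (ℕₚ.+-suc _ _)) A (sym ∘ h)

  δᶠ : ∀ {n} → Fin n → Fin n → ℤ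
  δᶠ i j with i Fin.≟ j
  ... | yes _ = + 1
  ... | no _  = + 0

  δᶠ-refl : ∀ {n} (i : Fin n) → δᶠ i i ≡ + 1
  δᶠ-refl i with i Fin.≟ i
  ... | yes _ = refl
  ... | no ne = ⊥-elim (ne refl)

  δᶠ-≢ : ∀ {n} {i j : Fin n} → i ≢ j → δᶠ i j ≡ + 0
  δᶠ-≢ {i = i} {j} ne with i Fin.≟ j
  ... | yes e = ⊥-elim (ne e)
  ... | no _  = refl

  sumFin-δ : ∀ n (i : Fin n) (f : Fin n → ℤ) → sumFin n (λ j → f j * δᶠ j i) ≡ f i
  sumFin-δ n i f = trans (sumFin-single n i (λ j ne → trans (cong (f j *_) (δᶠ-≢ ne)) (ℤₚ.*-zeroʳ (f j))))
    (trans (cong (f i *_) (δᶠ-refl i)) (ℤₚ.*-identityʳ (f i)))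

  module Uniqueness {n} (f : Square n → ℤ) (f-cong : RowCongruent f) (f-lin : RowLinear f)
    (f-alt : Alternating f) (f-one : f δᶠ ≡ + 0) where

    open Swapping f f-cong f-lin

    private
      double⇒zero : ∀ x → x ≡ + 1 * x + x → x ≡ + 0
      double⇒zero x h = trans (rearrange x) (trans (cong (_- x) (sym h)) (ℤₚ.+-inverseʳ x))
        where
        rearrange : ∀ x → x ≡ (+ 1 * x + x) - x
        rearrange = solve-∀

    RowVanishes : Square n → Fin n → (Fin n → ℤ) → Set
    RowVanishes A r v = f (A ⟪ r ≔ v ⟫) ≡ + 0

    row-cong : ∀ A r u v → (∀ j → u j ≡ v j) → f (A ⟪ r ≔ u ⟫) ≡ f (A ⟪ r ≔ v ⟫)
    row-cong A r u v h = f-cong same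
      where
      same : ∀ i j → (A ⟪ r ≔ u ⟫) i j ≡ (A ⟪ r ≔ v ⟫) i j
      same i j with i Fin.≟ r
      ... | yes _ = h j
      ... | no _  = refl

    row-combination : ∀ A r m (c : Fin m → ℤ) (e : Fin m → Fin n → ℤ) → (∀ k → RowVanishes A r (e k)) →
      RowVanishes A r (λ j → sumFin m (λ k → c k * e k j))
    -- The empty combination is the zero row, and `0 = 1 · 0 + 0` makes the value of `f` equal to
    -- its double.
    row-combination A r zero    c e h =
      double⇒zero _ (linear-at A r (+ 1) _ (λ _ → + 0) (λ _ → + 0) (λ _ → refl))
    row-combination A r (suc m) c e h =
      trans (linear-at A r (c zero) _ (e zero) (λ j → sumFin m (λ k → c (suc k) * e (suc k) j)) (λ j → refl))
        (trans (cong₂ (λ x y → c zero * x + y) (h zero) (row-combination A r m (c ∘ suc) (e ∘ suc) (h ∘ suc)))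
          (trans (ℤₚ.+-identityʳ _) (ℤₚ.*-zeroʳ (c zero))))

    row-basis : (A : Square n) (r : Fin n) (v : Fin n → ℤ) → (∀ k → RowVanishes A r (δᶠ k)) → RowVanishes A r v
    row-basis A r v h = trans (row-cong A r v _ (λ j → sym (sumFin-δ n j v))) (row-combination A r n v δᶠ h)

    swapF : Fin n → Fin n → (Fin n → Fin n) → Fin n → Fin n
    swapF a b σ i with i Fin.≟ b
    ... | yes _ = σ a
    ... | no _ with i Fin.≟ a
    ...   | yes _ = σ b
    ...   | no _  = σ i

    -- Sorting of basis vectors: `σ` is already the identity below `d`. If `d` is a value of `σ`,
    -- one exchange of rows brings it to position `d`; if not, the pigeonhole principle yields two
    -- equal rows.
    vanishes-sorted : ∀ k d → k ℕ.+ d ≡ n → (σ : Fin n → Fin n) → (∀ i → toℕ i ℕ.< d → σ i ≡ i) → f (λ i → δᶠ (σ i)) ≡ + 0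
    vanishes-sorted zero d refl σ fix =
      trans (f-cong (λ i j → cong (λ x → δᶠ x j) (fix i (Finₚ.toℕ<n i)))) f-one
    vanishes-sorted (suc k) d eq σ fix = case Finₚ.any? (λ j → σ j Fin.≟ c) of λ where
        (yes (j , σj≡c)) → moved j σj≡c
        (no none)        → repeated none
      where
      d<n : d ℕ.< n
      d<n = subst (d ℕ.<_) eq (ℕₚ.m<1+n⇒m≤n (ℕ.s≤s (ℕ.s≤s (ℕₚ.m≤n+m d k))))
      c : Fin n
      c = Fin.fromℕ< d<n
      toℕc : toℕ c ≡ d
      toℕc = Finₚ.toℕ-fromℕ< d<n
      next : ∀ σ' → (∀ i → toℕ i ℕ.< d → σ' i ≡ i) → σ' c ≡ c → f (λ i → δᶠ (σ' i)) ≡ + 0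
      next σ' fix' fc = vanishes-sorted k (suc d) (trans (ℕₚ.+-suc k d) eq) σ' λ i lt →
        case ℕₚ.m<1+n⇒m<n∨m≡n lt of λ where
          (inj₁ l) → fix' i l
          (inj₂ e) → subst (λ x → σ' x ≡ x) (Finₚ.toℕ-injective (trans toℕc (sym e))) fc
      repeated : ¬ ∃ (λ j → σ j ≡ c) → f (λ i → δᶠ (σ i)) ≡ + 0
      repeated none = case clash n refl c none of λ where
          (i , j , i≢j , e) → f-alt i j i≢j _ (λ x → cong (λ y → δᶠ y x) e)
        where
        clash : ∀ m (m≡n : m ≡ n) (c : Fin n) → ¬ ∃ (λ j → σ j ≡ c) → ∃ λ i → ∃ λ j → i ≢ j × σ i ≡ σ j
        clash (suc m) refl c none with Finₚ.pigeonhole (ℕₚ.n<1+n m) (λ j → punchOut {i = c} {j = σ j} (λ e → none (j , sym e)))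
        ... | i , j , i<j , e = i , j , Finₚ.<⇒≢ i<j , Finₚ.punchOut-injective (λ e → none (i , sym e)) (λ e → none (j , sym e)) e
      moved : ∀ j → σ j ≡ c → f (λ i → δᶠ (σ i)) ≡ + 0
      moved j σj≡c = case j Fin.≟ c of λ where
          (yes refl) → next σ fix σj≡c
          (no j≢c) → trans (swapped c j (j≢c ∘ sym) (f-alt c j (j≢c ∘ sym)) _)
            (trans (cong -_ (trans (f-cong (pointwise j j≢c)) (next (swapF c j σ)
            (λ i lt → swap-fix j j≢c σj≡c i lt) (swap-c j j≢c σj≡c)))) refl)
        where
        pointwise : ∀ j → j ≢ c → ∀ i x → ((λ i → δᶠ (σ i)) ⟪ c ≔ δᶠ (σ j) ⟫ ⟪ j ≔ δᶠ (σ c) ⟫) i x ≡ δᶠ (swapF c j σ i) x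
        pointwise j _ i x with i Fin.≟ j
        ... | yes _ = refl
        ... | no _ with i Fin.≟ c
        ...   | yes _ = refl
        ...   | no _  = refl
        swap-c : ∀ j → j ≢ c → σ j ≡ c → swapF c j σ c ≡ c
        swap-c j j≢c e with c Fin.≟ j
        ... | yes p = ⊥-elim (j≢c (sym p))
        ... | no _ with c Fin.≟ c
        ...   | yes _ = e
        ...   | no ne = ⊥-elim (ne refl)
        swap-fix : ∀ j → j ≢ c → σ j ≡ c → ∀ i → toℕ i ℕ.< d → swapF c j σ i ≡ i
        swap-fix j j≢c e i lt with i Fin.≟ j
        ... | yes refl = ⊥-elim (j≢c (trans (sym (fix j lt)) e))
        ... | no _ with i Fin.≟ c
        ...   | yes refl = ⊥-elim (ℕₚ.<-irrefl toℕc lt)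
        ...   | no _     = fix i lt

    -- The rows from k on are basis vectors; the free rows are expanded one at a time.
    vanishes-partial : ∀ k → k ℕ.≤ n → (A : Square n) (σ : Fin n → Fin n) → (∀ i → k ℕ.≤ toℕ i → ∀ j → A i j ≡ δᶠ (σ i) j) → f A ≡ + 0
    vanishes-partial zero    k≤n A σ h =
      trans (f-cong (λ i j → h i ℕ.z≤n j)) (vanishes-sorted n 0 (ℕₚ.+-identityʳ n) σ (λ _ ()))
    vanishes-partial (suc k) k<n A σ h =
      trans (f-cong same) (row-basis A r (A r) λ c →
        vanishes-partial k (ℕₚ.<⇒≤ k<n) (A ⟪ r ≔ δᶠ c ⟫) (σ' c) (basis c))
      where
      r : Fin n
      r = Fin.fromℕ< k<n
      same : ∀ i j → A i j ≡ (A ⟪ r ≔ A r ⟫) i j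
      same i j with i Fin.≟ r
      ... | yes refl = refl
      ... | no _     = refl
      σ' : Fin n → Fin n → Fin n
      σ' c i with i Fin.≟ r
      ... | yes _ = c
      ... | no _  = σ i
      basis : ∀ c i → k ℕ.≤ toℕ i → ∀ j → (A ⟪ r ≔ δᶠ c ⟫) i j ≡ δᶠ (σ' c i) j
      basis c i k≤i j with i Fin.≟ r
      ... | yes _  = refl
      ... | no i≢r = h i (ℕₚ.≤∧≢⇒< k≤i (λ e → i≢r (Finₚ.toℕ-injective (trans (sym e) (sym (Finₚ.toℕ-fromℕ< k<n)))))) j

    -- An alternating multilinear function is determined by its value at the identity. Applied to
    -- the difference of two such functions, this proves them equal without a sum over permutations.
    vanishes : ∀ A → f A ≡ + 0
    vanishes A = vanishes-partial n ℕₚ.≤-refl A id (λ i n≤i → ⊥-elim (ℕₚ.<⇒≱ (Finₚ.toℕ<n i) n≤i))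

  det-alternating : ∀ n → Alternating (det n)
  det-alternating n = Swapping.alternating (det n) (det-cong n) (det-rowLinear n) (det-adjacent n)

  det-one : ∀ n → det n δᶠ ≡ + 1
  det-one zero    = refl
  det-one (suc n) = trans
    (sumFin-single (suc n) zero (λ i ne → trans (cong (λ y → sign (toℕ i) * (y * det n (minor δᶠ i))) (δᶠ-≢ ne)) (ℤₚ.*-zeroʳ (sign (toℕ i)))))
    (trans (ℤₚ.*-identityˡ _) (trans (ℤₚ.*-identityˡ _) (trans (det-cong n shift) (det-one n))))
    where
    shift : ∀ {n} (i j : Fin n) → δᶠ (suc i) (suc j) ≡ δᶠ i j
    shift i j = case i Fin.≟ j of λ where
      (yes refl) → trans (δᶠ-refl (suc i)) (sym (δᶠ-refl i))
      (no ne)    → trans (δᶠ-≢ (ne ∘ Finₚ.suc-injective)) (sym (δᶠ-≢ ne))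

  infixl 7 _·_
  _·_ : ∀ {n} → Square n → Square n → Square n
  _·_ {n} A B i j = sumFin n (λ k → A i k * B k j)

  private
    minus⇒≡ : ∀ x y → x - y ≡ + 0 → x ≡ y
    minus⇒≡ x y h = ℤₚ.i-j≡0⇒i≡j x y h

  -- For fixed `B`, the difference of the two sides is multilinear and alternating in the rows of
  -- `A` and vanishes at the identity.
  det-· : ∀ n (A B : Square n) → det n (A · B) ≡ det n A * det n B
  det-· n A B = minus⇒≡ _ _ (Uniqueness.vanishes f f-cong f-lin f-alt f-one A)
    where
    f : Square n → ℤ
    f A = det n (A · B) - det n A * det n B
    f-cong : RowCongruent f
    f-cong h = cong₂ (λ x y → x - y * det n B)
      (det-cong n (λ i j → sumFin-cong n (λ k → cong (_* B k j) (h i k)))) (det-cong n h)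
    f-lin : RowLinear f
    f-lin r x A C D hr hC hD = trans (cong₂ (λ y z → y - z * det n B)
        (det-rowLinear n r x (A · B) (C · B) (D · B) row
          (λ i ne j → sumFin-cong n (λ k → cong (_* B k j) (hC i ne k)))
          (λ i ne j → sumFin-cong n (λ k → cong (_* B k j) (hD i ne k))))
        (det-rowLinear n r x A C D hr hC hD))
      (rearrange x (det n (C · B)) (det n (D · B)) (det n C) (det n D) (det n B))
      where
      rearrange : ∀ x a b c d e → (x * a + b) - (x * c + d) * e ≡ x * (a - c * e) + (b - d * e)
      rearrange = solve-∀
      distrib : ∀ x a b c → (x * a + b) * c ≡ x * (a * c) + b * c
      distrib = solve-∀
      row : ∀ j → (A · B) r j ≡ x * (C · B) r j + (D · B) r j
      row j = trans (sumFin-cong n (λ k → trans (cong (_* B k j) (hr k)) (distrib x (C r k) (D r k) (B k j))))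
        (trans (sumFin-+ n (λ k → x * (C r k * B k j)) (λ k → D r k * B k j))
          (cong (_+ (D · B) r j) (sumFin-*ˡ n x (λ k → C r k * B k j))))
    f-alt : Alternating f
    f-alt a b a≢b A h = cong₂ (λ x y → x - y * det n B)
      (det-alternating n a b a≢b (A · B) (λ j → sumFin-cong n (λ k → cong (_* B k j) (h k))))
      (det-alternating n a b a≢b A h)
    f-one : f δᶠ ≡ + 0
    f-one = trans (cong₂ _-_ (det-cong n (λ i j → trans
        (sumFin-single n i (λ k ne → trans (cong (_* B k j) (δᶠ-≢ (ne ∘ sym))) refl))
        (trans (cong (_* B i j) (δᶠ-refl i)) (ℤₚ.*-identityˡ _))))
      (trans (cong (_* det n B) (det-one n)) (ℤₚ.*-identityˡ _))) (ℤₚ.+-inverseʳ (det n B))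

  -- Induction on `m`: the lower `n` entries of the first column vanish, and each remaining minor is
  -- block triangular with the same lower block.
  det-block : ∀ m n (A : Square (m ℕ.+ n)) → (∀ r c → A (m ↑ʳ r) (c ↑ˡ n) ≡ + 0) →
    det (m ℕ.+ n) A ≡ det m (λ i j → A (i ↑ˡ n) (j ↑ˡ n)) * det n (λ i j → A (m ↑ʳ i) (m ↑ʳ j))
  det-block zero    n A h = sym (ℤₚ.*-identityˡ _)
  det-block (suc m) n A h = begin
    det (suc m ℕ.+ n) A
      ≡⟨ sumFin-++ (suc m) n term ⟩
    sumFin (suc m) (λ i → term (i ↑ˡ n)) + sumFin n (λ i → term (suc m ↑ʳ i))
      ≡⟨ cong₂ _+_ (sumFin-cong (suc m) upper) (sumFin-zero n lower) ⟩
    sumFin (suc m) (λ i → sign (toℕ i) * (L i zero * det m (minor L i)) * det n R) + + 0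
      ≡⟨ ℤₚ.+-identityʳ _ ⟩
    sumFin (suc m) (λ i → sign (toℕ i) * (L i zero * det m (minor L i)) * det n R)
      ≡⟨ sumFin-*ʳ (suc m) (det n R) (λ i → sign (toℕ i) * (L i zero * det m (minor L i))) ⟩
    det (suc m) L * det n R ∎
    where
    open ≡-Reasoning
    L : Square (suc m)
    L i j = A (i ↑ˡ n) (j ↑ˡ n)
    R : Square n
    R i j = A (suc m ↑ʳ i) (suc m ↑ʳ j)
    term : Fin (suc m ℕ.+ n) → ℤ
    term i = sign (toℕ i) * (A i zero * det (m ℕ.+ n) (minor A i))
    punchIn-↑ˡ : ∀ {m} (i : Fin (suc m)) k → punchIn (i ↑ˡ n) (k ↑ˡ n) ≡ punchIn i k ↑ˡ n
    punchIn-↑ˡ zero    k       = refl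
    punchIn-↑ˡ (suc i) zero    = refl
    punchIn-↑ˡ (suc i) (suc k) = cong suc (punchIn-↑ˡ i k)
    punchIn-↑ʳ : ∀ {m} (i : Fin (suc m)) k → punchIn (i ↑ˡ n) (m ↑ʳ k) ≡ suc m ↑ʳ k
    punchIn-↑ʳ zero            k = refl
    punchIn-↑ʳ {suc m} (suc i) k = cong suc (punchIn-↑ʳ i k)
    assoc : ∀ s a b c → s * (a * (b * c)) ≡ s * (a * b) * c
    assoc = solve-∀
    upper : ∀ i → term (i ↑ˡ n) ≡ sign (toℕ i) * (L i zero * det m (minor L i)) * det n R
    upper i = trans (cong₂ (λ x y → sign x * (L i zero * y)) (Finₚ.toℕ-↑ˡ i n)
      (trans (det-block m n (minor A (i ↑ˡ n)) (λ r c →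
          trans (cong (λ k → A k (suc c ↑ˡ n)) (punchIn-↑ʳ i r)) (h r (suc c))))
        (cong₂ _*_ (det-cong m (λ r c → cong (λ k → A k (suc c ↑ˡ n)) (punchIn-↑ˡ i r)))
          (det-cong n (λ r c → cong (λ k → A k (suc m ↑ʳ c)) (punchIn-↑ʳ i r))))))
      (assoc (sign (toℕ i)) (L i zero) (det m (minor L i)) (det n R))
    lower : ∀ i → term (suc m ↑ʳ i) ≡ + 0
    lower i = trans (cong (λ y → sign (toℕ (suc m ↑ʳ i)) * (y * det (m ℕ.+ n) (minor A (suc m ↑ʳ i)))) (h i zero))
      (ℤₚ.*-zeroʳ (sign (toℕ (suc m ↑ʳ i))))

  det-scale : ∀ n x (A : Square n) → det n (λ i j → x * A i j) ≡ x ℤ.^ n * det n A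
  det-scale zero    x A = refl
  det-scale (suc n) x A = trans (sumFin-cong (suc n) (λ i →
      trans (cong (λ y → sign (toℕ i) * (x * A i zero * y)) (det-scale n x (minor A i)))
        (rearrange (sign (toℕ i)) x (A i zero) (x ℤ.^ n) (det n (minor A i)))))
    (sumFin-*ˡ (suc n) (x * x ℤ.^ n) (λ i → sign (toℕ i) * (A i zero * det n (minor A i))))
    where
    rearrange : ∀ s x a y d → s * (x * a * (y * d)) ≡ (x * y) * (s * (a * d))
    rearrange = solve-∀

  -- The determinant is a polynomial in the entries with integer coefficients.
  det-mod : ∀ n m (A B : Square n) → (∀ i j → m ∣ˢ A i j - B i j) → m ∣ˢ det n A - det n B
  det-mod zero    m A B h = divides (+ 0) refl
  det-mod (suc n) m A B h = sums (suc n) (T A) (T B) λ i → scaled (sign (toℕ i)) {A i zero * det n (minor A i)} {B i zero * det n (minor B i)} (products {A i zero} {B i zero} (h i zero) (det-mod n m (minor A i) (minor B i) (λ r c → h (punchIn i r) (suc c))))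
    where
    T : Square (suc n) → Fin (suc n) → ℤ
    T M i = sign (toℕ i) * (M i zero * det n (minor M i))
    scaled : ∀ s {x y} → m ∣ˢ x - y → m ∣ˢ s * x - s * y
    scaled s {x} {y} (divides k e) = divides (s * k) (trans (factor s x y) (trans (cong (s *_) e) (sym (ℤₚ.*-assoc s k m))))
      where
      factor : ∀ s x y → s * x - s * y ≡ s * (x - y)
      factor = solve-∀
    products : ∀ {a b c d} → m ∣ˢ a - b → m ∣ˢ c - d → m ∣ˢ a * c - b * d
    products {a} {b} {c} {d} (divides k e) (divides l e') = divides (k * c + b * l)
      (trans (split a b c d) (trans (cong₂ (λ x y → x * c + b * y) e e') (collect k l m b c)))
      where
      split : ∀ a b c d → a * c - b * d ≡ (a - b) * c + b * (c - d)
      split = solve-∀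
      collect : ∀ k l m b c → k * m * c + b * (l * m) ≡ (k * c + b * l) * m
      collect = solve-∀
    sums : ∀ n (f g : Fin n → ℤ) → (∀ i → m ∣ˢ f i - g i) → m ∣ˢ sumFin n f - sumFin n g
    sums zero    f g h = divides (+ 0) refl
    sums (suc n) f g h with h zero | sums n (f ∘ suc) (g ∘ suc) (h ∘ suc)
    ... | divides k e | divides l e' = divides (k + l) (trans (split (f zero) (g zero) _ _)
      (trans (cong₂ _+_ e e') (sym (ℤₚ.*-distribʳ-+ m k l))))
      where
      split : ∀ a b c d → (a + c) - (b + d) ≡ (a - b) + (c - d)
      split = solve-∀

open Determinants hiding (_·_)

-- Matrices indexed by finite sets, and their determinants

-- An explicit enumeration lets products and sums of index sets keep their structure while `det`
-- still sees `Fin`; the choice of enumeration drops out by `Det-reindex`.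
record FinSet : Set₁ where
  field
    Carrier : Set
    size    : ℕ
    to      : Fin size → Carrier
    from    : Carrier → Fin size
    to-from : ∀ x → to (from x) ≡ x
    from-to : ∀ i → from (to i) ≡ i

open FinSet public hiding (Carrier)

∣_∣ : FinSet → Set
∣_∣ = FinSet.Carrier

fin : ℕ → FinSet
fin n = record { Carrier = Fin n ; size = n ; to = id ; from = id ; to-from = λ _ → refl ; from-to = λ _ → refl }

infixr 7 _⊗_
_⊗_ : FinSet → FinSet → FinSet
I ⊗ J = record
  { Carrier = ∣ I ∣ × ∣ J ∣
  ; size    = size I ℕ.* size J
  ; to      = λ k → to I (proj₁ (Fin.remQuot {size I} (size J) k)) , to J (proj₂ (Fin.remQuot {size I} (size J) k))
  ; from    = λ (i , j) → Fin.combine (from I i) (from J j)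
  ; to-from = λ (i , j) → cong₂ _,_
      (trans (cong (to I ∘ proj₁) (Finₚ.remQuot-combine (from I i) (from J j))) (to-from I i))
      (trans (cong (to J ∘ proj₂) (Finₚ.remQuot-combine (from I i) (from J j))) (to-from J j))
  ; from-to = λ k → trans (cong₂ Fin.combine (from-to I _) (from-to J _)) (Finₚ.combine-remQuot {size I} (size J) k)
  }

infixr 6 _⊕_
_⊕_ : FinSet → FinSet → FinSet
I ⊕ J = record
  { Carrier = ∣ I ∣ ⊎ ∣ J ∣
  ; size    = size I ℕ.+ size J
  ; to      = λ k → to′ (Fin.splitAt (size I) k)
  ; from    = λ x → Fin.join (size I) (size J) (from′ x)
  ; to-from = λ x → trans (cong to′ (Finₚ.splitAt-join (size I) (size J) (from′ x))) (to-from′ x)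
  ; from-to = λ k → trans (cong (Fin.join (size I) (size J)) (from-to′ (Fin.splitAt (size I) k))) (Finₚ.join-splitAt (size I) (size J) k)
  }
  where
  to′ : Fin (size I) ⊎ Fin (size J) → ∣ I ∣ ⊎ ∣ J ∣
  to′ (inj₁ i) = inj₁ (to I i)
  to′ (inj₂ j) = inj₂ (to J j)
  from′ : ∣ I ∣ ⊎ ∣ J ∣ → Fin (size I) ⊎ Fin (size J)
  from′ (inj₁ i) = inj₁ (from I i)
  from′ (inj₂ j) = inj₂ (from J j)
  to-from′ : ∀ x → to′ (from′ x) ≡ x
  to-from′ (inj₁ i) = cong inj₁ (to-from I i)
  to-from′ (inj₂ j) = cong inj₂ (to-from J j)
  from-to′ : ∀ x → from′ (to′ x) ≡ x
  from-to′ (inj₁ i) = cong inj₁ (from-to I i)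
  from-to′ (inj₂ j) = cong inj₂ (from-to J j)

module FiniteSums where
  open Int using (_+_; _*_; -_; _-_)

  Σ : (I : FinSet) → (∣ I ∣ → ℤ) → ℤ
  Σ I f = sumFin (size I) (f ∘ to I)

  δ : (I : FinSet) → ∣ I ∣ → ∣ I ∣ → ℤ
  δ I u v = δᶠ (from I u) (from I v)

  from-injective : ∀ I {u v} → from I u ≡ from I v → u ≡ v
  from-injective I {u} {v} h = trans (sym (to-from I u)) (trans (cong (to I) h) (to-from I v))

  δ-refl : ∀ I u → δ I u u ≡ + 1
  δ-refl I u = δᶠ-refl (from I u)

  δ-≢ : ∀ I {u v} → u ≢ v → δ I u v ≡ + 0
  δ-≢ I ne = δᶠ-≢ (ne ∘ from-injective I)

  decEq : ∀ I (u v : ∣ I ∣) → Dec (u ≡ v)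
  decEq I u v = case from I u Fin.≟ from I v of λ where
    (yes e) → yes (from-injective I e)
    (no ne) → no (ne ∘ cong (from I))

  δ-⇔ : ∀ I J {u v u' v'} → (u ≡ v → u' ≡ v') → (u' ≡ v' → u ≡ v) → δ I u v ≡ δ J u' v'
  δ-⇔ I J {u} {v} {u'} {v'} f g = case decEq I u v of λ where
    (yes e) → trans (trans (cong (δ I u) (sym e)) (δ-refl I u)) (sym (trans (cong (δ J u') (sym (f e))) (δ-refl J u')))
    (no ne) → trans (δ-≢ I ne) (sym (δ-≢ J (ne ∘ g)))

  δ-sym : ∀ I u v → δ I u v ≡ δ I v u
  δ-sym I u v = δ-⇔ I I sym sym

  Σ-cong : ∀ I {f g : ∣ I ∣ → ℤ} → (∀ u → f u ≡ g u) → Σ I f ≡ Σ I g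
  Σ-cong I h = sumFin-cong (size I) (h ∘ to I)

  Σ-zero : ∀ I {f : ∣ I ∣ → ℤ} → (∀ u → f u ≡ + 0) → Σ I f ≡ + 0
  Σ-zero I h = sumFin-zero (size I) (h ∘ to I)

  Σ-+ : ∀ I (f g : ∣ I ∣ → ℤ) → Σ I (λ u → f u + g u) ≡ Σ I f + Σ I g
  Σ-+ I f g = sumFin-+ (size I) (f ∘ to I) (g ∘ to I)

  Σ-*ˡ : ∀ I x (f : ∣ I ∣ → ℤ) → Σ I (λ u → x * f u) ≡ x * Σ I f
  Σ-*ˡ I x f = sumFin-*ˡ (size I) x (f ∘ to I)

  Σ-*ʳ : ∀ I x (f : ∣ I ∣ → ℤ) → Σ I (λ u → f u * x) ≡ Σ I f * x
  Σ-*ʳ I x f = sumFin-*ʳ (size I) x (f ∘ to I)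

  Σ-swap : ∀ I J (f : ∣ I ∣ → ∣ J ∣ → ℤ) → Σ I (λ u → Σ J (f u)) ≡ Σ J (λ v → Σ I (λ u → f u v))
  Σ-swap I J f = sumFin-swap (size I) (size J) (λ i j → f (to I i) (to J j))

  Σ-δʳ : ∀ I (f : ∣ I ∣ → ℤ) v → Σ I (λ u → f u * δ I u v) ≡ f v
  Σ-δʳ I f v = trans (sumFin-cong (size I) (λ i → cong (λ x → f (to I i) * δᶠ x (from I v)) (from-to I i)))
    (trans (sumFin-δ (size I) (from I v) (f ∘ to I)) (cong f (to-from I v)))

  Σ-δˡ : ∀ I (f : ∣ I ∣ → ℤ) v → Σ I (λ u → δ I v u * f u) ≡ f v
  Σ-δˡ I f v = trans (Σ-cong I (λ u → trans (ℤₚ.*-comm (δ I v u) (f u)) (cong (f u *_) (δ-sym I v u)))) (Σ-δʳ I f v)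

  Σ-⊕ : ∀ I J (f : ∣ I ∣ ⊎ ∣ J ∣ → ℤ) → Σ (I ⊕ J) f ≡ Σ I (f ∘ inj₁) + Σ J (f ∘ inj₂)
  Σ-⊕ I J f = trans (sumFin-++ (size I) (size J) (f ∘ to (I ⊕ J))) (cong₂ _+_
    (sumFin-cong (size I) (λ i → cong f (to-↑ˡ i))) (sumFin-cong (size J) (λ j → cong f (to-↑ʳ j))))
    where
    to-↑ˡ : ∀ i → to (I ⊕ J) (i ↑ˡ size J) ≡ inj₁ (to I i)
    to-↑ˡ i rewrite Finₚ.splitAt-↑ˡ (size I) i (size J) = refl
    to-↑ʳ : ∀ j → to (I ⊕ J) (size I ↑ʳ j) ≡ inj₂ (to J j)
    to-↑ʳ j rewrite Finₚ.splitAt-↑ʳ (size I) (size J) j = refl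

open FiniteSums

record Mat (I J : FinSet) : Set where
  no-eta-equality
  constructor mat
  field at : ∣ I ∣ → ∣ J ∣ → ℤ
open Mat public

infix 4 _≈ᴹ_
record _≈ᴹ_ {I J} (A B : Mat I J) : Set where
  no-eta-equality
  constructor pointwise
  field entry : ∀ i j → at A i j ≡ at B i j
open _≈ᴹ_ public

module Matrices where
  open Int using (_+_; _*_; -_; _-_)

  infixl 6 _+ᴹ_
  infixl 7 _∙_ _*ᴹ_

  _+ᴹ_ : ∀ {I J} → Mat I J → Mat I J → Mat I J
  A +ᴹ B = mat λ i j → at A i j + at B i j

  opaque
    _∙_ : ∀ {I J K} → Mat I J → Mat J K → Mat I K
    _∙_ {J = J} A B = mat λ i k → Σ J (λ j → at A i j * at B j k)

  _*ᴹ_ : ∀ {I J} → ℤ → Mat I J → Mat I J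
  x *ᴹ A = mat λ i j → x * at A i j

  0ᴹ : ∀ {I J} → Mat I J
  0ᴹ = mat λ _ _ → + 0

  1ᴹ : ∀ {I} → Mat I I
  1ᴹ {I} = mat (δ I)

  -- Column `j` is the basis vector `φ j`: the linear map that `φ` induces on free modules, so that
  -- products of these matrices follow composition.
  Fm : ∀ I J → (∣ J ∣ → ∣ I ∣) → Mat I J
  Fm I J φ = mat λ i j → δ I i (φ j)

  opaque
    unfolding _∙_

    ≈-refl : ∀ {I J} {A : Mat I J} → A ≈ᴹ A
    ≈-refl = pointwise λ _ _ → refl

    ≈-sym : ∀ {I J} {A B : Mat I J} → A ≈ᴹ B → B ≈ᴹ A
    ≈-sym h = pointwise λ i j → sym (entry h i j)

    ≈-trans : ∀ {I J} {A B C : Mat I J} → A ≈ᴹ B → B ≈ᴹ C → A ≈ᴹ C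
    ≈-trans h k = pointwise λ i j → trans (entry h i j) (entry k i j)

    +-cong : ∀ {I J} {A B C D : Mat I J} → A ≈ᴹ B → C ≈ᴹ D → A +ᴹ C ≈ᴹ B +ᴹ D
    +-cong h k = pointwise λ i j → cong₂ _+_ (entry h i j) (entry k i j)

    ∙-cong : ∀ {I J K} {A B : Mat I J} {C D : Mat J K} → A ≈ᴹ B → C ≈ᴹ D → A ∙ C ≈ᴹ B ∙ D
    ∙-cong {J = J} h k = pointwise λ i l → Σ-cong J (λ j → cong₂ _*_ (entry h i j) (entry k j l))

    ∙-congˡ : ∀ {I J K} (A : Mat I J) {B C : Mat J K} → B ≈ᴹ C → A ∙ B ≈ᴹ A ∙ C
    ∙-congˡ A h = ∙-cong (≈-refl {A = A}) h

    ∙-congʳ : ∀ {I J K} (C : Mat J K) {A B : Mat I J} → A ≈ᴹ B → A ∙ C ≈ᴹ B ∙ C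
    ∙-congʳ C h = ∙-cong h (≈-refl {A = C})

    *-cong : ∀ {I J} x {A B : Mat I J} → A ≈ᴹ B → x *ᴹ A ≈ᴹ x *ᴹ B
    *-cong x h = pointwise λ i j → cong (x *_) (entry h i j)

    ∙-assoc : ∀ {I J K L} (A : Mat I J) (B : Mat J K) (C : Mat K L) → (A ∙ B) ∙ C ≈ᴹ A ∙ (B ∙ C)
    ∙-assoc {I} {J} {K} A B C = pointwise λ i l → trans
      (Σ-cong K (λ k → sym (Σ-*ʳ J (at C k l) (λ j → at A i j * at B j k))))
      (trans (Σ-swap K J (λ k j → at A i j * at B j k * at C k l))
        (Σ-cong J (λ j → trans (Σ-cong K (λ k → ℤₚ.*-assoc (at A i j) (at B j k) (at C k l)))
          (Σ-*ˡ K (at A i j) (λ k → at B j k * at C k l)))))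

    ∙-distribˡ : ∀ {I J K} (A : Mat I J) (B C : Mat J K) → A ∙ (B +ᴹ C) ≈ᴹ A ∙ B +ᴹ A ∙ C
    ∙-distribˡ {J = J} A B C = pointwise λ i k → trans
      (Σ-cong J (λ j → ℤₚ.*-distribˡ-+ (at A i j) (at B j k) (at C j k))) (Σ-+ J (λ j → at A i j * at B j k) (λ j → at A i j * at C j k))

    ∙-distribʳ : ∀ {I J K} (A : Mat J K) (B C : Mat I J) → (B +ᴹ C) ∙ A ≈ᴹ B ∙ A +ᴹ C ∙ A
    ∙-distribʳ {J = J} A B C = pointwise λ i k → trans
      (Σ-cong J (λ j → ℤₚ.*-distribʳ-+ (at A j k) (at B i j) (at C i j))) (Σ-+ J (λ j → at B i j * at A j k) (λ j → at C i j * at A j k))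

    *ᴹ-∙ : ∀ {I J K} x (A : Mat I J) (B : Mat J K) → (x *ᴹ A) ∙ B ≈ᴹ x *ᴹ (A ∙ B)
    *ᴹ-∙ {J = J} x A B = pointwise λ i k → trans
      (Σ-cong J (λ j → ℤₚ.*-assoc x (at A i j) (at B j k))) (Σ-*ˡ J x (λ j → at A i j * at B j k))

    ∙-*ᴹ : ∀ {I J K} x (A : Mat I J) (B : Mat J K) → A ∙ (x *ᴹ B) ≈ᴹ x *ᴹ (A ∙ B)
    ∙-*ᴹ {J = J} x A B = pointwise λ i k → trans
      (Σ-cong J (λ j → rearrange (at A i j) x (at B j k))) (Σ-*ˡ J x (λ j → at A i j * at B j k))
      where
      rearrange : ∀ a x b → a * (x * b) ≡ x * (a * b)
      rearrange = solve-∀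

    ∙-identityˡ : ∀ {I J} (A : Mat I J) → 1ᴹ ∙ A ≈ᴹ A
    ∙-identityˡ {I} A = pointwise λ i j → Σ-δˡ I (λ k → at A k j) i

    ∙-identityʳ : ∀ {I J} (A : Mat I J) → A ∙ 1ᴹ ≈ᴹ A
    ∙-identityʳ {J = J} A = pointwise λ i j → Σ-δʳ J (at A i) j

    Fm-∙ : ∀ I J K (φ : ∣ J ∣ → ∣ I ∣) (ψ : ∣ K ∣ → ∣ J ∣) → Fm I J φ ∙ Fm J K ψ ≈ᴹ Fm I K (φ ∘ ψ)
    Fm-∙ I J K φ ψ = pointwise λ i k → Σ-δʳ J (λ j → δ I i (φ j)) (ψ k)

    Fm-cong : ∀ I J {φ ψ : ∣ J ∣ → ∣ I ∣} → (∀ j → φ j ≡ ψ j) → Fm I J φ ≈ᴹ Fm I J ψ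
    Fm-cong I J h = pointwise λ i j → cong (δ I i) (h j)

  opaque
    unfolding _∙_

    Det : ∀ {I} → Mat I I → ℤ
    Det {I} A = det (size I) (λ r c → at A (to I r) (to I c))

    Det-cong : ∀ {I} {A B : Mat I I} → A ≈ᴹ B → Det A ≡ Det B
    Det-cong {I} h = det-cong (size I) (λ r c → entry h (to I r) (to I c))

    Det-∙ : ∀ {I} (A B : Mat I I) → Det (A ∙ B) ≡ Det A * Det B
    Det-∙ {I} A B = det-· (size I) (λ r c → at A (to I r) (to I c)) (λ r c → at B (to I r) (to I c))

    Det-1 : ∀ {I} → Det (1ᴹ {I}) ≡ + 1
    Det-1 {I} = trans (det-cong (size I) (λ r c → cong₂ δᶠ (from-to I r) (from-to I c))) (det-one (size I))

    Det-*ᴹ : ∀ {I} x (A : Mat I I) → Det (x *ᴹ A) ≡ x ℤ.^ size I * Det A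
    Det-*ᴹ {I} x A = det-scale (size I) x (λ r c → at A (to I r) (to I c))

    Det-mod : ∀ {I} m (A B : Mat I I) → (∀ i j → m ∣ˢ at A i j - at B i j) → m ∣ˢ Det A - Det B
    Det-mod {I} m A B h = det-mod (size I) m _ _ (λ r c → h (to I r) (to I c))

  private
    det-conj : ∀ {m n} → m ≡ n → (X : Square m) (P' : Fin n → Fin m → ℤ) (P : Fin m → Fin n → ℤ) →
      (∀ i j → sumFin m (λ k → P' i k * P k j) ≡ δᶠ i j) →
      det n (λ i j → sumFin m (λ k → P' i k * sumFin m (λ l → X k l * P l j))) ≡ det m X
    det-conj {n} refl X P' P h = trans (det-· n P' (X · P)) (trans (cong (det n P' *_) (det-· n X P))
      (trans (rearrange (det n P') (det n X) (det n P))
        (trans (cong (_* det n X) (trans (sym (det-· n P' P)) (trans (det-cong n h) (det-one n)))) (ℤₚ.*-identityˡ _))))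
      where
      open Determinants using (_·_)
      rearrange : ∀ a b c → a * (b * c) ≡ a * c * b
      rearrange = solve-∀

  opaque
    unfolding _∙_ Det

    -- The index sets differ but their sizes agree, so after enumeration `P'` and `P` are square
    -- matrices whose determinants are inverse to each other.
    Det-conj : ∀ {I J} → size I ≡ size J → (X : Mat I I) (P' : Mat J I) (P : Mat I J) → P' ∙ P ≈ᴹ 1ᴹ →
      Det (P' ∙ (X ∙ P)) ≡ Det X
    Det-conj {I} {J} eq X P' P h = det-conj eq _ (λ r c → at P' (to J r) (to I c)) (λ r c → at P (to I r) (to J c))
      (λ i j → trans (entry h (to J i) (to J j)) (cong₂ δᶠ (from-to J i) (from-to J j)))

  opaque
    unfolding _∙_

    Det-reindex : ∀ {I J} → size I ≡ size J → (φ : ∣ J ∣ → ∣ I ∣) (ψ : ∣ I ∣ → ∣ J ∣) → (∀ j → ψ (φ j) ≡ j) →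
      (∀ i → φ (ψ i) ≡ i) → (X : Mat I I) → Det {J} (mat λ i j → at X (φ i) (φ j)) ≡ Det X
    Det-reindex {I} {J} eq φ ψ ψφ φψ X = trans (Det-cong {J} (pointwise λ i j → sym (conjugate i j)))
      (Det-conj {I} {J} eq X (Fm J I ψ) (Fm I J φ) (≈-trans (Fm-∙ J I J ψ φ) (Fm-cong J J ψφ)))
      where
      conjugate : ∀ i j → at (Fm J I ψ ∙ (X ∙ Fm I J φ)) i j ≡ at X (φ i) (φ j)
      conjugate i j = trans (Σ-cong I (λ k → cong₂ _*_
          (δ-⇔ J I {i} {ψ k} {φ i} {k} (λ e → trans (cong φ e) (φψ k)) (λ e → trans (sym (ψφ i)) (cong ψ e))) (Σ-δʳ I (at X k) (φ j))))
        (Σ-δˡ I (λ k → at X k (φ j)) (φ i))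

  block : ∀ {I J} → Mat I I → Mat I J → Mat J I → Mat J J → Mat (I ⊕ J) (I ⊕ J)
  block {I} {J} A B C D = mat go
    where
    go : ∣ I ⊕ J ∣ → ∣ I ⊕ J ∣ → ℤ
    go (inj₁ i) (inj₁ j) = at A i j
    go (inj₁ i) (inj₂ j) = at B i j
    go (inj₂ i) (inj₁ j) = at C i j
    go (inj₂ i) (inj₂ j) = at D i j

  opaque
    unfolding Det

    Det-upper : ∀ {I J} (A : Mat I I) (B : Mat I J) (D : Mat J J) → Det (block A B 0ᴹ D) ≡ Det A * Det D
    Det-upper {I} {J} A B D = trans
      (det-block (size I) (size J) _ zeros)
      (cong₂ _*_ (det-cong (size I) diag₁) (det-cong (size J) diag₂))
      where
      zeros : ∀ r c → at (block A B 0ᴹ D) (to (I ⊕ J) (size I ↑ʳ r)) (to (I ⊕ J) (c ↑ˡ size J)) ≡ + 0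
      zeros r c rewrite Finₚ.splitAt-↑ˡ (size I) c (size J) | Finₚ.splitAt-↑ʳ (size I) (size J) r = refl
      diag₁ : ∀ r c → at (block A B 0ᴹ D) (to (I ⊕ J) (r ↑ˡ size J)) (to (I ⊕ J) (c ↑ˡ size J)) ≡ at A (to I r) (to I c)
      diag₁ r c rewrite Finₚ.splitAt-↑ˡ (size I) r (size J) | Finₚ.splitAt-↑ˡ (size I) c (size J) = refl
      diag₂ : ∀ r c → at (block A B 0ᴹ D) (to (I ⊕ J) (size I ↑ʳ r)) (to (I ⊕ J) (size I ↑ʳ c)) ≡ at D (to J r) (to J c)
      diag₂ r c rewrite Finₚ.splitAt-↑ʳ (size I) (size J) r | Finₚ.splitAt-↑ʳ (size I) (size J) c = refl

  Det-lower : ∀ {I J} (A : Mat I I) (C : Mat J I) (D : Mat J J) → Det (block A 0ᴹ C D) ≡ Det A * Det D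
  Det-lower {I} {J} A C D = trans
    (sym (Det-reindex {I ⊕ J} {J ⊕ I} (ℕₚ.+-comm (size I) (size J)) flip flip flip-flip flip-flip (block A 0ᴹ C D)))
    (trans (Det-cong {J ⊕ I} (pointwise swapped)) (trans (Det-upper D C A) (ℤₚ.*-comm (Det D) (Det A))))
    where
    flip : ∀ {X Y : Set} → X ⊎ Y → Y ⊎ X
    flip (inj₁ x) = inj₂ x
    flip (inj₂ y) = inj₁ y
    flip-flip : ∀ {X Y : Set} (x : X ⊎ Y) → flip (flip x) ≡ x
    flip-flip (inj₁ x) = refl
    flip-flip (inj₂ y) = refl
    swapped : ∀ i j → at (block A 0ᴹ C D) (flip i) (flip j) ≡ at (block D C 0ᴹ A) i j
    swapped (inj₁ i) (inj₁ j) = refl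
    swapped (inj₁ i) (inj₂ j) = refl
    swapped (inj₂ i) (inj₁ j) = refl
    swapped (inj₂ i) (inj₂ j) = refl

  opaque
    unfolding _∙_

    -- Left multiplication by a unipotent matrix with lower left block `-C` clears `C` and leaves
    -- the Schur complement `D - CB`.
    Det-Schur : ∀ {I J} (B : Mat I J) (C : Mat J I) (D : Mat J J) →
      Det (block 1ᴹ B C D) ≡ Det (D +ᴹ (-[1+ 0 ] *ᴹ (C ∙ B)))
    Det-Schur {I} {J} B C D = begin
      Det X                     ≡⟨ sym (ℤₚ.*-identityˡ (Det X)) ⟩
      + 1 * Det X               ≡⟨ cong (_* Det X) (sym unipotent) ⟩
      Det L * Det X             ≡⟨ sym (Det-∙ L X) ⟩
      Det (L ∙ X)               ≡⟨ Det-cong {I ⊕ J} (pointwise product) ⟩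
      Det (block 1ᴹ B 0ᴹ S)     ≡⟨ Det-upper 1ᴹ B S ⟩
      Det (1ᴹ {I}) * Det S      ≡⟨ cong (_* Det S) (Det-1 {I}) ⟩
      + 1 * Det S               ≡⟨ ℤₚ.*-identityˡ (Det S) ⟩
      Det S                     ∎
      where
      open ≡-Reasoning
      X L : Mat (I ⊕ J) (I ⊕ J)
      X = block 1ᴹ B C D
      L = block 1ᴹ 0ᴹ (-[1+ 0 ] *ᴹ C) 1ᴹ
      S : Mat J J
      S = D +ᴹ (-[1+ 0 ] *ᴹ (C ∙ B))
      unipotent : Det L ≡ + 1
      unipotent = trans (Det-lower 1ᴹ (-[1+ 0 ] *ᴹ C) 1ᴹ) (cong₂ _*_ (Det-1 {I}) (Det-1 {J}))
      neg-cancel : ∀ x → -[1+ 0 ] * x + x ≡ + 0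
      neg-cancel = solve-∀
      0* : ∀ K (f : ∣ K ∣ → ℤ) → Σ K (λ k → + 0 * f k) ≡ + 0
      0* K f = Σ-zero K (λ _ → refl)
      product : ∀ i j → at (L ∙ X) i j ≡ at (block 1ᴹ B 0ᴹ S) i j
      product (inj₁ i) (inj₁ j) = trans (Σ-⊕ I J (λ k → at L (inj₁ i) k * at X k (inj₁ j)))
        (trans (cong₂ _+_ (Σ-δˡ I (λ k → δ I k j) i) (0* J (λ k → at C k j))) (ℤₚ.+-identityʳ _))
      product (inj₁ i) (inj₂ j) = trans (Σ-⊕ I J (λ k → at L (inj₁ i) k * at X k (inj₂ j)))
        (trans (cong₂ _+_ (Σ-δˡ I (λ k → at B k j) i) (0* J (λ k → at D k j))) (ℤₚ.+-identityʳ _))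
      product (inj₂ i) (inj₁ j) = trans (Σ-⊕ I J (λ k → at L (inj₂ i) k * at X k (inj₁ j)))
        (trans (cong₂ _+_ (Σ-δʳ I (λ k → -[1+ 0 ] * at C i k) j) (Σ-δˡ J (λ k → at C k j) i)) (neg-cancel (at C i j)))
      product (inj₂ i) (inj₂ j) = trans (Σ-⊕ I J (λ k → at L (inj₂ i) k * at X k (inj₂ j)))
        (trans (cong₂ _+_ (entry (*ᴹ-∙ -[1+ 0 ] C B) i j) (Σ-δˡ J (λ k → at D k j) i))
          (ℤₚ.+-comm (-[1+ 0 ] * at (C ∙ B) i j) (at D i j)))

-- Noncommutative rings and a ring solver with central variables

infixl 6 _:+_
infixl 7 _:*_
-- Serves twice: as input of the ring solver and, with `K` a group, as group ring elements, whose
-- equality is determined only by a representation.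
data Expr (K : Set) : Set where
  con       : ℤ → Expr K
  var       : K → Expr K
  _:+_ _:*_ : Expr K → Expr K → Expr K

-- An associative ring with unit over a setoid, `ι` being the map from ℤ. Negation is multiplication
-- by `ι -[1+ 0 ]`, so that subtraction needs no extra syntax in `Expr`.
record Algebra : Set₁ where
  infix  4 _≈_
  infixl 6 _+_ _-_
  infixl 7 _*_
  infixr 8 _^_
  field
    Carrier       : Set
    _≈_           : Carrier → Carrier → Set
    _+_ _*_       : Carrier → Carrier → Carrier
    ι             : ℤ → Carrier
    isEquivalence : IsEquivalence _≈_
    +-cong        : ∀ {a b c d} → a ≈ b → c ≈ d → a + c ≈ b + d
    *-cong        : ∀ {a b c d} → a ≈ b → c ≈ d → a * c ≈ b * d
    +-assoc       : ∀ a b c → (a + b) + c ≈ a + (b + c)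
    +-comm        : ∀ a b → a + b ≈ b + a
    +-identityˡ   : ∀ a → ι (+ 0) + a ≈ a
    *-assoc       : ∀ a b c → (a * b) * c ≈ a * (b * c)
    *-identityˡ   : ∀ a → ι (+ 1) * a ≈ a
    *-distribˡ    : ∀ a b c → a * (b + c) ≈ a * b + a * c
    *-distribʳ    : ∀ a b c → (b + c) * a ≈ b * a + c * a
    *-zeroˡ       : ∀ a → ι (+ 0) * a ≈ ι (+ 0)
    ι-+           : ∀ x y → ι (x ℤ.+ y) ≈ ι x + ι y
    ι-*           : ∀ x y → ι (x ℤ.* y) ≈ ι x * ι y
    ι-central     : ∀ x a → ι x * a ≈ a * ι x

  open IsEquivalence isEquivalence public renaming (refl to ≈-refl; sym to ≈-sym; trans to ≈-trans; reflexive to ≈-reflexive)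

  setoid : Setoid _ _
  setoid = record { isEquivalence = isEquivalence }
  module Reasoning = SetoidReasoning setoid

  _-_ : Carrier → Carrier → Carrier
  a - b = a + ι -[1+ 0 ] * b

  _^_ : Carrier → ℕ → Carrier
  a ^ zero  = ι (+ 1)
  a ^ suc n = a * a ^ n

  Central : Carrier → Set
  Central c = ∀ a → c * a ≈ a * c

  +-identityʳ : ∀ a → a + ι (+ 0) ≈ a
  +-identityʳ a = ≈-trans (+-comm a _) (+-identityˡ a)

  *-identityʳ : ∀ a → a * ι (+ 1) ≈ a
  *-identityʳ a = ≈-trans (≈-sym (ι-central (+ 1) a)) (*-identityˡ a)

  *-zeroʳ : ∀ a → a * ι (+ 0) ≈ ι (+ 0)
  *-zeroʳ a = ≈-trans (≈-sym (ι-central (+ 0) a)) (*-zeroˡ a)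

  *-cong₁ : ∀ {a b c} → a ≈ b → a * c ≈ b * c
  *-cong₁ h = *-cong h ≈-refl

  *-cong₂ : ∀ {a b c} → a ≈ b → c * a ≈ c * b
  *-cong₂ h = *-cong ≈-refl h

  +-cong₁ : ∀ {a b c} → a ≈ b → a + c ≈ b + c
  +-cong₁ h = +-cong h ≈-refl

  +-cong₂ : ∀ {a b c} → a ≈ b → c + a ≈ c + b
  +-cong₂ h = +-cong ≈-refl h

  ^-cong : ∀ {a b} n → a ≈ b → a ^ n ≈ b ^ n
  ^-cong zero    h = ≈-refl
  ^-cong (suc n) h = *-cong h (^-cong n h)

  ⟦_⟧ : ∀ {K} → Expr K → (K → Carrier) → Carrier
  ⟦ con x ⟧  ρ = ι x
  ⟦ var k ⟧  ρ = ρ k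
  ⟦ e :+ f ⟧ ρ = ⟦ e ⟧ ρ + ⟦ f ⟧ ρ
  ⟦ e :* f ⟧ ρ = ⟦ e ⟧ ρ * ⟦ f ⟧ ρ

-- A normaliser for ring expressions in m central and n arbitrary variables: sums of monomials
-- (coefficient, sorted word in the central variables, word in the others).
module Normalisation where

  Monomial : ℕ → ℕ → Set
  Monomial m n = ℤ × List (Fin m) × List (Fin n)

  insertFin : ∀ {m} → Fin m → List (Fin m) → List (Fin m)
  insertFin i []       = i ∷ []
  insertFin i (j ∷ js) = if toℕ i ℕ.≤ᵇ toℕ j then i ∷ j ∷ js else j ∷ insertFin i js

  mergeFin : ∀ {m} → List (Fin m) → List (Fin m) → List (Fin m)
  mergeFin []       js = js
  mergeFin (i ∷ is) js = insertFin i (mergeFin is js)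

  lessFin : ∀ {m} → List (Fin m) → List (Fin m) → Bool
  lessFin []       []       = false
  lessFin []       (_ ∷ _)  = true
  lessFin (_ ∷ _)  []       = false
  lessFin (i ∷ is) (j ∷ js) = if toℕ i ℕ.<ᵇ toℕ j then true else (if toℕ j ℕ.<ᵇ toℕ i then false else lessFin is js)

  sameWord? : ∀ {m} (v w : List (Fin m)) → Dec (v ≡ w)
  sameWord? = Listₚ.≡-dec Fin._≟_

  insert : ∀ {m n} → Monomial m n → List (Monomial m n) → List (Monomial m n)
  insert a [] = a ∷ []
  insert (k , c , w) ((k' , c' , w') ∷ l) with sameWord? c c' | sameWord? w w'
  ... | yes _ | yes _ = (k ℤ.+ k' , c' , w') ∷ l
  ... | yes _ | no _  = if lessFin w w' then (k , c , w) ∷ (k' , c' , w') ∷ l else (k' , c' , w') ∷ insert (k , c , w) l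
  ... | no _  | _     = if lessFin c c' then (k , c , w) ∷ (k' , c' , w') ∷ l else (k' , c' , w') ∷ insert (k , c , w) l

  merge : ∀ {m n} → List (Monomial m n) → List (Monomial m n) → List (Monomial m n)
  merge []      l = l
  merge (a ∷ k) l = insert a (merge k l)

  _⊛_ : ∀ {m n} → Monomial m n → Monomial m n → Monomial m n
  (k , c , w) ⊛ (k' , c' , w') = k ℤ.* k' , mergeFin c c' , w ++ w'

  timesMonomial : ∀ {m n} → Monomial m n → List (Monomial m n) → List (Monomial m n)
  timesMonomial a []      = []
  timesMonomial a (b ∷ l) = insert (a ⊛ b) (timesMonomial a l)

  times : ∀ {m n} → List (Monomial m n) → List (Monomial m n) → List (Monomial m n)
  times []      l = []
  times (a ∷ k) l = merge (timesMonomial a l) (times k l)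

  dropZeros : ∀ {m n} → List (Monomial m n) → List (Monomial m n)
  dropZeros []                = []
  dropZeros ((+ 0 , _) ∷ l)   = dropZeros l
  dropZeros (a@(+ (suc _) , _) ∷ l) = a ∷ dropZeros l
  dropZeros (a@(-[1+ _ ] , _) ∷ l)  = a ∷ dropZeros l

  normal : ∀ {m n} → Expr (Fin m ⊎ Fin n) → List (Monomial m n)
  normal (con x)        = (x , [] , []) ∷ []
  normal (var (inj₁ i)) = (+ 1 , i ∷ [] , []) ∷ []
  normal (var (inj₂ j)) = (+ 1 , [] , j ∷ []) ∷ []
  normal (e :+ f)       = merge (normal e) (normal f)
  normal (e :* f)       = times (normal e) (normal f)

  normalise : ∀ {m n} → Expr (Fin m ⊎ Fin n) → List (Monomial m n)
  normalise = dropZeros ∘ normal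

module Solver (A : Algebra) where
  open Algebra A
  open Normalisation

  module _ {m n} (γ : Fin m → ∃ Central) (ρ : Fin n → Carrier) where

    private
      c⟦_⟧ : List (Fin m) → Carrier
      c⟦ [] ⟧     = ι (+ 1)
      c⟦ i ∷ is ⟧ = proj₁ (γ i) * c⟦ is ⟧

      w⟦_⟧ : List (Fin n) → Carrier
      w⟦ [] ⟧     = ι (+ 1)
      w⟦ i ∷ is ⟧ = ρ i * w⟦ is ⟧

      m⟦_⟧ : Monomial m n → Carrier
      m⟦ k , c , w ⟧ = ι k * (c⟦ c ⟧ * w⟦ w ⟧)

      l⟦_⟧ : List (Monomial m n) → Carrier
      l⟦ [] ⟧    = ι (+ 0)
      l⟦ a ∷ l ⟧ = m⟦ a ⟧ + l⟦ l ⟧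

      env : Fin m ⊎ Fin n → Carrier
      env (inj₁ i) = proj₁ (γ i)
      env (inj₂ j) = ρ j

      open Reasoning

      central-* : ∀ {a b} → Central a → Central b → Central (a * b)
      central-* {a} {b} ca cb x = begin
        (a * b) * x ≈⟨ *-assoc a b x ⟩
        a * (b * x) ≈⟨ *-cong₂ (cb x) ⟩
        a * (x * b) ≈⟨ ≈-sym (*-assoc a x b) ⟩
        (a * x) * b ≈⟨ *-cong₁ (ca x) ⟩
        (x * a) * b ≈⟨ *-assoc x a b ⟩
        x * (a * b) ∎

      c-central : ∀ is → Central c⟦ is ⟧
      c-central []       = ι-central (+ 1)
      c-central (i ∷ is) = central-* (proj₂ (γ i)) (c-central is)

      insertFin-sound : ∀ i js → c⟦ insertFin i js ⟧ ≈ proj₁ (γ i) * c⟦ js ⟧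
      insertFin-sound i []       = ≈-refl
      insertFin-sound i (j ∷ js) with toℕ i ℕ.≤ᵇ toℕ j
      ... | true  = ≈-refl
      ... | false = begin
        γ₁ j * c⟦ insertFin i js ⟧ ≈⟨ *-cong₂ (insertFin-sound i js) ⟩
        γ₁ j * (γ₁ i * c⟦ js ⟧)    ≈⟨ ≈-sym (*-assoc _ _ _) ⟩
        γ₁ j * γ₁ i * c⟦ js ⟧      ≈⟨ *-cong₁ (proj₂ (γ j) (γ₁ i)) ⟩
        γ₁ i * γ₁ j * c⟦ js ⟧      ≈⟨ *-assoc _ _ _ ⟩
        γ₁ i * (γ₁ j * c⟦ js ⟧)    ∎
        where
        γ₁ : Fin m → Carrier
        γ₁ i = proj₁ (γ i)

      mergeFin-sound : ∀ is js → c⟦ mergeFin is js ⟧ ≈ c⟦ is ⟧ * c⟦ js ⟧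
      mergeFin-sound []       js = ≈-sym (*-identityˡ _)
      mergeFin-sound (i ∷ is) js = ≈-trans (insertFin-sound i (mergeFin is js))
        (≈-trans (*-cong₂ (mergeFin-sound is js)) (≈-sym (*-assoc _ _ _)))

      ++-sound : ∀ v w → w⟦ v ++ w ⟧ ≈ w⟦ v ⟧ * w⟦ w ⟧
      ++-sound []      w = ≈-sym (*-identityˡ _)
      ++-sound (i ∷ v) w = ≈-trans (*-cong₂ (++-sound v w)) (≈-sym (*-assoc _ _ _))

      exchange : ∀ a b c d → Central b → (a * c) * (b * d) ≈ (a * b) * (c * d)
      exchange a b c d cb = begin
        (a * c) * (b * d) ≈⟨ *-assoc a c _ ⟩
        a * (c * (b * d)) ≈⟨ *-cong₂ (≈-sym (*-assoc c b d)) ⟩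
        a * ((c * b) * d) ≈⟨ *-cong₂ (*-cong₁ (≈-sym (cb c))) ⟩
        a * ((b * c) * d) ≈⟨ *-cong₂ (*-assoc b c d) ⟩
        a * (b * (c * d)) ≈⟨ ≈-sym (*-assoc a b _) ⟩
        (a * b) * (c * d) ∎

      ⊛-sound : ∀ a b → m⟦ a ⊛ b ⟧ ≈ m⟦ a ⟧ * m⟦ b ⟧
      ⊛-sound (k , c , w) (k' , c' , w') = begin
        ι (k ℤ.* k') * (c⟦ mergeFin c c' ⟧ * w⟦ w ++ w' ⟧)
          ≈⟨ *-cong (ι-* k k') (*-cong (mergeFin-sound c c') (++-sound w w')) ⟩
        (ι k * ι k') * ((c⟦ c ⟧ * c⟦ c' ⟧) * (w⟦ w ⟧ * w⟦ w' ⟧))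
          ≈⟨ *-cong₂ (≈-sym (exchange _ _ _ _ (c-central c'))) ⟩
        (ι k * ι k') * ((c⟦ c ⟧ * w⟦ w ⟧) * (c⟦ c' ⟧ * w⟦ w' ⟧))
          ≈⟨ ≈-sym (exchange _ _ _ _ (ι-central k')) ⟩
        m⟦ k , c , w ⟧ * m⟦ k' , c' , w' ⟧ ∎

      swap : ∀ a b c → a + (b + c) ≈ b + (a + c)
      swap a b c = ≈-trans (≈-sym (+-assoc a b c)) (≈-trans (+-cong₁ (+-comm a b)) (+-assoc b a c))

      insert-sound : ∀ a l → l⟦ insert a l ⟧ ≈ m⟦ a ⟧ + l⟦ l ⟧
      insert-sound a [] = ≈-refl
      insert-sound (k , c , w) ((k' , c' , w') ∷ l) with sameWord? c c' | sameWord? w w'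
      ... | yes refl | yes refl = ≈-trans (+-cong₁ (≈-trans (*-cong₁ (ι-+ k k')) (*-distribʳ _ _ _))) (+-assoc _ _ _)
      ... | yes _ | no _ with lessFin w w'
      ...   | true  = ≈-refl
      ...   | false = ≈-trans (+-cong₂ (insert-sound (k , c , w) l)) (swap _ _ _)
      insert-sound (k , c , w) ((k' , c' , w') ∷ l) | no _ | _ with lessFin c c'
      ...   | true  = ≈-refl
      ...   | false = ≈-trans (+-cong₂ (insert-sound (k , c , w) l)) (swap _ _ _)

      merge-sound : ∀ k l → l⟦ merge k l ⟧ ≈ l⟦ k ⟧ + l⟦ l ⟧
      merge-sound []      l = ≈-sym (+-identityˡ _)
      merge-sound (a ∷ k) l = ≈-trans (insert-sound a (merge k l)) (≈-trans (+-cong₂ (merge-sound k l)) (≈-sym (+-assoc _ _ _)))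

      timesMonomial-sound : ∀ a l → l⟦ timesMonomial a l ⟧ ≈ m⟦ a ⟧ * l⟦ l ⟧
      timesMonomial-sound a []      = ≈-sym (*-zeroʳ _)
      timesMonomial-sound a (b ∷ l) = ≈-trans (insert-sound (a ⊛ b) (timesMonomial a l))
        (≈-trans (+-cong (⊛-sound a b) (timesMonomial-sound a l)) (≈-sym (*-distribˡ _ _ _)))

      times-sound : ∀ k l → l⟦ times k l ⟧ ≈ l⟦ k ⟧ * l⟦ l ⟧
      times-sound []      l = ≈-sym (*-zeroˡ _)
      times-sound (a ∷ k) l = ≈-trans (merge-sound (timesMonomial a l) (times k l))
        (≈-trans (+-cong (timesMonomial-sound a l) (times-sound k l)) (≈-sym (*-distribʳ _ _ _)))

      dropZeros-sound : ∀ l → l⟦ dropZeros l ⟧ ≈ l⟦ l ⟧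
      dropZeros-sound []                      = ≈-refl
      dropZeros-sound ((+ 0 , _) ∷ l)         = ≈-trans (dropZeros-sound l)
        (≈-sym (≈-trans (+-cong₁ (*-zeroˡ _)) (+-identityˡ _)))
      dropZeros-sound ((+ (suc _) , _) ∷ l)   = +-cong₂ (dropZeros-sound l)
      dropZeros-sound ((-[1+ _ ] , _) ∷ l)    = +-cong₂ (dropZeros-sound l)

      normal-sound : ∀ e → l⟦ normal e ⟧ ≈ ⟦ e ⟧ env
      normal-sound (con x)        = ≈-trans (+-identityʳ _) (≈-trans (*-cong₂ (*-identityˡ _)) (*-identityʳ _))
      normal-sound (var (inj₁ i)) = ≈-trans (+-identityʳ _) (≈-trans (*-identityˡ _) (≈-trans (*-identityʳ _) (*-identityʳ _)))
      normal-sound (var (inj₂ j)) = ≈-trans (+-identityʳ _) (≈-trans (*-identityˡ _) (≈-trans (*-identityˡ _) (*-identityʳ _)))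
      normal-sound (e :+ f)       = ≈-trans (merge-sound (normal e) (normal f)) (+-cong (normal-sound e) (normal-sound f))
      normal-sound (e :* f)       = ≈-trans (times-sound (normal e) (normal f)) (*-cong (normal-sound e) (normal-sound f))

    prove : ∀ e f → normalise e ≡ normalise f → ⟦ e ⟧ env ≈ ⟦ f ⟧ env
    prove e f h = begin
      ⟦ e ⟧ env          ≈⟨ ≈-sym (normal-sound e) ⟩
      l⟦ normal e ⟧      ≈⟨ ≈-sym (dropZeros-sound (normal e)) ⟩
      l⟦ normalise e ⟧   ≡⟨ cong l⟦_⟧ h ⟩
      l⟦ normalise f ⟧   ≈⟨ dropZeros-sound (normal f) ⟩
      l⟦ normal f ⟧      ≈⟨ normal-sound f ⟩
      ⟦ f ⟧ env          ∎

  solve : ∀ {n} (ρ : Vec Carrier n) (e f : Expr (Fin 0 ⊎ Fin n)) → normalise e ≡ normalise f → _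
  solve ρ = prove {0} (λ ()) (Vec.lookup ρ)

  solveᶜ : ∀ {m n} (γ : Vec (∃ Central) m) (ρ : Vec Carrier n) (e f : Expr (Fin m ⊎ Fin n)) → normalise e ≡ normalise f → _
  solveᶜ γ ρ = prove (Vec.lookup γ) (Vec.lookup ρ)

x₀ : ∀ {m n} → Expr (Fin m ⊎ Fin (0 ℕ.+ suc n))
x₀ = var (inj₂ (0 Fin.↑ʳ zero))
x₁ : ∀ {m n} → Expr (Fin m ⊎ Fin (1 ℕ.+ suc n))
x₁ = var (inj₂ (1 Fin.↑ʳ zero))
x₂ : ∀ {m n} → Expr (Fin m ⊎ Fin (2 ℕ.+ suc n))
x₂ = var (inj₂ (2 Fin.↑ʳ zero))
x₃ : ∀ {m n} → Expr (Fin m ⊎ Fin (3 ℕ.+ suc n))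
x₃ = var (inj₂ (3 Fin.↑ʳ zero))
x₄ : ∀ {m n} → Expr (Fin m ⊎ Fin (4 ℕ.+ suc n))
x₄ = var (inj₂ (4 Fin.↑ʳ zero))
x₅ : ∀ {m n} → Expr (Fin m ⊎ Fin (5 ℕ.+ suc n))
x₅ = var (inj₂ (5 Fin.↑ʳ zero))
x₆ : ∀ {m n} → Expr (Fin m ⊎ Fin (6 ℕ.+ suc n))
x₆ = var (inj₂ (6 Fin.↑ʳ zero))
c₀ : ∀ {m n} → Expr (Fin (0 ℕ.+ suc m) ⊎ Fin n)
c₀ = var (inj₁ (0 Fin.↑ʳ zero))
c₁ : ∀ {m n} → Expr (Fin (1 ℕ.+ suc m) ⊎ Fin n)
c₁ = var (inj₁ (1 Fin.↑ʳ zero))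
c₂ : ∀ {m n} → Expr (Fin (2 ℕ.+ suc m) ⊎ Fin n)
c₂ = var (inj₁ (2 Fin.↑ʳ zero))
c₃ : ∀ {m n} → Expr (Fin (3 ℕ.+ suc m) ⊎ Fin n)
c₃ = var (inj₁ (3 Fin.↑ʳ zero))
c₄ : ∀ {m n} → Expr (Fin (4 ℕ.+ suc m) ⊎ Fin n)
c₄ = var (inj₁ (4 Fin.↑ʳ zero))
c₅ : ∀ {m n} → Expr (Fin (5 ℕ.+ suc m) ⊎ Fin n)
c₅ = var (inj₁ (5 Fin.↑ʳ zero))
c₆ : ∀ {m n} → Expr (Fin (6 ℕ.+ suc m) ⊎ Fin n)
c₆ = var (inj₁ (6 Fin.↑ʳ zero))
c₇ : ∀ {m n} → Expr (Fin (7 ℕ.+ suc m) ⊎ Fin n)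
c₇ = var (inj₁ (7 Fin.↑ʳ zero))
c₈ : ∀ {m n} → Expr (Fin (8 ℕ.+ suc m) ⊎ Fin n)
c₈ = var (inj₁ (8 Fin.↑ʳ zero))
c₉ : ∀ {m n} → Expr (Fin (9 ℕ.+ suc m) ⊎ Fin n)
c₉ = var (inj₁ (9 Fin.↑ʳ zero))

infixl 6 _:-_
_:-_ : ∀ {K} → Expr K → Expr K → Expr K
e :- f = e :+ con -[1+ 0 ] :* f

-- Powers, geometric sums and expansions at t = 1

module AlgebraPowers (A : Algebra) where
  open Algebra A
  open Solver A
  open Reasoning

  ^-sucʳ : ∀ a n → a ^ suc n ≈ a ^ n * a
  ^-sucʳ a zero    = solve (a ∷ []) (x₀ :* con (+ 1)) (con (+ 1) :* x₀) refl
  ^-sucʳ a (suc n) = ≈-trans (*-cong₂ (^-sucʳ a n)) (≈-sym (*-assoc a (a ^ n) a))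

  ^-+ : ∀ a m n → a ^ (m ℕ.+ n) ≈ a ^ m * a ^ n
  ^-+ a zero    n = ≈-sym (*-identityˡ _)
  ^-+ a (suc m) n = ≈-trans (*-cong₂ (^-+ a m n)) (≈-sym (*-assoc a (a ^ m) (a ^ n)))

  commute-^ : ∀ a b n → a * b ≈ b * a → a * b ^ n ≈ b ^ n * a
  commute-^ a b zero    h = ≈-sym (ι-central (+ 1) a)
  commute-^ a b (suc n) h = begin
    a * (b * b ^ n) ≈⟨ ≈-sym (*-assoc a b _) ⟩
    a * b * b ^ n   ≈⟨ *-cong₁ h ⟩
    b * a * b ^ n   ≈⟨ *-assoc b a _ ⟩
    b * (a * b ^ n) ≈⟨ *-cong₂ (commute-^ a b n h) ⟩
    b * (b ^ n * a) ≈⟨ ≈-sym (*-assoc b _ a) ⟩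
    b * b ^ n * a   ∎

  ^-distrib-* : ∀ a b n → a * b ≈ b * a → (a * b) ^ n ≈ a ^ n * b ^ n
  ^-distrib-* a b zero    h = ≈-sym (*-identityˡ _)
  ^-distrib-* a b (suc n) h = begin
    a * b * (a * b) ^ n       ≈⟨ *-cong₂ (^-distrib-* a b n h) ⟩
    a * b * (a ^ n * b ^ n)   ≈⟨ solve (a ∷ b ∷ a ^ n ∷ b ^ n ∷ []) (x₀ :* x₁ :* (x₂ :* x₃)) (x₀ :* (x₁ :* x₂) :* x₃) refl ⟩
    a * (b * a ^ n) * b ^ n   ≈⟨ *-cong₁ (*-cong₂ (commute-^ b a n (≈-sym h))) ⟩
    a * (a ^ n * b) * b ^ n   ≈⟨ solve (a ∷ b ∷ a ^ n ∷ b ^ n ∷ []) (x₀ :* (x₂ :* x₁) :* x₃) (x₀ :* x₂ :* (x₁ :* x₃)) refl ⟩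
    a * a ^ n * (b * b ^ n)   ∎

  ^-* : ∀ a m n → a ^ (m ℕ.* n) ≈ (a ^ n) ^ m
  ^-* a zero    n = ≈-refl
  ^-* a (suc m) n = ≈-trans (^-+ a n (m ℕ.* n)) (*-cong₂ (^-* a m n))

  ι-^ : ∀ x n → ι (x ℤ.^ n) ≈ ι x ^ n
  ι-^ x zero    = ≈-refl
  ι-^ x (suc n) = ≈-trans (ι-* x (x ℤ.^ n)) (*-cong₂ (ι-^ x n))

  central-^ : ∀ {a} n → Central a → Central (a ^ n)
  central-^ n h x = ≈-sym (commute-^ x _ n (≈-sym (h x)))

  a-a≈0 : ∀ a → a - a ≈ ι (+ 0)
  a-a≈0 a = solve (a ∷ []) (x₀ :- x₀) (con (+ 0)) refl

  a-b≈c⇒a≈b+c : ∀ {a b c} → a - b ≈ c → a ≈ b + c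
  a-b≈c⇒a≈b+c {a} {b} h = ≈-trans (solve (a ∷ b ∷ []) x₀ (x₁ :+ (x₀ :- x₁)) refl) (+-cong₂ h)

  a≈b+c⇒a-b≈c : ∀ {a b c} → a ≈ b + c → a - b ≈ c
  a≈b+c⇒a-b≈c {a} {b} {c} h = ≈-trans (+-cong₁ h) (solve (b ∷ c ∷ []) ((x₀ :+ x₁) :- x₀) x₁ refl)

  geometric : Carrier → ℕ → Carrier
  geometric t zero    = ι (+ 0)
  geometric t (suc n) = geometric t n + t ^ n

  [1-t]*geometric : ∀ t n → (ι (+ 1) - t) * geometric t n ≈ ι (+ 1) - t ^ n
  [1-t]*geometric t zero    = solve (t ∷ []) ((con (+ 1) :- x₀) :* con (+ 0)) (con (+ 1) :- con (+ 1)) refl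
  [1-t]*geometric t (suc n) = begin
    (ι (+ 1) - t) * (geometric t n + t ^ n)              ≈⟨ *-distribˡ _ _ _ ⟩
    (ι (+ 1) - t) * geometric t n + (ι (+ 1) - t) * t ^ n ≈⟨ +-cong₁ ([1-t]*geometric t n) ⟩
    (ι (+ 1) - t ^ n) + (ι (+ 1) - t) * t ^ n            ≈⟨ solve (t ∷ t ^ n ∷ []) ((con (+ 1) :- x₁) :+ (con (+ 1) :- x₀) :* x₁) (con (+ 1) :- x₀ :* x₁) refl ⟩
    ι (+ 1) - t * t ^ n                                  ∎

  geometric-commute : ∀ t n → t * geometric t n ≈ geometric t n * t
  geometric-commute t zero    = ≈-sym (ι-central (+ 0) t)
  geometric-commute t (suc n) = ≈-trans (*-distribˡ _ _ _) (≈-trans (+-cong (geometric-commute t n) (^-sucʳ t n)) (≈-sym (*-distribʳ _ _ _)))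

  geometric-invariant : ∀ t n → t ^ n ≈ ι (+ 1) → ∀ k → geometric t n * t ^ k ≈ geometric t n
  geometric-invariant t n h zero    = *-identityʳ _
  geometric-invariant t n h (suc k) = begin
    geometric t n * (t * t ^ k)   ≈⟨ ≈-sym (*-assoc _ _ _) ⟩
    geometric t n * t * t ^ k     ≈⟨ *-cong₁ once ⟩
    geometric t n * t ^ k         ≈⟨ geometric-invariant t n h k ⟩
    geometric t n                 ∎
    where
    once : geometric t n * t ≈ geometric t n
    once = begin
      geometric t n * t         ≈⟨ ≈-sym (geometric-commute t n) ⟩
      t * geometric t n         ≈⟨ solve (t ∷ geometric t n ∷ []) (x₀ :* x₁) (x₁ :- (con (+ 1) :- x₀) :* x₁) refl ⟩
      geometric t n - (ι (+ 1) - t) * geometric t n ≈⟨ +-cong₂ (*-cong₂ (≈-trans ([1-t]*geometric t n) (≈-trans (+-cong₂ (*-cong₂ h)) (a-a≈0 _)))) ⟩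
      geometric t n - ι (+ 0)   ≈⟨ solve (geometric t n ∷ []) (x₀ :- con (+ 0)) x₀ refl ⟩
      geometric t n             ∎

  -- The second-order expansion at `t = 1` is the source of the derivative in the bound over `Z_p`.
  taylor-^ : ∀ t n → ∃ λ B → t ^ n ≈ ι (+ 1) + ι (+ n) * (t - ι (+ 1)) + (t - ι (+ 1)) ^ 2 * B
  taylor-^ t zero    = ι (+ 0) , solve (t ∷ []) (con (+ 1))
    (con (+ 1) :+ con (+ 0) :* (x₀ :- con (+ 1)) :+ (x₀ :- con (+ 1)) :* ((x₀ :- con (+ 1)) :* con (+ 1)) :* con (+ 0)) refl
  taylor-^ t (suc n) = step (taylor-^ t n)
    where
    step : (∃ λ B → t ^ n ≈ ι (+ 1) + ι (+ n) * (t - ι (+ 1)) + (t - ι (+ 1)) ^ 2 * B) →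
      ∃ λ B → t ^ suc n ≈ ι (+ 1) + ι (+ suc n) * (t - ι (+ 1)) + (t - ι (+ 1)) ^ 2 * B
    step (B , h) = ι (+ n) + t * B , (begin
      t * t ^ n ≈⟨ *-cong₂ h ⟩
      t * (ι (+ 1) + ι (+ n) * (t - ι (+ 1)) + (t - ι (+ 1)) ^ 2 * B)
        ≈⟨ solveᶜ ((ι (+ n) , ι-central (+ n)) ∷ []) (t ∷ B ∷ [])
             (x₀ :* (con (+ 1) :+ c₀ :* (x₀ :- con (+ 1)) :+ (x₀ :- con (+ 1)) :* ((x₀ :- con (+ 1)) :* con (+ 1)) :* x₁))
             (con (+ 1) :+ (con (+ 1) :+ c₀) :* (x₀ :- con (+ 1)) :+ (x₀ :- con (+ 1)) :* ((x₀ :- con (+ 1)) :* con (+ 1)) :* (c₀ :+ x₀ :* x₁)) refl ⟩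
      ι (+ 1) + (ι (+ 1) + ι (+ n)) * (t - ι (+ 1)) + (t - ι (+ 1)) ^ 2 * (ι (+ n) + t * B)
        ≈⟨ +-cong₁ (+-cong₂ (*-cong₁ (≈-sym (ι-+ (+ 1) (+ n))))) ⟩
      ι (+ 1) + ι (+ suc n) * (t - ι (+ 1)) + (t - ι (+ 1)) ^ 2 * (ι (+ n) + t * B) ∎)

  -- Used with `x` and the exponent both equal to the prime `p`: then every term after the power of
  -- `w` is a multiple of `p²`.
  binomial₂ : ∀ x a w n → a * w ≈ w * a →
    ∃ λ V → (ι x * a + w) ^ suc n ≈ w ^ suc n + ι (+ suc n) * (ι x * (a * w ^ n)) + ι x * (ι x * V)
  binomial₂ x a w zero    h = ι (+ 0) , solveᶜ ((ι x , ι-central x) ∷ []) (a ∷ w ∷ [])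
    ((c₀ :* x₀ :+ x₁) :* con (+ 1)) (x₁ :* con (+ 1) :+ con (+ 1) :* (c₀ :* (x₀ :* con (+ 1))) :+ c₀ :* (c₀ :* con (+ 0))) refl
  binomial₂ x a w (suc n) h = step (binomial₂ x a w n h)
    where
    N : Carrier
    N = ι (+ suc n)
    step : (∃ λ V → (ι x * a + w) ^ suc n ≈ w ^ suc n + N * (ι x * (a * w ^ n)) + ι x * (ι x * V)) →
      ∃ λ V → (ι x * a + w) ^ suc (suc n) ≈ w ^ suc (suc n) + ι (+ suc (suc n)) * (ι x * (a * w ^ suc n)) + ι x * (ι x * V)
    step (V , e) = N * (a * (a * w ^ n)) + (ι x * a + w) * V , (begin
      (ι x * a + w) * (ι x * a + w) ^ suc n ≈⟨ *-cong₂ e ⟩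
      (ι x * a + w) * (w ^ suc n + N * (ι x * (a * w ^ n)) + ι x * (ι x * V))
        ≈⟨ solveᶜ ((ι x , ι-central x) ∷ (N , ι-central (+ suc n)) ∷ []) (a ∷ w ∷ w ^ n ∷ V ∷ [])
             ((c₀ :* x₀ :+ x₁) :* (x₁ :* x₂ :+ c₁ :* (c₀ :* (x₀ :* x₂)) :+ c₀ :* (c₀ :* x₃)))
             ((x₁ :* (x₁ :* x₂) :+ c₀ :* (x₀ :* (x₁ :* x₂)) :+ c₁ :* (c₀ :* ((x₁ :* x₀) :* x₂))) :+ c₀ :* (c₀ :* (c₁ :* (x₀ :* (x₀ :* x₂)) :+ (c₀ :* x₀ :+ x₁) :* x₃))) refl ⟩
      (w ^ suc (suc n) + ι x * (a * w ^ suc n) + N * (ι x * ((w * a) * w ^ n))) + ι x * (ι x * (N * (a * (a * w ^ n)) + (ι x * a + w) * V))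
        ≈⟨ +-cong₁ (+-cong₂ (*-cong₂ (*-cong₂ (≈-trans (*-cong₁ (≈-sym h)) (*-assoc a w (w ^ n)))))) ⟩
      (w ^ suc (suc n) + ι x * (a * w ^ suc n) + N * (ι x * (a * w ^ suc n))) + ι x * (ι x * (N * (a * (a * w ^ n)) + (ι x * a + w) * V))
        ≈⟨ +-cong₁ (solve (w ^ suc (suc n) ∷ ι x * (a * w ^ suc n) ∷ N ∷ []) (x₀ :+ x₁ :+ x₂ :* x₁) (x₀ :+ (con (+ 1) :+ x₂) :* x₁) refl) ⟩
      (w ^ suc (suc n) + (ι (+ 1) + N) * (ι x * (a * w ^ suc n))) + ι x * (ι x * (N * (a * (a * w ^ n)) + (ι x * a + w) * V))
        ≈⟨ +-cong₁ (+-cong₂ (*-cong₁ (≈-sym (ι-+ (+ 1) (+ suc n))))) ⟩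
      _ ∎)

  -- `1 + 2t + … + n t^(n-1)`, the derivative of `1 + t + … + t^n`. Its value `n(n+1)/2` at `t = 1`
  -- later decides a valuation.
  κ : Carrier → ℕ → Carrier
  κ t zero    = ι (+ 0)
  κ t (suc n) = κ t n + ι (+ suc n) * t ^ n

  -- The left side and its derivative in `t` both vanish at `t = 1`; `κ` is the explicit quotient by
  -- `(1 - t)²`.
  double-root : ∀ t n → ι (+ 1) - ι (+ suc n) * t ^ n + ι (+ n) * t ^ suc n ≈ (ι (+ 1) - t) * ((ι (+ 1) - t) * κ t n)
  double-root t zero    = solve (t ∷ []) (con (+ 1) :- con (+ 1) :* con (+ 1) :+ con (+ 0) :* (x₀ :* con (+ 1))) ((con (+ 1) :- x₀) :* ((con (+ 1) :- x₀) :* con (+ 0))) refl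
  double-root t (suc n) = begin
    ι (+ 1) - ι (+ suc (suc n)) * t ^ suc n + N * t ^ suc (suc n)
      ≈⟨ +-cong₁ (+-cong₂ (*-cong₂ (*-cong₁ (ι-+ (+ 1) (+ suc n))))) ⟩
    ι (+ 1) - (ι (+ 1) + N) * t ^ suc n + N * t ^ suc (suc n)
      ≈⟨ solveᶜ ((N , ι-central (+ suc n)) ∷ []) (t ∷ t ^ n ∷ [])
           (con (+ 1) :- (con (+ 1) :+ c₀) :* (x₀ :* x₁) :+ c₀ :* (x₀ :* (x₀ :* x₁)))
           ((con (+ 1) :- c₀ :* x₁ :+ (c₀ :- con (+ 1)) :* (x₀ :* x₁)) :+ (con (+ 1) :- x₀) :* ((con (+ 1) :- x₀) :* (c₀ :* x₁))) refl ⟩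
    (ι (+ 1) - N * t ^ n + (N - ι (+ 1)) * t ^ suc n) + (ι (+ 1) - t) * ((ι (+ 1) - t) * (N * t ^ n))
      ≈⟨ +-cong₁ (≈-trans (+-cong₂ (*-cong₁ (a≈b+c⇒a-b≈c (ι-+ (+ 1) (+ n))))) (double-root t n)) ⟩
    (ι (+ 1) - t) * ((ι (+ 1) - t) * κ t n) + (ι (+ 1) - t) * ((ι (+ 1) - t) * (N * t ^ n))
      ≈⟨ solve (t ∷ κ t n ∷ N * t ^ n ∷ []) ((con (+ 1) :- x₀) :* ((con (+ 1) :- x₀) :* x₁) :+ (con (+ 1) :- x₀) :* ((con (+ 1) :- x₀) :* x₂))
           ((con (+ 1) :- x₀) :* ((con (+ 1) :- x₀) :* (x₁ :+ x₂))) refl ⟩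
    (ι (+ 1) - t) * ((ι (+ 1) - t) * (κ t n + N * t ^ n)) ∎
    where
    N : Carrier
    N = ι (+ suc n)

-- Binomial coefficients modulo a prime and Jacobson's formula

module Binomials where

  bin : ℕ → ℕ → ℕ
  bin zero    zero    = 1
  bin zero    (suc k) = 0
  bin (suc n) zero    = 1
  bin (suc n) (suc k) = bin n k ℕ.+ bin n (suc k)

  bin-0 : ∀ n → bin n 0 ≡ 1
  bin-0 zero    = refl
  bin-0 (suc n) = refl

  bin-> : ∀ n k → n ℕ.< k → bin n k ≡ 0
  bin-> zero    (suc k) h         = refl
  bin-> (suc n) (suc k) (ℕ.s≤s h) = cong₂ ℕ._+_ (bin-> n k h) (bin-> n (suc k) (ℕₚ.m<n⇒m<1+n h))

  bin-n : ∀ n → bin n n ≡ 1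
  bin-n zero    = refl
  bin-n (suc n) = cong₂ ℕ._+_ (bin-n n) (bin-> n (suc n) ℕₚ.≤-refl)

  absorption : ∀ n k → suc k ℕ.* bin (suc n) (suc k) ≡ suc n ℕ.* bin n k
  absorption zero    zero    = refl
  absorption zero    (suc k) = ℕₚ.*-zeroʳ (suc (suc k))
  absorption (suc n) zero    = cong suc (≡.trans (absorption n zero) (cong (suc n ℕ.*_) (bin-0 n)))
  absorption (suc n) (suc k) = ≡.trans (expand k B C) (≡.trans (cong₂ (λ x y → B ℕ.+ (x ℕ.+ y)) (absorption n k) (absorption n (suc k)))
    (collect n (bin n k) (bin n (suc k))))
    where
    B C : ℕ
    B = bin (suc n) (suc k)
    C = bin (suc n) (suc (suc k))
    expand : ∀ k b c → suc (suc k) ℕ.* (b ℕ.+ c) ≡ b ℕ.+ (suc k ℕ.* b ℕ.+ suc (suc k) ℕ.* c)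
    expand = ℕSolver.solve-∀
    collect : ∀ n a b → (a ℕ.+ b) ℕ.+ (suc n ℕ.* a ℕ.+ suc n ℕ.* b) ≡ suc (suc n) ℕ.* (a ℕ.+ b)
    collect = ℕSolver.solve-∀

  -- In `(k+1) C(p, k+1) = p C(p-1, k)` the factor `k + 1 < p` is prime to `p`.
  prime∣bin : ∀ {q} → Prime (suc q) → ∀ k → k ℕ.< q → suc q ℕᵈ.∣ bin (suc q) (suc k)
  prime∣bin {q} pr k k<q = case euclidsLemma (suc k) (bin (suc q) (suc k)) pr
      (≡.subst (suc q ℕᵈ.∣_) (≡.sym (absorption q k)) (ℕᵈ.m∣m*n (bin q k))) of λ where
    (inj₁ d) → ⊥-elim (ℕₚ.<⇒≱ (ℕ.s≤s k<q) (ℕᵈ.∣⇒≤ d))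
    (inj₂ d) → d

  private
    to-ℤ : ∀ {a b c} → 1 ℕ.+ a ℕ.* b ≡ c → + 1 ℤ.+ + a ℤ.* + b ≡ + c
    to-ℤ {a} {b} h = ≡.trans (cong (λ x → + 1 ℤ.+ x) (≡.sym (ℤₚ.pos-* a b))) (cong +_ h)

  inverse-mod : ∀ {p n} → Prime p → ¬ p ℕᵈ.∣ n → ∃ λ u → ∃ λ v → u ℤ.* + n ℤ.+ v ℤ.* + p ≡ + 1
  inverse-mod {p} {n} pr p∤n = case coprime-Bézout coprime of λ where
      (Bézout.+- x y e) → + x , ℤ.- + y , minus {y = y} (≡.trans (to-ℤ {y} {p} e) (ℤₚ.pos-* x n))
      (Bézout.-+ x y e) → ℤ.- + x , + y , minus′ {x = x} (≡.trans (to-ℤ {x} {n} e) (ℤₚ.pos-* y p))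
    where
    coprime : Coprime n p
    coprime (d∣n , d∣p) = case prime⇒irreducible pr d∣p of λ where
      (inj₁ e) → e
      (inj₂ e) → ⊥-elim (p∤n (≡.subst (ℕᵈ._∣ n) e d∣n))
    cancel : ∀ a b → + 1 ℤ.+ b ≡ a → a ℤ.- b ≡ + 1
    cancel a b h = ≡.trans (cong (ℤ._- b) (≡.sym h)) (arith b)
      where
      arith : ∀ b → + 1 ℤ.+ b ℤ.- b ≡ + 1
      arith = solve-∀
    minus : ∀ {a y} → + 1 ℤ.+ + y ℤ.* + p ≡ a → a ℤ.+ (ℤ.- + y) ℤ.* + p ≡ + 1
    minus {a} {y} h = ≡.trans (cong (λ x → a ℤ.+ x) (≡.sym (ℤₚ.neg-distribˡ-* (+ y) (+ p)))) (cancel a _ h)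
    minus′ : ∀ {b x} → + 1 ℤ.+ + x ℤ.* + n ≡ b → (ℤ.- + x) ℤ.* + n ℤ.+ b ≡ + 1
    minus′ {b} {x} h = ≡.trans (ℤₚ.+-comm ((ℤ.- + x) ℤ.* + n) b)
      (≡.trans (cong (λ z → b ℤ.+ z) (≡.sym (ℤₚ.neg-distribˡ-* (+ x) (+ n)))) (cancel b _ h))

open Binomials

iter : ∀ {V : Set} → ℕ → (V → V) → V → V
iter zero    f v = v
iter (suc n) f v = f (iter n f v)

module Pascal (A : Algebra) where
  open Algebra A
  open Solver A
  open AlgebraPowers A
  open Reasoning

  -- Σ_{k<m} c(k) x(i + (m-1-k), j + k)
  antidiagonal : (x : ℕ → ℕ → Carrier) → ℕ → (ℕ → ℕ) → ℕ → ℕ → Carrier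
  antidiagonal x zero    c i j = ι (+ 0)
  antidiagonal x (suc m) c i j = ι (+ c 0) * x (i ℕ.+ m) j + antidiagonal x m (c ∘ suc) i (suc j)

  -- One step of Pascal's rule: both sums run over `x (i + m - k) (j + k)`, with coefficients
  -- `c (k+1)` and `c k`. The hypothesis supplies the last coefficient that is missing from the
  -- first sum.
  antidiagonal-sum : ∀ x m c i j → c (suc m) ≡ 0 →
    antidiagonal x m (c ∘ suc) (suc i) j + antidiagonal x (suc m) c i j ≈ antidiagonal x (suc m) (λ k → c k ℕ.+ c (suc k)) i j
  antidiagonal-sum x zero c i j h = ≈-trans (+-identityˡ _)
    (+-cong₁ (*-cong₁ (≈-reflexive (cong (ι ∘ +_) (≡.trans (≡.sym (ℕₚ.+-identityʳ (c 0))) (cong (c 0 ℕ.+_) (≡.sym h)))))))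
  antidiagonal-sum x (suc m) c i j h = begin
    (ι (+ c 1) * x (suc i ℕ.+ m) j + antidiagonal x m ((λ k → c (suc (suc k)))) (suc i) (suc j)) + (ι (+ c 0) * x (i ℕ.+ suc m) j + antidiagonal x (suc m) (c ∘ suc) i (suc j))
      ≈⟨ +-cong₁ (+-cong₁ (*-cong₂ (≈-reflexive (cong (λ k → x k j) (≡.sym (ℕₚ.+-suc i m)))))) ⟩
    (ι (+ c 1) * x (i ℕ.+ suc m) j + antidiagonal x m ((λ k → c (suc (suc k)))) (suc i) (suc j)) + (ι (+ c 0) * x (i ℕ.+ suc m) j + antidiagonal x (suc m) (c ∘ suc) i (suc j))
      ≈⟨ solve (ι (+ c 0) ∷ ι (+ c 1) ∷ x (i ℕ.+ suc m) j ∷ antidiagonal x m ((λ k → c (suc (suc k)))) (suc i) (suc j) ∷ antidiagonal x (suc m) (c ∘ suc) i (suc j) ∷ []) ((x₁ :* x₂ :+ x₃) :+ (x₀ :* x₂ :+ x₄)) ((x₀ :+ x₁) :* x₂ :+ (x₃ :+ x₄)) refl ⟩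
    (ι (+ c 0) + ι (+ c 1)) * x (i ℕ.+ suc m) j + (antidiagonal x m ((λ k → c (suc (suc k)))) (suc i) (suc j) + antidiagonal x (suc m) (c ∘ suc) i (suc j))
      ≈⟨ +-cong (*-cong₁ (≈-sym (ι-+ (+ c 0) (+ c 1)))) (antidiagonal-sum x m (c ∘ suc) i (suc j) h) ⟩
    antidiagonal x (suc (suc m)) (λ k → c k ℕ.+ c (suc k)) i j ∎

  module _ (x : ℕ → ℕ → Carrier) where

    pascal : ℕ → ℕ → ℕ → Carrier
    pascal zero    i j = x i j
    pascal (suc n) i j = pascal n (suc i) j + pascal n i (suc j)

    pascal-binomial : ∀ n i j → pascal n i j ≈ antidiagonal x (suc n) (bin n) i j
    pascal-binomial zero    i j = begin
      x i j                             ≈⟨ solve (x i j ∷ []) x₀ (con (+ 1) :* x₀ :+ con (+ 0)) refl ⟩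
      ι (+ 1) * x i j + ι (+ 0)         ≡⟨ cong (λ k → ι (+ 1) * x k j + ι (+ 0)) (≡.sym (ℕₚ.+-identityʳ i)) ⟩
      ι (+ 1) * x (i ℕ.+ 0) j + ι (+ 0) ∎
    pascal-binomial (suc n) i j = begin
      pascal n (suc i) j + pascal n i (suc j)
        ≈⟨ +-cong (pascal-binomial n (suc i) j) (pascal-binomial n i (suc j)) ⟩
      (ι (+ bin n 0) * x (suc i ℕ.+ n) j + antidiagonal x n (bin n ∘ suc) (suc i) (suc j)) + antidiagonal x (suc n) (bin n) i (suc j)
        ≈⟨ +-assoc _ _ _ ⟩
      ι (+ bin n 0) * x (suc i ℕ.+ n) j + (antidiagonal x n (bin n ∘ suc) (suc i) (suc j) + antidiagonal x (suc n) (bin n) i (suc j))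
        ≈⟨ +-cong (≈-reflexive (cong₂ (λ y z → ι (+ y) * x z j) (bin-0 n) (≡.sym (ℕₚ.+-suc i n))))
             (antidiagonal-sum x n (bin n) i (suc j) (bin-> n (suc n) ℕₚ.≤-refl)) ⟩
      antidiagonal x (suc (suc n)) (bin (suc n)) i j ∎

    module _ {q : ℕ} (prime : Prime (suc q)) (char : ∀ a → ι (+ (suc q)) * a ≈ ι (+ 0)) where

      divisible-vanishes : ∀ k a → suc q ℕᵈ.∣ k → ι (+ k) * a ≈ ι (+ 0)
      divisible-vanishes k a (ℕᵈ.divides-refl m) = begin
        ι (+ (m ℕ.* suc q)) * a      ≈⟨ *-cong₁ (≈-trans (≈-reflexive (cong ι (ℤₚ.pos-* m (suc q)))) (ι-* (+ m) (+ suc q))) ⟩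
        ι (+ m) * ι (+ suc q) * a    ≈⟨ *-assoc _ _ _ ⟩
        ι (+ m) * (ι (+ suc q) * a)  ≈⟨ *-cong₂ (char a) ⟩
        ι (+ m) * ι (+ 0)            ≈⟨ *-zeroʳ _ ⟩
        ι (+ 0)                      ∎

      antidiagonal-last : ∀ m c i j → (∀ k → k ℕ.< m → suc q ℕᵈ.∣ c k) → c m ≡ 1 → antidiagonal x (suc m) c i j ≈ x i (j ℕ.+ m)
      antidiagonal-last zero c i j h e = begin
        ι (+ c 0) * x (i ℕ.+ 0) j + ι (+ 0) ≡⟨ cong₂ (λ y z → ι (+ y) * x z j + ι (+ 0)) e (ℕₚ.+-identityʳ i) ⟩
        ι (+ 1) * x i j + ι (+ 0)           ≈⟨ solve (x i j ∷ []) (con (+ 1) :* x₀ :+ con (+ 0)) x₀ refl ⟩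
        x i j                               ≡⟨ cong (x i) (≡.sym (ℕₚ.+-identityʳ j)) ⟩
        x i (j ℕ.+ 0)                       ∎
      antidiagonal-last (suc m) c i j h e = begin
        ι (+ c 0) * x (i ℕ.+ suc m) j + antidiagonal x (suc m) (c ∘ suc) i (suc j)
          ≈⟨ +-cong (divisible-vanishes (c 0) _ (h 0 (ℕ.s≤s ℕ.z≤n))) (antidiagonal-last m (c ∘ suc) i (suc j) (λ k l → h (suc k) (ℕ.s≤s l)) e) ⟩
        ι (+ 0) + x i (suc j ℕ.+ m) ≈⟨ +-identityˡ _ ⟩
        x i (suc j ℕ.+ m)           ≡⟨ cong (x i) (≡.sym (ℕₚ.+-suc j m)) ⟩
        x i (j ℕ.+ suc m)           ∎

      -- In characteristic `p` the inner binomial coefficients vanish, and only the two ends of the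
      -- antidiagonal remain.
      pascal-prime : ∀ i j → pascal (suc q) i j ≈ x (i ℕ.+ suc q) j + x i (suc j ℕ.+ q)
      pascal-prime i j = begin
        pascal (suc q) i j ≈⟨ pascal-binomial (suc q) i j ⟩
        ι (+ 1) * x (i ℕ.+ suc q) j + antidiagonal x (suc q) (bin (suc q) ∘ suc) i (suc j)
          ≈⟨ +-cong (*-identityˡ _) (antidiagonal-last q (bin (suc q) ∘ suc) i (suc j) (prime∣bin prime) (bin-n (suc q))) ⟩
        x (i ℕ.+ suc q) j + x i (suc j ℕ.+ q) ∎

  module Operators (Idx : Set) where

    V : Set
    V = Idx → Carrier

    infix 4 _≋_
    _≋_ : V → V → Set
    f ≋ g = ∀ i → f i ≈ g i

    _⊹_ : V → V → V
    (f ⊹ g) i = f i + g i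

    𝟘 : V
    𝟘 _ = ι (+ 0)

    record Additive (T : V → V) : Set where
      field
        op-cong : ∀ {f g} → f ≋ g → T f ≋ T g
        op-+    : ∀ f g → T (f ⊹ g) ≋ (T f ⊹ T g)
        op-0    : T 𝟘 ≋ 𝟘
    open Additive public

    iter-additive : ∀ {T} n → Additive T → Additive (iter n T)
    iter-additive zero    t = record { op-cong = id ; op-+ = λ f g i → ≈-refl ; op-0 = λ i → ≈-refl }
    iter-additive (suc n) t = record
      { op-cong = λ h → op-cong t (op-cong (iter-additive n t) h)
      ; op-+    = λ f g i → ≈-trans (op-cong t (op-+ (iter-additive n t) f g) i) (op-+ t _ _ i)
      ; op-0    = λ i → ≈-trans (op-cong t (op-0 (iter-additive n t)) i) (op-0 t i) }

    iter-commute : ∀ {S T} n → Additive S → Additive T → (∀ f → S (T f) ≋ T (S f)) → ∀ f → iter n S (T f) ≋ T (iter n S f)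
    iter-commute zero    s t h f i = ≈-refl
    iter-commute (suc n) s t h f i = ≈-trans (op-cong s (iter-commute n s t h f) i) (h _ i)

    iter-+ : ∀ (T : V → V) m n f i → iter m T (iter n T f) i ≡ iter (m ℕ.+ n) T f i
    iter-+ T m n f i = cong (λ g → g i) (go m)
      where
      go : ∀ m → iter m T (iter n T f) ≡ iter (m ℕ.+ n) T f
      go zero    = refl
      go (suc m) = cong T (go m)

    -- With L = R + E and RE = ER, d n = Σ_{k<n} L^k R^(n-1-k) v = (L^n - R^n)/(L - R) v,
    -- which in characteristic p is (L - R)^(p-1) v for n = p.
    module _ {q : ℕ} (prime : Prime (suc q)) (char : ∀ a → ι (+ (suc q)) * a ≈ ι (+ 0))
      {R E : V → V} (R-add : Additive R) (E-add : Additive E) (RE : ∀ f → R (E f) ≋ E (R f))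
      (v : V) (d : ℕ → V) (d-zero : d 0 ≋ 𝟘) (d-suc : ∀ n → d (suc n) ≋ ((R (d n) ⊹ E (d n)) ⊹ iter n R v)) where

      private
        T : ℕ → ℕ → ℕ → V
        T n i j = iter i R (iter j E (d n))

        -- `x u i j` stands for the value of `R^i E^(j-1) v` at `u`. The value at `j = 0` occurs on
        -- both sides of `T-pascal` alike and is set to 0.
        x : Idx → ℕ → ℕ → Carrier
        x u i zero    = ι (+ 0)
        x u i (suc j) = iter i R (iter j E v) u

        RᵢEⱼ : ∀ i j → Additive (iter i R ∘ iter j E)
        RᵢEⱼ i j = record
          { op-cong = λ h → op-cong (iter-additive i R-add) (op-cong (iter-additive j E-add) h)
          ; op-+ = λ f g u → ≈-trans (op-cong (iter-additive i R-add) (op-+ (iter-additive j E-add) f g) u) (op-+ (iter-additive i R-add) _ _ u)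
          ; op-0 = λ u → ≈-trans (op-cong (iter-additive i R-add) (op-0 (iter-additive j E-add)) u) (op-0 (iter-additive i R-add) u) }

        T-suc : ∀ n i j u → T (suc n) i j u ≈ (T n (suc i) j u + T n i (suc j) u) + x u (i ℕ.+ n) (suc j)
        T-suc n i j u = begin
          T (suc n) i j u ≈⟨ op-cong (RᵢEⱼ i j) (d-suc n) u ⟩
          (iter i R ∘ iter j E) ((R (d n) ⊹ E (d n)) ⊹ iter n R v) u ≈⟨ op-+ (RᵢEⱼ i j) _ _ u ⟩
          (iter i R ∘ iter j E) (R (d n) ⊹ E (d n)) u + (iter i R ∘ iter j E) (iter n R v) u ≈⟨ +-cong₁ (op-+ (RᵢEⱼ i j) _ _ u) ⟩
          (iter i R (iter j E (R (d n))) u + iter i R (iter j E (E (d n))) u) + iter i R (iter j E (iter n R v)) u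
            ≈⟨ +-cong (+-cong shiftR shiftE) shiftV ⟩
          _ ∎
          where
          shiftR : iter i R (iter j E (R (d n))) u ≈ iter (suc i) R (iter j E (d n)) u
          shiftR = ≈-trans (op-cong (iter-additive i R-add) (iter-commute j E-add R-add (λ f k → ≈-sym (RE f k)) (d n)) u)
            (iter-commute i R-add R-add (λ f k → ≈-refl) (iter j E (d n)) u)
          shiftE : iter i R (iter j E (E (d n))) u ≈ iter i R (iter (suc j) E (d n)) u
          shiftE = op-cong (iter-additive i R-add) (iter-commute j E-add E-add (λ f k → ≈-refl) (d n)) u
          EᵢRⱼ : ∀ n → iter j E (iter n R v) ≋ iter n R (iter j E v)
          EᵢRⱼ zero    k = ≈-refl
          EᵢRⱼ (suc n) k = ≈-trans (iter-commute j E-add R-add (λ f k → ≈-sym (RE f k)) (iter n R v) k) (op-cong R-add (EᵢRⱼ n) k)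
          shiftV : iter i R (iter j E (iter n R v)) u ≈ iter (i ℕ.+ n) R (iter j E v) u
          shiftV = ≈-trans (op-cong (iter-additive i R-add) (EᵢRⱼ n) u) (≈-reflexive (iter-+ R i n (iter j E v) u))

        -- Adding `x` absorbs the inhomogeneous term of `T-suc`, so that the sum obeys Pascal's rule
        -- exactly.
        T-pascal : ∀ u n i j → T n i j u + x u (i ℕ.+ n) j ≈ pascal (x u) n i j
        T-pascal u zero i j = ≈-trans (+-cong (≈-trans (op-cong (RᵢEⱼ i j) d-zero u) (op-0 (RᵢEⱼ i j) u))
            (≈-reflexive (cong (λ k → x u k j) (ℕₚ.+-identityʳ i)))) (+-identityˡ _)
        T-pascal u (suc n) i j = begin
          T (suc n) i j u + x u (i ℕ.+ suc n) j
            ≈⟨ +-cong (T-suc n i j u) (≈-reflexive (cong (λ k → x u k j) (ℕₚ.+-suc i n))) ⟩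
          ((T n (suc i) j u + T n i (suc j) u) + x u (i ℕ.+ n) (suc j)) + x u (suc i ℕ.+ n) j
            ≈⟨ solve (T n (suc i) j u ∷ T n i (suc j) u ∷ x u (i ℕ.+ n) (suc j) ∷ x u (suc i ℕ.+ n) j ∷ [])
                 (((x₀ :+ x₁) :+ x₂) :+ x₃) ((x₀ :+ x₃) :+ (x₁ :+ x₂)) refl ⟩
          (T n (suc i) j u + x u (suc i ℕ.+ n) j) + (T n i (suc j) u + x u (i ℕ.+ n) (suc j))
            ≈⟨ +-cong (T-pascal u n (suc i) j) (T-pascal u n i (suc j)) ⟩
          pascal (x u) (suc n) i j ∎

      power-difference : d (suc q) ≋ iter q E v
      power-difference u = begin
        d (suc q) u                   ≈⟨ ≈-sym (+-identityʳ _) ⟩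
        d (suc q) u + ι (+ 0)         ≈⟨ T-pascal u (suc q) 0 0 ⟩
        pascal (x u) (suc q) 0 0      ≈⟨ pascal-prime (x u) prime char 0 0 ⟩
        ι (+ 0) + iter q E v u        ≈⟨ +-identityˡ _ ⟩
        iter q E v u                  ∎

-- Polynomials over a noncommutative ring and the p-th power of a sum

-- Sequences ℕ → A stand for polynomials in a variable T; left and rightMul multiply by b + aT.
module Sequences (A : Algebra) (a b : Algebra.Carrier A) where
  open Algebra A
  open Solver A
  open AlgebraPowers A
  open Reasoning
  open Pascal.Operators A ℕ public

  shift : V → V
  shift f zero    = ι (+ 0)
  shift f (suc i) = f i

  shift-cong : ∀ {f g} → f ≋ g → shift f ≋ shift g
  shift-cong h zero    = ≈-refl
  shift-cong h (suc i) = h i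

  leftMul rightMul : V → V
  leftMul  f i = b * f i + a * shift f i
  rightMul f i = f i * b + shift f i * a

  one : V
  one zero    = ι (+ 1)
  one (suc _) = ι (+ 0)

  power : ℕ → V
  power n = iter n rightMul one

  rightMul-cong : ∀ {f g} → f ≋ g → rightMul f ≋ rightMul g
  rightMul-cong h i = +-cong (*-cong₁ (h i)) (*-cong₁ (shift-cong h i))

  shift-+ : ∀ f g → shift (f ⊹ g) ≋ (shift f ⊹ shift g)
  shift-+ f g zero    = ≈-sym (+-identityˡ _)
  shift-+ f g (suc i) = ≈-refl

  shift-0 : shift 𝟘 ≋ 𝟘
  shift-0 zero    = ≈-refl
  shift-0 (suc i) = ≈-refl

  rightMul-additive : Additive rightMul
  rightMul-additive = record
    { op-cong = rightMul-cong
    ; op-+ = λ f g i → ≈-trans (+-cong₂ (*-cong₁ (shift-+ f g i)))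
        (solve (f i ∷ g i ∷ shift f i ∷ shift g i ∷ a ∷ b ∷ []) ((x₀ :+ x₁) :* x₅ :+ (x₂ :+ x₃) :* x₄)
          ((x₀ :* x₅ :+ x₂ :* x₄) :+ (x₁ :* x₅ :+ x₃ :* x₄)) refl)
    ; op-0 = λ i → ≈-trans (+-cong₂ (*-cong₁ (shift-0 i))) (solve (a ∷ b ∷ []) (con (+ 0) :* x₁ :+ con (+ 0) :* x₀) (con (+ 0)) refl) }

  shift-rightMul : ∀ f → shift (rightMul f) ≋ rightMul (shift f)
  shift-rightMul f zero    = solve (a ∷ b ∷ []) (con (+ 0)) (con (+ 0) :* x₁ :+ con (+ 0) :* x₀) refl
  shift-rightMul f (suc i) = ≈-refl

  shift-leftMul : ∀ f → shift (leftMul f) ≋ leftMul (shift f)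
  shift-leftMul f zero    = solve (a ∷ b ∷ []) (con (+ 0)) (x₁ :* con (+ 0) :+ x₀ :* con (+ 0)) refl
  shift-leftMul f (suc i) = ≈-refl

  left-right : ∀ f → leftMul (rightMul f) ≋ rightMul (leftMul f)
  left-right f i = begin
    b * (f i * b + shift f i * a) + a * shift (rightMul f) i ≈⟨ +-cong₂ (*-cong₂ (shift-rightMul f i)) ⟩
    b * (f i * b + shift f i * a) + a * (shift f i * b + shift (shift f) i * a)
      ≈⟨ solve (f i ∷ shift f i ∷ shift (shift f) i ∷ a ∷ b ∷ [])
           (x₄ :* (x₀ :* x₄ :+ x₁ :* x₃) :+ x₃ :* (x₁ :* x₄ :+ x₂ :* x₃))
           ((x₄ :* x₀ :+ x₃ :* x₁) :* x₄ :+ (x₄ :* x₁ :+ x₃ :* x₂) :* x₃) refl ⟩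
    (b * f i + a * shift f i) * b + (b * shift f i + a * shift (shift f) i) * a ≈⟨ +-cong₂ (*-cong₁ (≈-sym (shift-leftMul f i))) ⟩
    leftMul f i * b + shift (leftMul f) i * a ∎

  leftMul-cong : ∀ {f g} → f ≋ g → leftMul f ≋ leftMul g
  leftMul-cong h i = +-cong (*-cong₂ (h i)) (*-cong₂ (shift-cong h i))

  -- A power commutes with its base. Comparing both ways of forming the next power gives the
  -- relations between coefficients used below.
  left-power : ∀ n → leftMul (power n) ≋ power (suc n)
  left-power zero zero          = solve (a ∷ b ∷ []) (x₁ :* con (+ 1) :+ x₀ :* con (+ 0)) (con (+ 1) :* x₁ :+ con (+ 0) :* x₀) refl
  left-power zero (suc zero)    = solve (a ∷ b ∷ []) (x₁ :* con (+ 0) :+ x₀ :* con (+ 1)) (con (+ 0) :* x₁ :+ con (+ 1) :* x₀) refl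
  left-power zero (suc (suc i)) = solve (a ∷ b ∷ []) (x₁ :* con (+ 0) :+ x₀ :* con (+ 0)) (con (+ 0) :* x₁ :+ con (+ 0) :* x₀) refl
  left-power (suc n) i = ≈-trans (left-right (power n) i) (rightMul-cong (left-power n) i)

  power-support : ∀ n k → power n (suc n ℕ.+ k) ≈ ι (+ 0)
  power-support zero    k = ≈-refl
  power-support (suc n) k = ≈-trans (+-cong (*-cong₁ (≈-trans (≈-reflexive (cong (power n ∘ suc) (≡.sym (ℕₚ.+-suc n k)))) (power-support n (suc k))))
      (*-cong₁ (power-support n k)))
    (solve (a ∷ b ∷ []) (con (+ 0) :* x₁ :+ con (+ 0) :* x₀) (con (+ 0)) refl)

  power-first : ∀ n → power n 0 ≈ b ^ n
  power-first zero    = ≈-refl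
  power-first (suc n) = ≈-trans (+-cong₁ (*-cong₁ (power-first n)))
    (≈-trans (solve (a ∷ b ∷ b ^ n ∷ []) (x₂ :* x₁ :+ con (+ 0) :* x₀) (x₂ :* x₁) refl) (≈-sym (^-sucʳ b n)))

  power-last : ∀ n → power n n ≈ a ^ n
  power-last zero    = ≈-refl
  power-last (suc n) = ≈-trans (+-cong (*-cong₁ (≈-trans (≈-reflexive (cong (power n ∘ suc) (≡.sym (ℕₚ.+-identityʳ n)))) (power-support n 0)))
      (*-cong₁ (power-last n)))
    (≈-trans (solve (a ∷ b ∷ a ^ n ∷ []) (con (+ 0) :* x₁ :+ x₂ :* x₀) (x₂ :* x₀) refl) (≈-sym (^-sucʳ a n)))

  sum : ℕ → V → Carrier
  sum zero    f = ι (+ 0)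
  sum (suc n) f = sum n f + f n

  sum-shift : ∀ n f → sum (suc n) (shift f) ≈ sum n f
  sum-shift zero    f = +-identityˡ _
  sum-shift (suc n) f = +-cong₁ (sum-shift n f)

  sum-rightMul : ∀ n f → sum (suc n) (rightMul f) ≈ sum (suc n) f * b + sum n f * a
  sum-rightMul n f = ≈-trans (linear (suc n)) (+-cong₂ (*-cong₁ (sum-shift n f)))
    where
    linear : ∀ n → sum n (rightMul f) ≈ sum n f * b + sum n (shift f) * a
    linear zero    = solve (a ∷ b ∷ []) (con (+ 0)) (con (+ 0) :* x₁ :+ con (+ 0) :* x₀) refl
    linear (suc n) = ≈-trans (+-cong₁ (linear n)) (solve (sum n f ∷ sum n (shift f) ∷ f n ∷ shift f n ∷ a ∷ b ∷ [])
      ((x₀ :* x₅ :+ x₁ :* x₄) :+ (x₂ :* x₅ :+ x₃ :* x₄)) ((x₀ :+ x₂) :* x₅ :+ (x₁ :+ x₃) :* x₄) refl)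

  -- Evaluation at `T = 1`; `k` admits summands beyond the degree, which are 0.
  sum-power : ∀ n k → sum (suc n ℕ.+ k) (power n) ≈ (a + b) ^ n
  sum-power zero    zero    = +-identityˡ _
  sum-power zero    (suc k) = ≈-trans (+-identityʳ _) (sum-power zero k)
  sum-power (suc n) k = begin
    sum (suc (suc n ℕ.+ k)) (rightMul (power n)) ≈⟨ sum-rightMul (suc n ℕ.+ k) (power n) ⟩
    sum (suc (suc n) ℕ.+ k) (power n) * b + sum (suc n ℕ.+ k) (power n) * a
      ≈⟨ +-cong (*-cong₁ (≈-trans (≈-reflexive (cong (λ m → sum (suc m) (power n)) (≡.sym (ℕₚ.+-suc n k)))) (sum-power n (suc k))))
            (*-cong₁ (sum-power n k)) ⟩
    (a + b) ^ n * b + (a + b) ^ n * a ≈⟨ solve (a ∷ b ∷ (a + b) ^ n ∷ []) (x₂ :* x₁ :+ x₂ :* x₀) (x₂ :* (x₀ :+ x₁)) refl ⟩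
    (a + b) ^ n * (a + b) ≈⟨ ≈-sym (^-sucʳ (a + b) n) ⟩
    (a + b) ^ suc n ∎

  -- Isolates what the two uses share. The middle coefficients vanish for different reasons: in
  -- characteristic `p` because `s^(p-1) = 0`, and in the example because `a` and `b` commute up to
  -- a root of unity.
  power-ends : ∀ q → (∀ i → i ℕ.< q → power (suc q) (suc i) ≈ ι (+ 0)) → (a + b) ^ suc q ≈ a ^ suc q + b ^ suc q
  power-ends q h = begin
    (a + b) ^ suc q                             ≈⟨ ≈-sym (sum-power (suc q) 0) ⟩
    sum (suc (suc q) ℕ.+ 0) (power (suc q))     ≡⟨ cong (λ m → sum m (power (suc q))) (ℕₚ.+-identityʳ (suc (suc q))) ⟩
    sum (suc q) (power (suc q)) + power (suc q) (suc q) ≈⟨ +-cong (≈-trans (only-first q h) (power-first (suc q))) (power-last (suc q)) ⟩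
    b ^ suc q + a ^ suc q                       ≈⟨ +-comm _ _ ⟩
    a ^ suc q + b ^ suc q                       ∎
    where
    only-first : ∀ m {f} → (∀ i → i ℕ.< m → f (suc i) ≈ ι (+ 0)) → sum (suc m) f ≈ f 0
    only-first zero    h = +-identityˡ _
    only-first (suc m) h = ≈-trans (+-cong (only-first m (λ i l → h i (ℕₚ.m<n⇒m<1+n l))) (h m ℕₚ.≤-refl)) (+-identityʳ _)

module Frobenius (A : Algebra) {q : ℕ} (prime : Prime (suc q))
  (char : ∀ a → Algebra._≈_ A (Algebra._*_ A (Algebra.ι A (+ (suc q))) a) (Algebra.ι A (+ 0))) where
  open Algebra A
  open Solver A
  open AlgebraPowers A
  open Reasoning

  invert : ∀ i → i ℕ.< q → ∀ a → ι (+ suc i) * a ≈ ι (+ 0) → a ≈ ι (+ 0)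
  invert i i<q a h = case inverse-mod prime (λ d → ℕₚ.<⇒≱ (ℕ.s≤s i<q) (ℕᵈ.∣⇒≤ d)) of λ where
    (u , v , e) → begin
      a ≈⟨ ≈-sym (*-identityˡ a) ⟩
      ι (+ 1) * a ≡⟨ cong (λ x → ι x * a) (≡.sym e) ⟩
      ι (u ℤ.* + suc i ℤ.+ v ℤ.* + suc q) * a ≈⟨ *-cong₁ (≈-trans (ι-+ _ _) (+-cong (ι-* u _) (ι-* v _))) ⟩
      (ι u * ι (+ suc i) + ι v * ι (+ suc q)) * a
        ≈⟨ solve (ι u ∷ ι (+ suc i) ∷ ι v ∷ ι (+ suc q) ∷ a ∷ []) ((x₀ :* x₁ :+ x₂ :* x₃) :* x₄) (x₀ :* (x₁ :* x₄) :+ x₂ :* (x₃ :* x₄)) refl ⟩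
      ι u * (ι (+ suc i) * a) + ι v * (ι (+ suc q) * a) ≈⟨ +-cong (*-cong₂ h) (*-cong₂ (char a)) ⟩
      ι u * ι (+ 0) + ι v * ι (+ 0) ≈⟨ solve (ι u ∷ ι v ∷ []) (x₀ :* con (+ 0) :+ x₁ :* con (+ 0)) (con (+ 0)) refl ⟩
      ι (+ 0) ∎

  -- This is `power-difference` with `R` and `E` the multiplications by `t` and `1 - t`: their sum
  -- is the identity, so `d n` is the geometric sum.
  [1-t]^q≈geometric : ∀ t → (ι (+ 1) - t) ^ q ≈ geometric t (suc q)
  [1-t]^q≈geometric t = ≈-sym (≈-trans (power-difference prime char Radd Eadd RE (λ _ → ι (+ 1)) d (λ _ → ≈-refl) d-suc 0) (E-iter q))
    where
    open Pascal A
    open Operators ℕ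
    s : Carrier
    s = ι (+ 1) - t
    right : ∀ c → Additive (λ f i → f i * c)
    right c = record { op-cong = λ h i → *-cong₁ (h i) ; op-+ = λ f g i → *-distribʳ c (f i) (g i) ; op-0 = λ i → *-zeroˡ c }
    Radd : Additive (λ f i → f i * t)
    Radd = right t
    Eadd : Additive (λ f i → f i * s)
    Eadd = right s
    RE : ∀ f → _ ≋ _
    RE f i = solve (f i ∷ t ∷ []) (x₀ :* (con (+ 1) :- x₁) :* x₁) (x₀ :* x₁ :* (con (+ 1) :- x₁)) refl
    d : ℕ → V
    d n _ = geometric t n
    R-iter : ∀ n {i} → iter n (λ f i → f i * t) (λ _ → ι (+ 1)) i ≈ t ^ n
    R-iter zero    = ≈-refl
    R-iter (suc n) = ≈-trans (*-cong₁ (R-iter n)) (≈-sym (^-sucʳ t n))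
    E-iter : ∀ n {i} → iter n (λ f i → f i * s) (λ _ → ι (+ 1)) i ≈ s ^ n
    E-iter zero    = ≈-refl
    E-iter (suc n) = ≈-trans (*-cong₁ (E-iter n)) (≈-sym (^-sucʳ s n))
    d-suc : ∀ n → d (suc n) ≋ _
    d-suc n i = +-cong (solve (geometric t n ∷ t ∷ []) x₀ (x₀ :* x₁ :+ x₀ :* (con (+ 1) :- x₁)) refl) (≈-sym (R-iter n))

  -- Differentiating (b + aT)^p in T gives Σ_k L^k R^(p-1-k) a = ad(b + aT)^(p-1) a, which lies in s^(p-1);
  -- so the middle coefficients of (b + aT)^p vanish.
  module _ (s : Carrier) (s-central : Central s) (s^q≈0 : s ^ q ≈ ι (+ 0))
    (commutator : ∀ a b → ∃ λ c → a * b - b * a ≈ s * c) where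

    frobenius : ∀ a b → (a + b) ^ suc q ≈ a ^ suc q + b ^ suc q
    frobenius a b = power-ends q λ i i<q → invert i i<q _ (coefficient (suc i))
      where
      open Sequences A a b
      bracket : V → V
      bracket f i = leftMul f i - rightMul f i
      aT : V → V
      aT f i = a * shift f i
      bracket-additive : Additive bracket
      bracket-additive = record
        { op-cong = λ h i → +-cong (leftMul-cong h i) (*-cong₂ (rightMul-cong h i))
        ; op-+ = λ f g i → ≈-trans (+-cong (+-cong₂ (*-cong₂ (shift-+ f g i))) (*-cong₂ (op-+ rightMul-additive f g i)))
            (solve (f i ∷ g i ∷ shift f i ∷ shift g i ∷ a ∷ b ∷ [])
              ((x₅ :* (x₀ :+ x₁) :+ x₄ :* (x₂ :+ x₃)) :- ((x₀ :* x₅ :+ x₂ :* x₄) :+ (x₁ :* x₅ :+ x₃ :* x₄)))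
              (((x₅ :* x₀ :+ x₄ :* x₂) :- (x₀ :* x₅ :+ x₂ :* x₄)) :+ ((x₅ :* x₁ :+ x₄ :* x₃) :- (x₁ :* x₅ :+ x₃ :* x₄))) refl)
        ; op-0 = λ i → ≈-trans (+-cong (+-cong₂ (*-cong₂ (shift-0 i))) (*-cong₂ (op-0 rightMul-additive i)))
            (solve (a ∷ b ∷ []) ((x₁ :* con (+ 0) :+ x₀ :* con (+ 0)) :- con (+ 0)) (con (+ 0)) refl) }
      rightMul-bracket : ∀ f → rightMul (bracket f) ≋ bracket (rightMul f)
      rightMul-bracket f i = begin
        rightMul (bracket f) i ≈⟨ +-cong₂ (*-cong₁ (shift-bracket i)) ⟩
        (leftMul f i - rightMul f i) * b + (shift (leftMul f) i - shift (rightMul f) i) * a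
          ≈⟨ solve (leftMul f i ∷ rightMul f i ∷ shift (leftMul f) i ∷ shift (rightMul f) i ∷ a ∷ b ∷ [])
               ((x₀ :- x₁) :* x₅ :+ (x₂ :- x₃) :* x₄) ((x₀ :* x₅ :+ x₂ :* x₄) :- (x₁ :* x₅ :+ x₃ :* x₄)) refl ⟩
        rightMul (leftMul f) i - rightMul (rightMul f) i ≈⟨ +-cong₁ (≈-sym (left-right f i)) ⟩
        bracket (rightMul f) i ∎
        where
        shift-bracket : ∀ i → shift (bracket f) i ≈ shift (leftMul f) i - shift (rightMul f) i
        shift-bracket zero    = solve [] (con (+ 0)) (con (+ 0) :- con (+ 0)) refl
        shift-bracket (suc i) = ≈-refl
      aT-rightMul : ∀ f → aT (rightMul f) ≋ rightMul (aT f)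
      aT-rightMul f i = begin
        a * shift (rightMul f) i ≈⟨ *-cong₂ (shift-rightMul f i) ⟩
        a * (shift f i * b + shift (shift f) i * a)
          ≈⟨ solve (shift f i ∷ shift (shift f) i ∷ a ∷ b ∷ []) (x₂ :* (x₀ :* x₃ :+ x₁ :* x₂)) (x₂ :* x₀ :* x₃ :+ x₂ :* x₁ :* x₂) refl ⟩
        a * shift f i * b + a * shift (shift f) i * a ≈⟨ +-cong₂ (*-cong₁ (≈-sym (shift-aT i))) ⟩
        rightMul (aT f) i ∎
        where
        shift-aT : ∀ i → shift (aT f) i ≈ a * shift (shift f) i
        shift-aT zero    = ≈-sym (*-zeroʳ a)
        shift-aT (suc i) = ≈-refl
      aT-power : ∀ n → aT (power n) ≋ iter n rightMul (aT one)
      aT-power zero    i = ≈-refl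
      aT-power (suc n) i = ≈-trans (aT-rightMul (power n) i) (rightMul-cong (aT-power n) i)
      -- The operator `T d/dT` instead of `d/dT` keeps the indices in place; this is why the source
      -- term is `aT` and not `a`.
      derivative : ℕ → V
      derivative n i = ι (+ i) * power n i
      derivative-zero : derivative 0 ≋ 𝟘
      derivative-zero zero    = *-zeroˡ _
      derivative-zero (suc i) = *-zeroʳ _
      leibniz : ∀ f i → ι (+ i) * leftMul f i ≈ leftMul (λ k → ι (+ k) * f k) i + aT f i
      leibniz f zero    = solve (f 0 ∷ a ∷ b ∷ []) (con (+ 0) :* (x₂ :* x₀ :+ x₁ :* con (+ 0)))
        ((x₂ :* (con (+ 0) :* x₀) :+ x₁ :* con (+ 0)) :+ x₁ :* con (+ 0)) refl
      leibniz f (suc i) = begin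
        ι (+ suc i) * (b * f (suc i) + a * f i) ≈⟨ *-cong₁ (ι-+ (+ 1) (+ i)) ⟩
        (ι (+ 1) + ι (+ i)) * (b * f (suc i) + a * f i)
          ≈⟨ solveᶜ ((ι (+ i) , ι-central (+ i)) ∷ []) (f i ∷ f (suc i) ∷ a ∷ b ∷ [])
               ((con (+ 1) :+ c₀) :* (x₃ :* x₁ :+ x₂ :* x₀)) ((x₃ :* ((con (+ 1) :+ c₀) :* x₁) :+ x₂ :* (c₀ :* x₀)) :+ x₂ :* x₀) refl ⟩
        (b * ((ι (+ 1) + ι (+ i)) * f (suc i)) + a * (ι (+ i) * f i)) + a * f i
          ≈⟨ +-cong₁ (+-cong₁ (*-cong₂ (*-cong₁ (≈-sym (ι-+ (+ 1) (+ i)))))) ⟩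
        (b * (ι (+ suc i) * f (suc i)) + a * (ι (+ i) * f i)) + a * f i ∎
      derivative-suc : ∀ n → derivative (suc n) ≋ ((rightMul (derivative n) ⊹ bracket (derivative n)) ⊹ iter n rightMul (aT one))
      derivative-suc n i = begin
        ι (+ i) * power (suc n) i ≈⟨ *-cong₂ (≈-sym (left-power n i)) ⟩
        ι (+ i) * leftMul (power n) i ≈⟨ leibniz (power n) i ⟩
        leftMul (derivative n) i + aT (power n) i
          ≈⟨ +-cong (solve (leftMul (derivative n) i ∷ rightMul (derivative n) i ∷ []) x₀ (x₁ :+ (x₀ :- x₁)) refl) (aT-power n i) ⟩
        (rightMul (derivative n) i + bracket (derivative n) i) + iter n rightMul (aT one) i ∎
      Multiple : ℕ → V → Set
      Multiple j f = ∀ i → ∃ λ g → f i ≈ s ^ j * g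
      -- Each bracket is made of commutators with `a` and `b`, and each commutator contributes a
      -- factor `s`.
      bracket-multiple : ∀ j f → Multiple j f → Multiple (suc j) (bracket f)
      bracket-multiple j f h i = proj₁ cb + proj₁ ca , (begin
        (b * f i + a * shift f i) - (f i * b + shift f i * a)
          ≈⟨ +-cong (+-cong (*-cong₂ (proj₂ (h i))) (*-cong₂ (proj₂ h'))) (*-cong₂ (+-cong (*-cong₁ (proj₂ (h i))) (*-cong₁ (proj₂ h')))) ⟩
        (b * (s ^ j * g) + a * (s ^ j * g')) - (s ^ j * g * b + s ^ j * g' * a)
          ≈⟨ solveᶜ ((s ^ j , central-^ j s-central) ∷ []) (g ∷ g' ∷ a ∷ b ∷ [])
               ((x₃ :* (c₀ :* x₀) :+ x₂ :* (c₀ :* x₁)) :- (c₀ :* x₀ :* x₃ :+ c₀ :* x₁ :* x₂))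
               (c₀ :* ((x₃ :* x₀ :- x₀ :* x₃) :+ (x₂ :* x₁ :- x₁ :* x₂))) refl ⟩
        s ^ j * ((b * g - g * b) + (a * g' - g' * a)) ≈⟨ *-cong₂ (+-cong (proj₂ cb) (proj₂ ca)) ⟩
        s ^ j * (s * proj₁ cb + s * proj₁ ca)
          ≈⟨ solveᶜ ((s ^ j , central-^ j s-central) ∷ (s , s-central) ∷ []) (proj₁ cb ∷ proj₁ ca ∷ [])
               (c₀ :* (c₁ :* x₀ :+ c₁ :* x₁)) (c₁ :* c₀ :* (x₀ :+ x₁)) refl ⟩
        s * s ^ j * (proj₁ cb + proj₁ ca) ∎)
        where
        shift-multiple : ∀ i → ∃ λ g → shift f i ≈ s ^ j * g
        shift-multiple zero    = ι (+ 0) , ≈-sym (*-zeroʳ _)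
        shift-multiple (suc i) = h i
        h' : ∃ λ g → shift f i ≈ s ^ j * g
        h' = shift-multiple i
        g g' : Carrier
        g = proj₁ (h i)
        g' = proj₁ h'
        cb : ∃ λ c → b * g - g * b ≈ s * c
        cb = commutator b g
        ca : ∃ λ c → a * g' - g' * a ≈ s * c
        ca = commutator a g'
      iter-multiple : ∀ j f → Multiple j (iter j bracket f)
      iter-multiple zero    f i = f i , ≈-sym (*-identityˡ _)
      iter-multiple (suc j) f = bracket-multiple j (iter j bracket f) (iter-multiple j f)
      coefficient : ∀ i → ι (+ i) * power (suc q) i ≈ ι (+ 0)
      coefficient i = begin
        derivative (suc q) i
          ≈⟨ Pascal.Operators.power-difference A ℕ prime char rightMul-additive bracket-additive rightMul-bracket
               (aT one) derivative derivative-zero derivative-suc i ⟩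
        iter q bracket (aT one) i ≈⟨ proj₂ (iter-multiple q (aT one) i) ⟩
        s ^ q * proj₁ (iter-multiple q (aT one) i) ≈⟨ *-cong₁ s^q≈0 ⟩
        ι (+ 0) * proj₁ (iter-multiple q (aT one) i) ≈⟨ *-zeroˡ _ ⟩
        ι (+ 0) ∎

-- Integers, matrices and quotient rings as algebras

ℤ-algebra : Algebra
ℤ-algebra = record
  { Carrier = ℤ ; _≈_ = _≡_ ; _+_ = ℤ._+_ ; _*_ = ℤ._*_ ; ι = id ; isEquivalence = ≡.isEquivalence
  ; +-cong = cong₂ ℤ._+_ ; *-cong = cong₂ ℤ._*_ ; +-assoc = ℤₚ.+-assoc ; +-comm = ℤₚ.+-comm ; +-identityˡ = ℤₚ.+-identityˡ
  ; *-assoc = ℤₚ.*-assoc ; *-identityˡ = ℤₚ.*-identityˡ ; *-distribˡ = ℤₚ.*-distribˡ-+ ; *-distribʳ = ℤₚ.*-distribʳ-+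
  ; *-zeroˡ = λ _ → refl ; ι-+ = λ _ _ → refl ; ι-* = λ _ _ → refl ; ι-central = ℤₚ.*-comm }

matrixAlgebra : FinSet → Algebra
matrixAlgebra I = record
  { Carrier = Mat I I ; _≈_ = _≈ᴹ_ ; _+_ = Matrices._+ᴹ_ ; _*_ = Matrices._∙_ ; ι = λ x → x Matrices.*ᴹ Matrices.1ᴹ
  ; isEquivalence = record { refl = Matrices.≈-refl ; sym = Matrices.≈-sym ; trans = Matrices.≈-trans }
  ; +-cong = Matrices.+-cong ; *-cong = Matrices.∙-cong
  ; +-assoc = λ A B C → pointwise λ i j → ℤₚ.+-assoc (at A i j) (at B i j) (at C i j)
  ; +-comm = λ A B → pointwise λ i j → ℤₚ.+-comm (at A i j) (at B i j)
  ; +-identityˡ = λ A → pointwise λ i j → ≡.trans (cong (ℤ._+ at A i j) (ℤₚ.*-zeroˡ (δ I i j))) (ℤₚ.+-identityˡ (at A i j))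
  ; *-assoc = ∙-assoc
  ; *-identityˡ = λ A → ≈-trans (*ᴹ-∙ (+ 1) 1ᴹ A) (≈-trans (*-cong (+ 1) (∙-identityˡ A)) (pointwise λ i j → ℤₚ.*-identityˡ (at A i j)))
  ; *-distribˡ = ∙-distribˡ ; *-distribʳ = ∙-distribʳ
  ; *-zeroˡ = λ A → ≈-trans (*ᴹ-∙ (+ 0) 1ᴹ A) (pointwise λ i j → ≡.trans (ℤₚ.*-zeroˡ (at (1ᴹ ∙ A) i j)) (≡.sym (ℤₚ.*-zeroˡ (δ I i j))))
  ; ι-+ = λ x y → pointwise λ i j → ℤₚ.*-distribʳ-+ (δ I i j) x y
  ; ι-* = λ x y → ≈-trans (pointwise λ i j → ℤₚ.*-assoc x y (δ I i j)) (≈-sym (≈-trans (*ᴹ-∙ x 1ᴹ (y *ᴹ 1ᴹ)) (*-cong x (∙-identityˡ (y *ᴹ 1ᴹ)))))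
  ; ι-central = λ x A → ≈-trans (scalar-∙ x A) (≈-sym (≈-trans (∙-*ᴹ x A 1ᴹ) (*-cong x (∙-identityʳ A)))) }
  where
  open Matrices
  scalar-∙ : ∀ x (A : Mat I I) → (x *ᴹ 1ᴹ) ∙ A ≈ᴹ x *ᴹ A
  scalar-∙ x A = ≈-trans (*ᴹ-∙ x 1ᴹ A) (*-cong x (∙-identityˡ A))

module MatrixAlgebra (I : FinSet) where
  open Matrices
  open Algebra (matrixAlgebra I) using (ι; _^_)

  ι-∙ : ∀ {J} x (A : Mat I J) → ι x ∙ A ≈ᴹ x *ᴹ A
  ι-∙ x A = ≈-trans (*ᴹ-∙ x 1ᴹ A) (*-cong x (∙-identityˡ A))

  Det-ι : ∀ x → Det (ι x) ≡ x ℤ.^ size I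
  Det-ι x = ≡.trans (Det-*ᴹ {I} x 1ᴹ) (≡.trans (cong (x ℤ.^ size I ℤ.*_) (Det-1 {I})) (ℤₚ.*-identityʳ _))

  Det-^ : ∀ A n → Det (A ^ n) ≡ Det A ℤ.^ n
  Det-^ A zero    = ≡.trans (Det-ι (+ 1)) (ℤₚ.^-zeroˡ (size I))
  Det-^ A (suc n) = ≡.trans (Det-∙ {I} A (A ^ n)) (cong (Det A ℤ.*_) (Det-^ A n))

module Quotient (A : Algebra) (p : ℤ) (τ : Algebra.Carrier A) (τ-central : Algebra.Central A τ) where
  open Algebra A
  open Solver A

  infix 4 _~_
  infix 3 _,_by_
  -- Congruence modulo the two-sided ideal generated by `p` and the central element `τ`. The
  -- witnesses are kept, because later steps work with the multiples themselves.
  record _~_ (a b : Carrier) : Set where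
    constructor _,_by_
    field
      U W   : Carrier
      proof : a ≈ b + (ι p * U + τ * W)
  open _~_ public

  private
    P : ∃ Central
    P = ι p , ι-central p
    T : ∃ Central
    T = τ , τ-central

  ≈⇒~ : ∀ {a b} → a ≈ b → a ~ b
  ≈⇒~ {a} {b} h = ι (+ 0) , ι (+ 0) by ≈-trans h (solveᶜ (P ∷ T ∷ []) (b ∷ []) x₀ (x₀ :+ (c₀ :* con (+ 0) :+ c₁ :* con (+ 0))) refl)

  ~-sym : ∀ {a b} → a ~ b → b ~ a
  ~-sym {a} {b} (u , w by h) = ι -[1+ 0 ] * u , ι -[1+ 0 ] * w by ≈-trans
    (solveᶜ (P ∷ T ∷ []) (b ∷ u ∷ w ∷ []) x₀ ((x₀ :+ (c₀ :* x₁ :+ c₁ :* x₂)) :+ (c₀ :* (con -[1+ 0 ] :* x₁) :+ c₁ :* (con -[1+ 0 ] :* x₂))) refl)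
    (+-cong₁ (≈-sym h))

  ~-trans : ∀ {a b c} → a ~ b → b ~ c → a ~ c
  ~-trans {a} {b} {c} (u , w by h) (u' , w' by k) = u + u' , w + w' by ≈-trans h (≈-trans (+-cong₁ k)
    (solveᶜ (P ∷ T ∷ []) (c ∷ u ∷ w ∷ u' ∷ w' ∷ []) ((x₀ :+ (c₀ :* x₃ :+ c₁ :* x₄)) :+ (c₀ :* x₁ :+ c₁ :* x₂))
      (x₀ :+ (c₀ :* (x₁ :+ x₃) :+ c₁ :* (x₂ :+ x₄))) refl))

  ~-+ : ∀ {a b c d} → a ~ b → c ~ d → a + c ~ b + d
  ~-+ {a} {b} {c} {d} (u , w by h) (u' , w' by k) = u + u' , w + w' by ≈-trans (+-cong h k)
    (solveᶜ (P ∷ T ∷ []) (b ∷ d ∷ u ∷ w ∷ u' ∷ w' ∷ []) ((x₀ :+ (c₀ :* x₂ :+ c₁ :* x₃)) :+ (x₁ :+ (c₀ :* x₄ :+ c₁ :* x₅)))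
      ((x₀ :+ x₁) :+ (c₀ :* (x₂ :+ x₄) :+ c₁ :* (x₃ :+ x₅))) refl)

  ~-* : ∀ {a b c d} → a ~ b → c ~ d → a * c ~ b * d
  ~-* {a} {b} {c} {d} (u , w by h) (u' , w' by k) = u * d + b * u' + u * (ι p * u' + τ * w') , w * d + b * w' + w * (ι p * u' + τ * w')
    by ≈-trans (*-cong h k)
    (solveᶜ (P ∷ T ∷ []) (b ∷ d ∷ u ∷ w ∷ u' ∷ w' ∷ []) ((x₀ :+ (c₀ :* x₂ :+ c₁ :* x₃)) :* (x₁ :+ (c₀ :* x₄ :+ c₁ :* x₅)))
      ((x₀ :* x₁) :+ (c₀ :* (x₂ :* x₁ :+ x₀ :* x₄ :+ x₂ :* (c₀ :* x₄ :+ c₁ :* x₅)) :+ c₁ :* (x₃ :* x₁ :+ x₀ :* x₅ :+ x₃ :* (c₀ :* x₄ :+ c₁ :* x₅)))) refl)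

  quotient : Algebra
  quotient = record
    { Carrier = Carrier ; _≈_ = _~_ ; _+_ = _+_ ; _*_ = _*_ ; ι = ι
    ; isEquivalence = record { refl = ≈⇒~ ≈-refl ; sym = ~-sym ; trans = ~-trans }
    ; +-cong = ~-+ ; *-cong = ~-*
    ; +-assoc = λ a b c → ≈⇒~ (+-assoc a b c) ; +-comm = λ a b → ≈⇒~ (+-comm a b) ; +-identityˡ = λ a → ≈⇒~ (+-identityˡ a)
    ; *-assoc = λ a b c → ≈⇒~ (*-assoc a b c) ; *-identityˡ = λ a → ≈⇒~ (*-identityˡ a)
    ; *-distribˡ = λ a b c → ≈⇒~ (*-distribˡ a b c) ; *-distribʳ = λ a b c → ≈⇒~ (*-distribʳ a b c)
    ; *-zeroˡ = λ a → ≈⇒~ (*-zeroˡ a) ; ι-+ = λ x y → ≈⇒~ (ι-+ x y) ; ι-* = λ x y → ≈⇒~ (ι-* x y) ; ι-central = λ x a → ≈⇒~ (ι-central x a) }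

  p~0 : ∀ a → ι p * a ~ ι (+ 0)
  p~0 a = a , ι (+ 0) by solveᶜ (P ∷ T ∷ []) (a ∷ []) (c₀ :* x₀) (con (+ 0) :+ (c₀ :* x₀ :+ c₁ :* con (+ 0))) refl

  τ~0 : τ ~ ι (+ 0)
  τ~0 = ι (+ 0) , ι (+ 1) by solveᶜ (P ∷ T ∷ []) [] c₁ (con (+ 0) :+ (c₀ :* con (+ 0) :+ c₁ :* con (+ 1))) refl

  ^-same : ∀ a n → Algebra._^_ quotient a n ≡ a ^ n
  ^-same a zero    = refl
  ^-same a (suc n) = cong (a *_) (^-same a n)

module GeometricMod (A : Algebra) {q : ℕ} (prime : Prime (suc q)) where
  open Algebra A
  open AlgebraPowers A
  private
    module Q = Quotient A (+ suc q) (ι (+ 0)) (ι-central (+ 0))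
    module P = AlgebraPowers Q.quotient

    geometric-same : ∀ t n → P.geometric t n ≡ geometric t n
    geometric-same t zero    = refl
    geometric-same t (suc n) = cong₂ _+_ (geometric-same t n) (Q.^-same t n)

    raw : ∀ t → Algebra._^_ Q.quotient (ι (+ 1) - t) q Q.~ P.geometric t (suc q)
    raw t = Frobenius.[1-t]^q≈geometric Q.quotient prime Q.p~0 t

  -- The formula in characteristic `p`, applied to `A / p` (the quotient with `τ = 0`) and unfolded
  -- to an identity in `A` with an explicit multiple of `p`.
  [1-t]^q-mod-p : ∀ t → ∃ λ U → (ι (+ 1) - t) ^ q ≈ geometric t (suc q) + ι (+ suc q) * U
  [1-t]^q-mod-p t = case ≡.subst₂ Q._~_ (Q.^-same (ι (+ 1) - t) q) (geometric-same t (suc q)) (raw t) of λ where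
    (Q._,_by_ U W h) → U , ≈-trans h (+-cong₂ (Solver.solveᶜ A ((ι (+ suc q) , ι-central (+ suc q)) ∷ []) (U ∷ W ∷ []) (c₀ :* x₀ :+ con (+ 0) :* x₁) (c₀ :* x₀) refl))

  [1-t]^p-mod-p : ∀ t → ∃ λ U → (ι (+ 1) - t) ^ suc q ≈ (ι (+ 1) - t ^ suc q) + ι (+ suc q) * ((ι (+ 1) - t) * U)
  [1-t]^p-mod-p t = case [1-t]^q-mod-p t of λ where
    (U , h) → U , ≈-trans (*-cong₂ h) (≈-trans (*-distribˡ _ _ _) (+-cong ([1-t]*geometric t (suc q))
      (Solver.solveᶜ A ((ι (+ suc q) , ι-central (+ suc q)) ∷ []) (ι (+ 1) - t ∷ U ∷ []) (x₀ :* (c₀ :* x₁)) (c₀ :* (x₀ :* x₁)) refl)))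

-- Permutation representations: change of index set and splitting along fibres

module _ {G : Set} where
  open Matrices

  ev : ∀ {I} → (G → Mat I I) → Expr G → Mat I I
  ev {I} ρ e = Algebra.⟦_⟧ (matrixAlgebra I) e ρ

  infix 4 _≈[_]_
  record _≈[_]_ {I : FinSet} (e : Expr G) (ρ : G → Mat I I) (f : Expr G) : Set where
    no-eta-equality
    constructor lift
    field lower : ev ρ e ≈ᴹ ev ρ f

  lower[_] : ∀ {I} (ρ : G → Mat I I) {e f} → e ≈[ ρ ] f → ev ρ e ≈ᴹ ev ρ f
  lower[ ρ ] = _≈[_]_.lower

  lift[_] : ∀ {I} (ρ : G → Mat I I) {e f} → ev ρ e ≈ᴹ ev ρ f → e ≈[ ρ ] f
  lift[ ρ ] = lift

  -- The image of the group ring under `ρ`, with expressions as carrier: all representations share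
  -- the same elements, so an identity moves between them without any renaming.
  repAlgebra : ∀ {I} → (G → Mat I I) → Algebra
  repAlgebra {I} ρ = record
    { Carrier = Expr G ; _≈_ = λ e f → e ≈[ ρ ] f ; _+_ = _:+_ ; _*_ = _:*_ ; ι = con
    ; isEquivalence = record { refl = lift A.≈-refl ; sym = λ h → lift (A.≈-sym (lower[ ρ ] h)) ; trans = λ h k → lift (A.≈-trans (lower[ ρ ] h) (lower[ ρ ] k)) }
    ; +-cong = λ h k → lift (A.+-cong (lower[ ρ ] h) (lower[ ρ ] k))
    ; *-cong = λ h k → lift (A.*-cong (lower[ ρ ] h) (lower[ ρ ] k))
    ; +-assoc = λ a b c → lift (A.+-assoc (ev ρ a) (ev ρ b) (ev ρ c)) ; +-comm = λ a b → lift (A.+-comm (ev ρ a) (ev ρ b))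
    ; +-identityˡ = λ a → lift (A.+-identityˡ (ev ρ a)) ; *-assoc = λ a b c → lift (A.*-assoc (ev ρ a) (ev ρ b) (ev ρ c))
    ; *-identityˡ = λ a → lift (A.*-identityˡ (ev ρ a)) ; *-distribˡ = λ a b c → lift (A.*-distribˡ (ev ρ a) (ev ρ b) (ev ρ c))
    ; *-distribʳ = λ a b c → lift (A.*-distribʳ (ev ρ a) (ev ρ b) (ev ρ c)) ; *-zeroˡ = λ a → lift (A.*-zeroˡ (ev ρ a))
    ; ι-+ = λ x y → lift (A.ι-+ x y) ; ι-* = λ x y → lift (A.ι-* x y) ; ι-central = λ x a → lift (A.ι-central x (ev ρ a)) }
    where module A = Algebra (matrixAlgebra I)

  ev-^ : ∀ {I} (ρ : G → Mat I I) e n → ev ρ (Algebra._^_ (repAlgebra ρ) e n) ≡ Algebra._^_ (matrixAlgebra I) (ev ρ e) n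
  ev-^ ρ e zero    = refl
  ev-^ ρ e (suc n) = cong (ev ρ e ∙_) (ev-^ ρ e n)

  intertwine : ∀ {I J} (ρ : G → Mat I I) (ρ' : G → Mat J J) (P : Mat I J) →
    (∀ g → ρ g ∙ P ≈ᴹ P ∙ ρ' g) → ∀ e → ev ρ e ∙ P ≈ᴹ P ∙ ev ρ' e
  intertwine {I} {J} ρ ρ' P h (con x) = ≈-trans (MatrixAlgebra.ι-∙ I x P) (≈-sym (≈-trans (∙-*ᴹ x P 1ᴹ) (*-cong x (∙-identityʳ P))))
  intertwine ρ ρ' P h (var g)   = h g
  intertwine ρ ρ' P h (e :+ f)  = ≈-trans (∙-distribʳ P (ev ρ e) (ev ρ f))
    (≈-trans (+-cong (intertwine ρ ρ' P h e) (intertwine ρ ρ' P h f)) (≈-sym (∙-distribˡ P (ev ρ' e) (ev ρ' f))))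
  intertwine ρ ρ' P h (e :* f)  = ≈-trans (∙-assoc (ev ρ e) (ev ρ f) P)
    (≈-trans (∙-congˡ (ev ρ e) (intertwine ρ ρ' P h f)) (≈-trans (≈-sym (∙-assoc (ev ρ e) P (ev ρ' f)))
      (≈-trans (∙-congʳ (ev ρ' f) (intertwine ρ ρ' P h e)) (∙-assoc P (ev ρ' e) (ev ρ' f)))))

  permutation : ∀ I → (G → ∣ I ∣ → ∣ I ∣) → G → Mat I I
  permutation I act g = Fm I I (act g)

  module Reindex {I J} (size≡ : size I ≡ size J) (φ : ∣ J ∣ → ∣ I ∣) (ψ : ∣ I ∣ → ∣ J ∣)
    (ψφ : ∀ j → ψ (φ j) ≡ j) (act : G → ∣ I ∣ → ∣ I ∣) (act' : G → ∣ J ∣ → ∣ J ∣)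
    (equivariant : ∀ g j → act g (φ j) ≡ φ (act' g j)) where

    private
      ρ : G → Mat I I
      ρ = permutation I act
      ρ' : G → Mat J J
      ρ' = permutation J act'
      P : Mat I J
      P = Fm I J φ
      P' : Mat J I
      P' = Fm J I ψ
      P'P : P' ∙ P ≈ᴹ 1ᴹ
      P'P = ≈-trans (Fm-∙ J I J ψ φ) (Fm-cong J J ψφ)

    conjugate : ∀ e → P' ∙ (ev ρ e ∙ P) ≈ᴹ ev ρ' e
    conjugate e = ≈-trans (∙-congˡ P' (intertwine ρ ρ' P (λ g → ≈-trans (Fm-∙ I I J (act g) φ)
        (≈-trans (Fm-cong I J (equivariant g)) (≈-sym (Fm-∙ I J J φ (act' g))))) e))
      (≈-trans (≈-sym (∙-assoc P' P (ev ρ' e))) (≈-trans (∙-congʳ (ev ρ' e) P'P) (∙-identityˡ (ev ρ' e))))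

    Det-reindexed : ∀ e → Det (ev ρ' e) ≡ Det (ev ρ e)
    Det-reindexed e = ≡.trans (Det-cong {J} (≈-sym (conjugate e))) (Det-conj size≡ (ev ρ e) P' P P'P)

    transfer : ∀ {e f} → e ≈[ ρ ] f → e ≈[ ρ' ] f
    transfer {e} {f} h = lift[ ρ' ] (≈-trans (≈-sym (conjugate e)) (≈-trans (∙-congˡ P' (∙-congʳ P (lower[ ρ ] h))) (conjugate f)))

  -- The functions on J × Fin (suc q) form an extension of those on J (sum over the second coordinate)
  -- by those with all these sums zero, which have the basis (j , suc c) - (j , 0).
  module Split (J : FinSet) (q : ℕ) (act : G → ∣ J ∣ × Fin (suc q) → ∣ J ∣ × Fin (suc q)) (act̄ : G → ∣ J ∣ → ∣ J ∣)
    (projects : ∀ g u → proj₁ (act g u) ≡ act̄ g (proj₁ u)) where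

    I K : FinSet
    I = J ⊗ fin (suc q)
    K = J ⊗ fin q

    private
      bottom lifted : ∣ K ∣ → ∣ I ∣
      bottom (j , c) = j , zero
      lifted (j , c) = j , suc c

    inclusion : Mat I K
    inclusion = Fm I K lifted +ᴹ -[1+ 0 ] *ᴹ Fm I K bottom

    coordinates : Mat K I
    coordinates = mat λ k u → δ I (lifted k) u

    fibreSum : Mat J I
    fibreSum = Fm J I proj₁

    section : Mat I J
    section = Fm I J (_, zero)

    ρ : G → Mat I I
    ρ = permutation I act
    ρ̄ : G → Mat J J
    ρ̄ = permutation J act̄
    -- The induced action on the differences, in general not by permutations. Identities reach it
    -- through `transfer-sub`.
    ρ₀ : G → Mat K K
    ρ₀ g = coordinates ∙ (ρ g ∙ inclusion)

    private
      opaque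
        unfolding _∙_

        π∙ : ∀ {L} (X : Mat I L) k l → at (coordinates ∙ X) k l ≡ at X (lifted k) l
        π∙ X k l = Σ-δˡ I (λ u → at X u l) (lifted k)

      x-x : ∀ x → x ℤ.+ -[1+ 0 ] ℤ.* x ≡ + 0
      x-x = solve-∀
      x-y+y : ∀ x y → (x ℤ.+ -[1+ 0 ] ℤ.* y) ℤ.+ y ≡ x
      x-y+y = solve-∀

      δ-lifted : ∀ k l → δ I (lifted k) (lifted l) ≡ δ K k l
      δ-lifted k l = δ-⇔ I K (λ { refl → refl }) (λ { refl → refl })

      πι : coordinates ∙ inclusion ≈ᴹ 1ᴹ
      πι = pointwise λ k l → ≡.trans (π∙ inclusion k l)
        (≡.trans (cong₂ (λ x y → x ℤ.+ -[1+ 0 ] ℤ.* y) (δ-lifted k l) (δ-≢ I {lifted k} {bottom l} (λ ()))) (ℤₚ.+-identityʳ _))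
      πτ : coordinates ∙ section ≈ᴹ 0ᴹ
      πτ = pointwise λ k j → ≡.trans (π∙ section k j) (δ-≢ I {lifted k} {j , zero} (λ ()))
      στ : fibreSum ∙ section ≈ᴹ 1ᴹ
      στ = Fm-∙ J I J proj₁ (_, zero)
      σι : fibreSum ∙ inclusion ≈ᴹ 0ᴹ
      σι = ≈-trans (∙-distribˡ fibreSum (Fm I K lifted) (-[1+ 0 ] *ᴹ Fm I K bottom))
        (≈-trans (+-cong (Fm-∙ J I K proj₁ lifted) (≈-trans (∙-*ᴹ -[1+ 0 ] fibreSum (Fm I K bottom)) (*-cong -[1+ 0 ] (Fm-∙ J I K proj₁ bottom))))
          (pointwise λ j k → x-x (δ J j (proj₁ k))))
      opaque
        unfolding _∙_

        -- The two products are complementary projections, onto the differences and onto the span of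
        -- the points `(j , zero)`.
        ιπ+τσ : inclusion ∙ coordinates +ᴹ section ∙ fibreSum ≈ᴹ 1ᴹ
        ιπ+τσ = pointwise go
          where
          go : ∀ u v → at (inclusion ∙ coordinates) u v ℤ.+ at (section ∙ fibreSum) u v ≡ δ I u v
          go u (j , zero) = ≡.trans (cong₂ ℤ._+_
              (Σ-zero K (λ k → ≡.trans (cong (at inclusion u k ℤ.*_) (δ-≢ I {lifted k} {j , zero} (λ ()))) (ℤₚ.*-zeroʳ (at inclusion u k))))
              (entry (Fm-∙ I J I (_, zero) proj₁) u (j , zero))) (ℤₚ.+-identityˡ _)
          go u (j , suc c) = ≡.trans (cong₂ ℤ._+_
              (≡.trans (Σ-cong K (λ k → cong (at inclusion u k ℤ.*_) (δ-lifted k (j , c)))) (Σ-δʳ K (at inclusion u) (j , c)))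
              (entry (Fm-∙ I J I (_, zero) proj₁) u (j , suc c))) (x-y+y (δ I u (j , suc c)) (δ I u (j , zero)))

      σρ : ∀ g → ρ̄ g ∙ fibreSum ≈ᴹ fibreSum ∙ ρ g
      σρ g = ≈-trans (Fm-∙ J J I (act̄ g) proj₁) (≈-trans (Fm-cong J I (λ u → ≡.sym (projects g u))) (≈-sym (Fm-∙ J I I proj₁ (act g))))

      opaque
        unfolding _∙_

        ∙-0ᴹ : ∀ {L M N} (X : Mat L M) → X ∙ 0ᴹ {M} {N} ≈ᴹ 0ᴹ
        ∙-0ᴹ {L} {M} X = pointwise λ i k → Σ-zero M (λ j → ℤₚ.*-zeroʳ (at X i j))

      -- Since `fibreSum` intertwines `ρ` with `ρ̄`, it kills `ρ g ∙ inclusion`; hence the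
      -- differences form a subrepresentation.
      ρι : ∀ g → ρ g ∙ inclusion ≈ᴹ inclusion ∙ ρ₀ g
      ρι g = ≈-trans (≈-sym (∙-identityˡ X)) (≈-trans (∙-congʳ X (≈-sym ιπ+τσ)) (≈-trans (∙-distribʳ X (inclusion ∙ coordinates) (section ∙ fibreSum))
          (≈-trans (+-cong (∙-assoc inclusion coordinates X) vanish) (pointwise λ i k → ℤₚ.+-identityʳ _))))
        where
        X : Mat I K
        X = ρ g ∙ inclusion
        vanish : (section ∙ fibreSum) ∙ X ≈ᴹ 0ᴹ
        vanish = ≈-trans (∙-assoc section fibreSum X) (≈-trans (∙-congˡ section (≈-trans (≈-sym (∙-assoc fibreSum (ρ g) inclusion))
          (≈-trans (∙-congʳ inclusion (≈-sym (σρ g))) (≈-trans (∙-assoc (ρ̄ g) fibreSum inclusion) (≈-trans (∙-congˡ (ρ̄ g) σι) (∙-0ᴹ (ρ̄ g))))))) (∙-0ᴹ section))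

    sub : ∀ e → ev ρ e ∙ inclusion ≈ᴹ inclusion ∙ ev ρ₀ e
    sub = intertwine ρ ρ₀ inclusion ρι

    quo : ∀ e → ev ρ̄ e ∙ fibreSum ≈ᴹ fibreSum ∙ ev ρ e
    quo = intertwine ρ̄ ρ fibreSum σρ

    π-ev-ι : ∀ e → coordinates ∙ (ev ρ e ∙ inclusion) ≈ᴹ ev ρ₀ e
    π-ev-ι e = ≈-trans (∙-congˡ coordinates (sub e)) (≈-trans (≈-sym (∙-assoc coordinates inclusion (ev ρ₀ e))) (≈-trans (∙-congʳ (ev ρ₀ e) πι) (∙-identityˡ (ev ρ₀ e))))

    σ-ev-τ : ∀ e → fibreSum ∙ (ev ρ e ∙ section) ≈ᴹ ev ρ̄ e
    σ-ev-τ e = ≈-trans (≈-sym (∙-assoc fibreSum (ev ρ e) section)) (≈-trans (∙-congʳ section (≈-sym (quo e)))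
      (≈-trans (∙-assoc (ev ρ̄ e) fibreSum section) (≈-trans (∙-congˡ (ev ρ̄ e) στ) (∙-identityʳ (ev ρ̄ e)))))

    σ-ev-ι : ∀ e → fibreSum ∙ (ev ρ e ∙ inclusion) ≈ᴹ 0ᴹ
    σ-ev-ι e = ≈-trans (≈-sym (∙-assoc fibreSum (ev ρ e) inclusion)) (≈-trans (∙-congʳ inclusion (≈-sym (quo e)))
      (≈-trans (∙-assoc (ev ρ̄ e) fibreSum inclusion) (≈-trans (∙-congˡ (ev ρ̄ e) σι) (∙-0ᴹ (ev ρ̄ e)))))

    transfer-sub : ∀ {e f} → e ≈[ ρ ] f → e ≈[ ρ₀ ] f
    transfer-sub {e} {f} h = lift[ ρ₀ ] (≈-trans (≈-sym (π-ev-ι e)) (≈-trans (∙-congˡ coordinates (∙-congʳ inclusion (lower[ ρ ] h))) (π-ev-ι f)))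

    transfer-quo : ∀ {e f} → e ≈[ ρ ] f → e ≈[ ρ̄ ] f
    transfer-quo {e} {f} h = lift[ ρ̄ ] (≈-trans (≈-sym (σ-ev-τ e)) (≈-trans (∙-congˡ fibreSum (∙-congʳ section (lower[ ρ ] h))) (σ-ev-τ f)))

    -- If `e g = e`, then `e` takes the same value on a basis vector and on its translate by `g`, so
    -- it kills their difference. The differences in question span the subrepresentation.
    annihilates : ∀ e → (∀ j c → ∃ λ g → act g (j , zero) ≡ (j , suc c) × (e :* var g) ≈[ ρ ] e) → e ≈[ ρ₀ ] con (+ 0)
    annihilates e h = lift[ ρ₀ ] (≈-trans (≈-sym (π-ev-ι e)) (≈-trans (∙-congˡ coordinates Xι) (≈-trans (∙-0ᴹ coordinates)
      (pointwise λ i j → ≡.sym (ℤₚ.*-zeroˡ (δ K i j))))))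
      where
      X : Mat I I
      X = ev ρ e
      opaque
        unfolding _∙_

        invariant : ∀ g → (e :* var g) ≈[ ρ ] e → ∀ u v → at X u (act g v) ≡ at X u v
        invariant g r u v = ≡.trans (≡.sym (Σ-δʳ I (at X u) (act g v))) (entry (lower[ ρ ] r) u v)

        difference-column : ∀ u k → at (X ∙ inclusion) u k ≡ at X u (lifted k) ℤ.+ -[1+ 0 ] ℤ.* at X u (bottom k)
        difference-column u k = ≡.trans (entry (∙-distribˡ X (Fm I K lifted) (-[1+ 0 ] *ᴹ Fm I K bottom)) u k)
          (cong₂ ℤ._+_ (Σ-δʳ I (at X u) (lifted k)) (≡.trans (entry (∙-*ᴹ -[1+ 0 ] X (Fm I K bottom)) u k) (cong (-[1+ 0 ] ℤ.*_) (Σ-δʳ I (at X u) (bottom k)))))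
      Xι : X ∙ inclusion ≈ᴹ 0ᴹ
      Xι = pointwise λ u (j , c) → case h j c of λ where
        (g , moves , r) → ≡.trans (difference-column u (j , c)) (≡.trans
          (cong (λ x → x ℤ.+ -[1+ 0 ] ℤ.* at X u (j , zero)) (≡.trans (cong (at X u) (≡.sym moves)) (invariant g r u (j , zero)))) (x-x (at X u (j , zero))))

    -- In the basis given by `inclusion` and `section`, the matrix is block upper triangular with
    -- the two induced actions on the diagonal.
    Det-split : ∀ e → Det (ev ρ e) ≡ Det (ev ρ₀ e) ℤ.* Det (ev ρ̄ e)
    Det-split e = ≡.trans (≡.sym (Det-conj {I} {K ⊕ J} sizes X P' P P'P)) (≡.trans (Det-cong {K ⊕ J} blocks)
      (Det-upper (ev ρ₀ e) (coordinates ∙ (X ∙ section)) (ev ρ̄ e)))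
      where
      X : Mat I I
      X = ev ρ e
      sizes : size J ℕ.* suc q ≡ size J ℕ.* q ℕ.+ size J
      sizes = ≡.trans (ℕₚ.*-suc (size J) q) (ℕₚ.+-comm (size J) _)
      P : Mat I (K ⊕ J)
      P = mat λ { u (inj₁ k) → at inclusion u k ; u (inj₂ j) → at section u j }
      P' : Mat (K ⊕ J) I
      P' = mat λ { (inj₁ k) u → at coordinates k u ; (inj₂ j) u → at fibreSum j u }
      δ-inj₁ : ∀ k l → δ K k l ≡ δ (K ⊕ J) (inj₁ k) (inj₁ l)
      δ-inj₁ k l = δ-⇔ K (K ⊕ J) (cong inj₁) (λ { refl → refl })
      δ-inj₂ : ∀ k l → δ J k l ≡ δ (K ⊕ J) (inj₂ k) (inj₂ l)
      δ-inj₂ k l = δ-⇔ J (K ⊕ J) (cong inj₂) (λ { refl → refl })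
      opaque
        unfolding _∙_

        P'P : P' ∙ P ≈ᴹ 1ᴹ
        P'P = pointwise λ where
          (inj₁ k) (inj₁ l) → ≡.trans (entry πι k l) (δ-inj₁ k l)
          (inj₁ k) (inj₂ j) → ≡.trans (entry πτ k j) (≡.sym (δ-≢ (K ⊕ J) {inj₁ k} {inj₂ j} (λ ())))
          (inj₂ j) (inj₁ k) → ≡.trans (entry σι j k) (≡.sym (δ-≢ (K ⊕ J) {inj₂ j} {inj₁ k} (λ ())))
          (inj₂ i) (inj₂ j) → ≡.trans (entry στ i j) (δ-inj₂ i j)
        blocks : P' ∙ (X ∙ P) ≈ᴹ block (ev ρ₀ e) (coordinates ∙ (X ∙ section)) 0ᴹ (ev ρ̄ e)
        blocks = pointwise λ where
          (inj₁ k) (inj₁ l) → entry (π-ev-ι e) k l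
          (inj₁ k) (inj₂ j) → refl
          (inj₂ j) (inj₁ k) → entry (σ-ev-ι e) j k
          (inj₂ i) (inj₂ j) → entry (σ-ev-τ e) i j

-- Congruences, p-adic valuations and residues

infix 4 _≡_[mod_]
record _≡_[mod_] (x y m : ℤ) : Set where
  constructor congruent
  field difference : m ∣ˢ x ℤ.- y
open _≡_[mod_] public

module Congruences {m : ℤ} where
  open Int using (_+_; _*_; -_; _-_)

  ≡⇒mod : ∀ {x y} → x ≡ y → x ≡ y [mod m ]
  ≡⇒mod {x} refl = congruent (divides (+ 0) (ℤₚ.+-inverseʳ x))

  mod-sym : ∀ {x y} → x ≡ y [mod m ] → y ≡ x [mod m ]
  mod-sym {x} {y} (congruent (divides k e)) = congruent $ divides (- k) (trans (sym (flip x y)) (trans (cong -_ e) (ℤₚ.neg-distribˡ-* k m)))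
    where
    flip : ∀ x y → - (x - y) ≡ y - x
    flip = solve-∀

  mod-trans : ∀ {x y z} → x ≡ y [mod m ] → y ≡ z [mod m ] → x ≡ z [mod m ]
  mod-trans {x} {y} {z} (congruent (divides k e)) (congruent (divides l f)) = congruent $ divides (k + l) (trans (chain x y z) (trans (cong₂ _+_ e f) (sym (ℤₚ.*-distribʳ-+ m k l))))
    where
    chain : ∀ x y z → x - z ≡ (x - y) + (y - z)
    chain = solve-∀

  mod-+ : ∀ {x y u v} → x ≡ y [mod m ] → u ≡ v [mod m ] → x + u ≡ y + v [mod m ]
  mod-+ {x} {y} {u} {v} (congruent (divides k e)) (congruent (divides l f)) = congruent $ divides (k + l) (trans (split x y u v) (trans (cong₂ _+_ e f) (sym (ℤₚ.*-distribʳ-+ m k l))))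
    where
    split : ∀ x y u v → (x + u) - (y + v) ≡ (x - y) + (u - v)
    split = solve-∀

  mod-* : ∀ {x y u v} → x ≡ y [mod m ] → u ≡ v [mod m ] → x * u ≡ y * v [mod m ]
  mod-* {x} {y} {u} {v} (congruent (divides k e)) (congruent (divides l f)) = congruent $ divides (k * u + y * l)
    (trans (split x y u v) (trans (cong₂ (λ a b → a * u + y * b) e f) (collect k l m u y)))
    where
    split : ∀ x y u v → x * u - y * v ≡ (x - y) * u + y * (u - v)
    split = solve-∀
    collect : ∀ k l m u y → k * m * u + y * (l * m) ≡ (k * u + y * l) * m
    collect = solve-∀

  mod-+ˡ : ∀ c {x y} → x ≡ y [mod m ] → c + x ≡ c + y [mod m ]
  mod-+ˡ c h = mod-+ (≡⇒mod {c} refl) h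

  mod-+ʳ : ∀ c {x y} → x ≡ y [mod m ] → x + c ≡ y + c [mod m ]
  mod-+ʳ c h = mod-+ h (≡⇒mod {c} refl)

  mod-*ˡ : ∀ c {x y} → x ≡ y [mod m ] → c * x ≡ c * y [mod m ]
  mod-*ˡ c h = mod-* (≡⇒mod {c} refl) h

  mod-*ʳ : ∀ c {x y} → x ≡ y [mod m ] → x * c ≡ y * c [mod m ]
  mod-*ʳ c h = mod-* h (≡⇒mod {c} refl)

  mod-neg : ∀ {x y} → x ≡ y [mod m ] → - x ≡ - y [mod m ]
  mod-neg {x} {y} (congruent (divides k e)) = congruent $ divides (- k) (trans (flip x y) (trans (cong -_ e) (ℤₚ.neg-distribˡ-* k m)))
    where
    flip : ∀ x y → - x - (- y) ≡ - (x - y)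
    flip = solve-∀

  mod-^ : ∀ {x y} n → x ≡ y [mod m ] → x ℤ.^ n ≡ y ℤ.^ n [mod m ]
  mod-^ zero    h = ≡⇒mod refl
  mod-^ (suc n) h = mod-* h (mod-^ n h)

  mod-zero : ∀ {x} → m ∣ˢ x → x ≡ + 0 [mod m ]
  mod-zero {x} (divides k e) = congruent $ divides k (trans (ℤₚ.+-identityʳ x) e)

  zero-mod : ∀ {x} → x ≡ + 0 [mod m ] → m ∣ˢ x
  zero-mod {x} (congruent (divides k e)) = divides k (trans (sym (ℤₚ.+-identityʳ x)) e)

  ∣-respects : ∀ {x y} → x ≡ y [mod m ] → m ∣ˢ y → m ∣ˢ x
  ∣-respects h d = zero-mod (mod-trans h (mod-zero d))

  multiple : ∀ x → m ∣ˢ m * x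
  multiple x = divides x (ℤₚ.*-comm m x)

  multiple-+ : ∀ x y → x + m * y ≡ x [mod m ]
  multiple-+ x y = congruent $ divides y (arith x m y)
    where
    arith : ∀ x m y → (x + m * y) - x ≡ y * m
    arith = solve-∀

open Congruences public

module Valuations {q : ℕ} (prime : Prime (suc q)) where
  open Int using (_+_; _*_; -_; _-_)

  p : ℤ
  p = + suc q

  euclid : ∀ x y → p ∣ˢ x * y → p ∣ˢ x ⊎ p ∣ˢ y
  euclid x y d = case euclidsLemma ℤ.∣ x ∣ ℤ.∣ y ∣ prime (subst (suc q ℕᵈ.∣_) (ℤₚ.abs-* x y) (ℤˢ.∣⇒∣ᵤ d)) of λ where
    (inj₁ d) → inj₁ (ℤˢ.∣ᵤ⇒∣ d)
    (inj₂ d) → inj₂ (ℤˢ.∣ᵤ⇒∣ d)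

  p∤1 : ¬ p ∣ˢ + 1
  p∤1 d = absurd (ℕᵈ.∣1⇒≡1 (ℤˢ.∣⇒∣ᵤ d)) prime
    where
    absurd : ∀ {n} → n ≡ 1 → Prime n → ⊥
    absurd refl (Data.Nat.Primality.prime ⦃ () ⦄ _)

  p∤* : ∀ {x y} → ¬ p ∣ˢ x → ¬ p ∣ˢ y → ¬ p ∣ˢ x * y
  p∤* {x} {y} hx hy d = case euclid x y d of λ where
    (inj₁ e) → hx e
    (inj₂ e) → hy e

  p∤^ : ∀ {x} n → ¬ p ∣ˢ x → ¬ p ∣ˢ x ℤ.^ n
  p∤^ zero    h = p∤1
  p∤^ (suc n) h = p∤* h (p∤^ n h)

  p∣^ : ∀ {x} n → p ∣ˢ x ℤ.^ n → p ∣ˢ x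
  p∣^ {x} zero    d = ⊥-elim (p∤1 d)
  p∣^ {x} (suc n) d = case euclid x (x ℤ.^ n) d of λ where
    (inj₁ e) → e
    (inj₂ e) → p∣^ n e

  p∣?_ : ∀ x → Dec (p ∣ˢ x)
  p∣? x = p ℤˢ.∣? x

  ^-distrib : ∀ n x y → (x * y) ℤ.^ n ≡ x ℤ.^ n * y ℤ.^ n
  ^-distrib zero    x y = refl
  ^-distrib (suc n) x y = trans (cong (x * y *_) (^-distrib n x y)) (rearrange x y (x ℤ.^ n) (y ℤ.^ n))
    where
    rearrange : ∀ x y a b → x * y * (a * b) ≡ x * a * (y * b)
    rearrange = solve-∀

  ^-power : ∀ x n k → (x ℤ.^ k) ℤ.^ n ≡ x ℤ.^ (n ℕ.* k)
  ^-power x n k = trans (ℤₚ.^-*-assoc x k n) (cong (x ℤ.^_) (ℕₚ.*-comm k n))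

  cancel-p^ : ∀ k {x y} → p ℤ.^ k * x ≡ p ℤ.^ k * y → x ≡ y
  cancel-p^ zero    {x} {y} h = trans (sym (ℤₚ.*-identityˡ x)) (trans h (ℤₚ.*-identityˡ y))
  cancel-p^ (suc k) {x} {y} h = cancel-p^ k (ℤₚ.*-cancelˡ-≡ p (p ℤ.^ k * x) (p ℤ.^ k * y) (trans (sym (ℤₚ.*-assoc p (p ℤ.^ k) x)) (trans h (ℤₚ.*-assoc p (p ℤ.^ k) y))))

  -- Valuations round up: `n v(D) > n k` forces `v(D) ≥ k + 1`. A single surplus `p` in an n-th
  -- power thus yields a full factor `p` in the base.
  root-divisible : ∀ n k D → p ℤ.^ (suc (n ℕ.* k)) ∣ˢ D ℤ.^ n → p ℤ.^ suc k ∣ˢ D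
  root-divisible n zero D (divides c e) = case p∣^ {D} n (divides (c * p ℤ.^ (n ℕ.* 0)) (trans e (rearrange c p (p ℤ.^ (n ℕ.* 0))))) of λ where
      (divides d e') → divides d (trans e' (cong (d *_) (sym (ℤₚ.*-identityʳ p))))
    where
    rearrange : ∀ c p r → c * (p * r) ≡ c * r * p
    rearrange = solve-∀
  root-divisible n (suc k) D h@(divides c e) = case root-divisible n k D (divides (c * p ℤ.^ n) lower) of λ where
      (divides d e') → case root-divisible n 0 d (divides c (top d e')) of λ where
        (divides f e'') → divides f (trans e' (trans (cong (_* p ℤ.^ suc k) e'') (rearrange f p (p ℤ.^ suc k))))
    where
    rearrange : ∀ f p r → f * (p * + 1) * r ≡ f * (p * r)
    rearrange = solve-∀
    rearrange₂ : ∀ c p a b → c * (p * (a * b)) ≡ c * a * (p * b)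
    rearrange₂ = solve-∀
    rearrange₃ : ∀ a b c p → b * (c * (p * a)) ≡ b * a * (c * p)
    rearrange₃ = solve-∀
    exponents : p ℤ.^ (n ℕ.* suc k) ≡ p ℤ.^ n * p ℤ.^ (n ℕ.* k)
    exponents = trans (cong (p ℤ.^_) (ℕₚ.*-suc n k)) (ℤₚ.^-distribˡ-+-* p n (n ℕ.* k))
    lower : D ℤ.^ n ≡ c * p ℤ.^ n * p ℤ.^ suc (n ℕ.* k)
    lower = trans e (trans (cong (λ x → c * (p * x)) exponents) (rearrange₂ c p (p ℤ.^ n) (p ℤ.^ (n ℕ.* k))))
    top : ∀ d → D ≡ d * p ℤ.^ suc k → d ℤ.^ n ≡ c * p ℤ.^ suc (n ℕ.* 0)
    top d e' = cancel-p^ (n ℕ.* suc k) (begin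
      p ℤ.^ (n ℕ.* suc k) * d ℤ.^ n        ≡⟨ cong (_* d ℤ.^ n) (sym (^-power p n (suc k))) ⟩
      (p ℤ.^ suc k) ℤ.^ n * d ℤ.^ n        ≡⟨ ℤₚ.*-comm ((p ℤ.^ suc k) ℤ.^ n) (d ℤ.^ n) ⟩
      d ℤ.^ n * (p ℤ.^ suc k) ℤ.^ n        ≡⟨ sym (^-distrib n d (p ℤ.^ suc k)) ⟩
      (d * p ℤ.^ suc k) ℤ.^ n              ≡⟨ cong (ℤ._^ n) (sym e') ⟩
      D ℤ.^ n                              ≡⟨ e ⟩
      c * (p * p ℤ.^ (n ℕ.* suc k))        ≡⟨ swap c p (p ℤ.^ (n ℕ.* suc k)) ⟩
      p ℤ.^ (n ℕ.* suc k) * (c * (p * + 1)) ≡⟨ cong (λ x → p ℤ.^ (n ℕ.* suc k) * (c * (p * p ℤ.^ x))) (sym (ℕₚ.*-zeroʳ n)) ⟩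
      p ℤ.^ (n ℕ.* suc k) * (c * p ℤ.^ suc (n ℕ.* 0)) ∎)
      where
      open ≡-Reasoning
      swap : ∀ c p r → c * (p * r) ≡ r * (c * (p * + 1))
      swap = solve-∀

  weaken : ∀ {a b} {x : ℤ} → a ℕ.≤ b → p ℤ.^ b ∣ˢ x → p ℤ.^ a ∣ˢ x
  weaken {a} {b} a≤b (divides c e) = divides (c * p ℤ.^ (b ℕ.∸ a)) (trans e (trans (cong (λ k → c * p ℤ.^ k) (sym (ℕₚ.m∸n+n≡m a≤b)))
    (trans (cong (c *_) (ℤₚ.^-distribˡ-+-* p (b ℕ.∸ a) a)) (sym (ℤₚ.*-assoc c (p ℤ.^ (b ℕ.∸ a)) (p ℤ.^ a))))))

  combine : ∀ {a b} {x y : ℤ} → p ℤ.^ a ∣ˢ x → p ℤ.^ b ∣ˢ y → p ℤ.^ (a ℕ.+ b) ∣ˢ x * y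
  combine {a} {b} (divides c e) (divides d f) = divides (c * d) (trans (cong₂ _*_ e f) (trans (rearrange c d (p ℤ.^ a) (p ℤ.^ b))
    (cong (c * d *_) (sym (ℤₚ.^-distribˡ-+-* p a b)))))
    where
    rearrange : ∀ c d a b → c * a * (d * b) ≡ c * d * (a * b)
    rearrange = solve-∀

  root-divides : ∀ n k D → p ℤ.^ (suc n ℕ.* k) ∣ˢ D ℤ.^ suc n → p ℤ.^ k ∣ˢ D
  root-divides n zero    D h = divides D (sym (ℤₚ.*-identityʳ D))
  root-divides n (suc k) D h = root-divisible (suc n) k D
    (weaken (subst (suc (suc n ℕ.* k) ℕ.≤_) (sym (ℕₚ.*-suc (suc n) k)) (ℕ.s≤s (ℕₚ.m≤n+m _ n))) h)

  -- A cofactor prime to `p` also excludes `D = 0`, so that valuations can be cancelled.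
  record Exactly (k : ℕ) (D : ℤ) : Set where
    constructor exactly
    field
      cofactor : ℤ
      equation : D ≡ p ℤ.^ k * cofactor
      coprime  : ¬ p ∣ˢ cofactor

  exactly-∣ : ∀ {k D} → Exactly k D → p ℤ.^ k ∣ˢ D
  exactly-∣ {k} (exactly u e _) = divides u (trans e (ℤₚ.*-comm (p ℤ.^ k) u))

  exactly-∤ : ∀ {k D} → Exactly k D → ¬ p ℤ.^ suc k ∣ˢ D
  exactly-∤ {k} (exactly u e p∤u) (divides c f) = p∤u (divides c (cancel-p^ k (trans (sym e) (trans f (rearrange c p (p ℤ.^ k))))))
    where
    rearrange : ∀ c p r → c * (p * r) ≡ r * (c * p)
    rearrange = solve-∀

  exactly-* : ∀ {k l D E} → Exactly k D → Exactly l E → Exactly (k ℕ.+ l) (D * E)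
  exactly-* {k} {l} (exactly u e p∤u) (exactly v f p∤v) = exactly (u * v) (trans (cong₂ _*_ e f)
    (trans (rearrange (p ℤ.^ k) u (p ℤ.^ l) v) (cong (_* (u * v)) (sym (ℤₚ.^-distribˡ-+-* p k l))))) (p∤* p∤u p∤v)
    where
    rearrange : ∀ a u b v → a * u * (b * v) ≡ a * b * (u * v)
    rearrange = solve-∀

  exactly-unit : ∀ {u} → ¬ p ∣ˢ u → Exactly 0 u
  exactly-unit {u} h = exactly u (sym (ℤₚ.*-identityˡ u)) h

  exactly-p^ : ∀ k → Exactly k (p ℤ.^ k)
  exactly-p^ k = exactly (+ 1) (sym (ℤₚ.*-identityʳ (p ℤ.^ k))) p∤1

  exactly-root : ∀ n k D → Exactly (suc n ℕ.* k) (D ℤ.^ suc n) → Exactly k D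
  exactly-root n k D h@(exactly u e p∤u) = case root-divides n k D (exactly-∣ h) of λ where
      (divides d e') → exactly d (trans e' (ℤₚ.*-comm d (p ℤ.^ k))) (λ p∣d → p∤u (subst (p ∣ˢ_) (same d e') (p∣power d p∣d)))
    where
    same : ∀ d → D ≡ d * p ℤ.^ k → d ℤ.^ suc n ≡ u
    same d e' = cancel-p^ (suc n ℕ.* k) (trans (cong (_* d ℤ.^ suc n) (sym (^-power p (suc n) k))) (trans (ℤₚ.*-comm ((p ℤ.^ k) ℤ.^ suc n) (d ℤ.^ suc n))
      (trans (sym (^-distrib (suc n) d (p ℤ.^ k))) (trans (cong (ℤ._^ suc n) (sym e')) e))))
    p∣power : ∀ d → p ∣ˢ d → p ∣ˢ d ℤ.^ suc n
    p∣power d (divides c f) = divides (c * d ℤ.^ n) (trans (cong (_* d ℤ.^ n) f) (rearrange c p (d ℤ.^ n)))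
      where
      rearrange : ∀ c p r → c * p * r ≡ c * r * p
      rearrange = solve-∀

  -- Allows the valuation of a determinant to be read off after multiplication by an auxiliary
  -- factor of known valuation.
  exactly-cancel : ∀ k l D E → Exactly l E → Exactly (k ℕ.+ l) (D * E) → Exactly k D
  exactly-cancel k l D E (exactly v f p∤v) (exactly u e p∤u) = case unit-divides k D eq of λ where
      (d , e') → exactly d e' (λ p∣d → p∤u (subst (p ∣ˢ_) (cancel-p^ k (trans (sym (ℤₚ.*-assoc (p ℤ.^ k) d v)) (trans (cong (_* v) (sym e')) eq))) (ℤˢ.∣m⇒∣m*n v p∣d)))
    where
    eq : D * v ≡ p ℤ.^ k * u
    eq = cancel-p^ l (trans (rearrange (p ℤ.^ l) D v) (trans (cong (D *_) (sym f)) (trans e (trans (cong (_* u) (ℤₚ.^-distribˡ-+-* p k l)) (rearrange₂ (p ℤ.^ k) (p ℤ.^ l) u)))))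
      where
      rearrange : ∀ a d v → a * (d * v) ≡ d * (a * v)
      rearrange = solve-∀
      rearrange₂ : ∀ a b u → a * b * u ≡ b * (a * u)
      rearrange₂ = solve-∀
    unit-divides : ∀ k → ∀ D → D * v ≡ p ℤ.^ k * u → ∃ λ d → D ≡ p ℤ.^ k * d
    unit-divides zero    D e = D , sym (ℤₚ.*-identityˡ D)
    unit-divides (suc k) D e = case euclid D v (divides (p ℤ.^ k * u) (trans e (rearrange p (p ℤ.^ k) u))) of λ where
        (inj₂ d) → ⊥-elim (p∤v d)
        (inj₁ (divides D' e')) → case unit-divides k D' (ℤₚ.*-cancelˡ-≡ p (D' * v) (p ℤ.^ k * u) (trans (rearrange₃ p D' v) (trans (cong (_* v) (sym e')) (trans e (ℤₚ.*-assoc p (p ℤ.^ k) u))))) of λ where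
          (d , e'') → d , trans e' (trans (cong (_* p) e'') (rearrange₂ (p ℤ.^ k) d p))
      where
      rearrange : ∀ p a u → p * a * u ≡ a * u * p
      rearrange = solve-∀
      rearrange₂ : ∀ a d p → a * d * p ≡ p * a * d
      rearrange₂ = solve-∀
      rearrange₃ : ∀ p d v → p * (d * v) ≡ d * p * v
      rearrange₃ = solve-∀

module Residues (q : ℕ) where
  open Int using (_+_; _*_; -_; _-_)

  m : ℤ
  m = + suc q

  residue : ℤ → Fin (suc q)
  residue = modFin (suc q)

  ⟪_⟫ : Fin (suc q) → ℤ
  ⟪ i ⟫ = + toℕ i

  ⟪residue⟫ : ∀ x → ⟪ residue x ⟫ ≡ x [mod m ]
  ⟪residue⟫ x = mod-trans (≡⇒mod (cong +_ (Finₚ.toℕ-fromℕ< (n%ℕd<d x (suc q)))))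
    (congruent (divides (- (x /ℕ suc q)) (≡.trans (cong (λ y → + (x %ℕ suc q) - y) (a≡a%ℕn+[a/ℕn]*n x (suc q)))
      (arith (+ (x %ℕ suc q)) (x /ℕ suc q) m))))
    where
    arith : ∀ r k m → r - (r + k * m) ≡ - k * m
    arith = solve-∀

  ⟪⟫-injective : ∀ i j → ⟪ i ⟫ ≡ ⟪ j ⟫ [mod m ] → i ≡ j
  ⟪⟫-injective i j (congruent d) = Finₚ.toℕ-injective (ℤₚ.+-injective (ℤₚ.i-j≡0⇒i≡j ⟪ i ⟫ ⟪ j ⟫ (ℤₚ.∣i∣≡0⇒i≡0
      (small (ℤˢ.∣⇒∣ᵤ d) (ℕₚ.≤-<-trans (≡.subst (λ z → ℤ.∣ z ∣ ℕ.≤ toℕ i ℕ.⊔ toℕ j) (≡.sym (ℤₚ.m-n≡m⊖n (toℕ i) (toℕ j))) (ℤₚ.∣m⊝n∣≤m⊔n (toℕ i) (toℕ j)))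
        (ℕₚ.⊔-pres-<m (Finₚ.toℕ<n i) (Finₚ.toℕ<n j)))))))
    where
    open import Data.Nat.Divisibility using (_∣_)
    small : ∀ {k} → suc q ∣ k → k ℕ.< suc q → k ≡ 0
    small {zero}  d lt = refl
    small {suc k} d lt = ⊥-elim (ℕₚ.<⇒≱ lt (ℕᵈ.∣⇒≤ d))

  residue-⟪⟫ : ∀ i → residue ⟪ i ⟫ ≡ i
  residue-⟪⟫ i = ⟪⟫-injective _ i (⟪residue⟫ ⟪ i ⟫)

  residue-cong : ∀ {x y} → x ≡ y [mod m ] → residue x ≡ residue y
  residue-cong {x} {y} h = ⟪⟫-injective _ _ (mod-trans (⟪residue⟫ x) (mod-trans h (mod-sym (⟪residue⟫ y))))

  residue-injective : ∀ {x y} → residue x ≡ residue y → x ≡ y [mod m ]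
  residue-injective {x} {y} h = mod-trans (mod-sym (⟪residue⟫ x)) (mod-trans (≡⇒mod (cong ⟪_⟫ h)) (⟪residue⟫ y))

  translate : ℤ → Fin (suc q) → Fin (suc q)
  translate x i = residue (x + ⟪ i ⟫)

  translate-cong : ∀ {x y} → x ≡ y [mod m ] → ∀ i → translate x i ≡ translate y i
  translate-cong h i = residue-cong (mod-+ʳ ⟪ i ⟫ h)

  translate-∘ : ∀ x y i → translate x (translate y i) ≡ translate (x + y) i
  translate-∘ x y i = residue-cong (mod-trans (mod-+ˡ x (⟪residue⟫ (y + ⟪ i ⟫))) (≡⇒mod (≡.sym (ℤₚ.+-assoc x y ⟪ i ⟫))))

  translate-0 : ∀ i → translate (+ 0) i ≡ i
  translate-0 i = ≡.trans (cong residue (ℤₚ.+-identityˡ ⟪ i ⟫)) (residue-⟪⟫ i)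

-- The regular representation of the Heisenberg group

module Heisenberg (q : ℕ) where
  open Int using (_+_; _*_; -_; _-_)
  open Residues q public
  open Matrices

  -- The triple (i , j , k) stands for x^i y^j z^k in the Heisenberg group over ℤ.
  G : Set
  G = ℤ × ℤ × ℤ

  infixl 7 _⋆_
  _⋆_ : G → G → G
  (i , j , k) ⋆ (i' , j' , k') = i + i' , j + j' , k + k' + j * i'

  H : FinSet
  H = fin (suc q) ⊗ (fin (suc q) ⊗ fin (suc q))

  -- Left multiplication by `x^i y^j z^k`: moving `y^j` past `x^a` produces `z^(ja)`.
  act : G → ∣ H ∣ → ∣ H ∣
  act (i , j , k) (a , b , c) = translate i a , translate j b , translate (k + j * ⟪ a ⟫) c

  triple-cong : ∀ {a a' b b' c c' : Fin (suc q)} → a ≡ a' → b ≡ b' → c ≡ c' → (a , b , c) ≡ (a' , b' , c')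
  triple-cong refl refl refl = refl

  act-cong : ∀ {i i' j j' k k'} → i ≡ i' [mod m ] → j ≡ j' [mod m ] → k ≡ k' [mod m ] → ∀ u → act (i , j , k) u ≡ act (i' , j' , k') u
  act-cong hi hj hk (a , b , c) = triple-cong (translate-cong hi a) (translate-cong hj b) (translate-cong (mod-+ hk (mod-*ʳ ⟪ a ⟫ hj)) c)

  act-∘ : ∀ g h u → act g (act h u) ≡ act (g ⋆ h) u
  act-∘ (i , j , k) (i' , j' , k') (a , b , c) = triple-cong (translate-∘ i i' a) (translate-∘ j j' b)
    (≡.trans (translate-∘ (k + j * ⟪ translate i' a ⟫) (k' + j' * ⟪ a ⟫) c) (translate-cong (mod-trans (mod-+ʳ (k' + j' * ⟪ a ⟫) (mod-+ˡ k (mod-*ˡ j (⟪residue⟫ (i' + ⟪ a ⟫)))))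
      (≡⇒mod (arith k j i' ⟪ a ⟫ k' j'))) c))
    where
    arith : ∀ k j i' a k' j' → k + j * (i' + a) + (k' + j' * a) ≡ k + k' + j * i' + (j + j') * a
    arith = solve-∀

  act-1 : ∀ u → act (+ 0 , + 0 , + 0) u ≡ u
  act-1 (a , b , c) = triple-cong (translate-0 a) (translate-0 b) (translate-0 c)

  reduce : G → ∣ H ∣
  reduce (i , j , k) = residue i , residue j , residue k

  embed : ∣ H ∣ → G
  embed (a , b , c) = ⟪ a ⟫ , ⟪ b ⟫ , ⟪ c ⟫

  reduce-embed : ∀ u → reduce (embed u) ≡ u
  reduce-embed (a , b , c) = triple-cong (residue-⟪⟫ a) (residue-⟪⟫ b) (residue-⟪⟫ c)

  -- `u v⁻¹` without reduction modulo `p`, so that integer ring identities apply to its exponents.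
  quotient-triple : ∣ H ∣ → ∣ H ∣ → G
  quotient-triple (a , b , c) (d , e , f) = ⟪ a ⟫ - ⟪ d ⟫ , ⟪ b ⟫ - ⟪ e ⟫ , ⟪ c ⟫ + (- ⟪ f ⟫ + ⟪ d ⟫ * ⟪ e ⟫) + ⟪ b ⟫ * (- ⟪ d ⟫)

  quotient-correct : ∀ u v → Hmul (suc q) u (Hinv (suc q) v) ≡ reduce (quotient-triple u v)
  quotient-correct (a , b , c) (d , e , f) = triple-cong
    (residue-cong (mod-+ˡ ⟪ a ⟫ (⟪residue⟫ (- ⟪ d ⟫)))) (residue-cong (mod-+ˡ ⟪ b ⟫ (⟪residue⟫ (- ⟪ e ⟫))))
    (residue-cong (mod-+ (mod-+ˡ ⟪ c ⟫ (⟪residue⟫ (- ⟪ f ⟫ + ⟪ d ⟫ * ⟪ e ⟫))) (mod-*ˡ ⟪ b ⟫ (⟪residue⟫ (- ⟪ d ⟫)))))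

  private
    reduce-parts : ∀ g h → reduce g ≡ reduce h →
      proj₁ g ≡ proj₁ h [mod m ] × proj₁ (proj₂ g) ≡ proj₁ (proj₂ h) [mod m ] × proj₂ (proj₂ g) ≡ proj₂ (proj₂ h) [mod m ]
    reduce-parts (i , j , k) (i' , j' , k') e = residue-injective {i} {i'} (cong proj₁ e) ,
      residue-injective {j} {j'} (cong (proj₁ ∘ proj₂) e) , residue-injective {k} {k'} (cong (proj₂ ∘ proj₂) e)

  reduce⇒act : ∀ g u v → reduce g ≡ Hmul (suc q) u (Hinv (suc q) v) → u ≡ act g v
  reduce⇒act (i , j , k) u@(a , b , c) v@(d , e , f) h = case reduce-parts (i , j , k) (quotient-triple u v) (≡.trans h (quotient-correct u v)) of λ where
      (hi , hj , hk) → triple-cong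
        (⟪⟫-injective a _ (mod-sym (mod-trans (⟪residue⟫ (i + ⟪ d ⟫)) (mod-trans (mod-+ʳ ⟪ d ⟫ hi) (≡⇒mod (arith₁ ⟪ a ⟫ ⟪ d ⟫))))))
        (⟪⟫-injective b _ (mod-sym (mod-trans (⟪residue⟫ (j + ⟪ e ⟫)) (mod-trans (mod-+ʳ ⟪ e ⟫ hj) (≡⇒mod (arith₁ ⟪ b ⟫ ⟪ e ⟫))))))
        (⟪⟫-injective c _ (mod-sym (mod-trans (⟪residue⟫ (k + j * ⟪ d ⟫ + ⟪ f ⟫))
          (mod-trans (mod-+ʳ ⟪ f ⟫ (mod-+ hk (mod-*ʳ ⟪ d ⟫ hj))) (≡⇒mod (arith₂ ⟪ b ⟫ ⟪ c ⟫ ⟪ d ⟫ ⟪ e ⟫ ⟪ f ⟫))))))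
    where
    arith₁ : ∀ a d → a - d + d ≡ a
    arith₁ = solve-∀
    arith₂ : ∀ b c d e f → c + (- f + d * e) + b * (- d) + (b - e) * d + f ≡ c
    arith₂ = solve-∀

  act⇒reduce : ∀ g u v → u ≡ act g v → reduce g ≡ Hmul (suc q) u (Hinv (suc q) v)
  act⇒reduce (i , j , k) u v@(d , e , f) refl = ≡.sym (≡.trans (quotient-correct u v) (triple-cong
    (residue-cong (mod-trans (mod-+ʳ (- ⟪ d ⟫) (⟪residue⟫ (i + ⟪ d ⟫))) (≡⇒mod (arith₁ i ⟪ d ⟫))))
    (residue-cong (mod-trans (mod-+ʳ (- ⟪ e ⟫) (⟪residue⟫ (j + ⟪ e ⟫))) (≡⇒mod (arith₁ j ⟪ e ⟫))))
    (residue-cong (mod-trans (mod-+ (mod-+ʳ (- ⟪ f ⟫ + ⟪ d ⟫ * ⟪ e ⟫) (⟪residue⟫ (k + j * ⟪ d ⟫ + ⟪ f ⟫))) (mod-*ʳ (- ⟪ d ⟫) (⟪residue⟫ (j + ⟪ e ⟫))))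
      (≡⇒mod (arith₂ j k ⟪ d ⟫ ⟪ e ⟫ ⟪ f ⟫))))))
    where
    arith₁ : ∀ i d → i + d - d ≡ i
    arith₁ = solve-∀
    arith₂ : ∀ j k d e f → k + j * d + f + (- f + d * e) + (j + e) * (- d) ≡ k
    arith₂ = solve-∀

  ρ : G → Mat H H
  ρ = permutation H act

  -- `u = g v` means `g = u v⁻¹`: the left regular representation has the index pattern of the group
  -- determinant.
  ρ-entry : ∀ g u v → at (ρ g) u v ≡ δ H (reduce g) (Hmul (suc q) u (Hinv (suc q) v))
  ρ-entry g u v = δ-⇔ H H (act⇒reduce g u v) (reduce⇒act g u v)

  opaque
    unfolding Matrices.Det

    M-Det : ∀ F → M (suc q) F ≡ Det {H} (mat λ u v → coeff (suc q) F (Hmul (suc q) u (Hinv (suc q) v)))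
    M-Det F = Determinants.det-cong _ (λ i j → cong₂ (λ u v → coeff (suc q) F (Hmul (suc q) u (Hinv (suc q) v))) (decode-to i) (decode-to j))
      where
      decode-to : ∀ i → decode (suc q) i ≡ to H i
      -- `H` is nested in the same way as the product in `decode`, so both enumerations agree by
      -- computation.
      decode-to i = refl

  groupSum : ∀ n → (Fin n → Expr G) → Expr G
  groupSum zero    f = con (+ 0)
  groupSum (suc n) f = f zero :+ groupSum n (f ∘ suc)

  element : Coeffs (suc q) → Expr G
  element F = groupSum (size H) (λ i → con (coeff (suc q) F (to H i)) :* var (embed (to H i)))

  scalar-entry : ∀ x g u v → at (ev ρ (con x :* var g)) u v ≡ x * δ H (reduce g) (Hmul (suc q) u (Hinv (suc q) v))
  scalar-entry x g u v = ≡.trans (entry (MatrixAlgebra.ι-∙ H x (ρ g)) u v) (cong (x *_) (ρ-entry g u v))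

  M-element : ∀ F → M (suc q) F ≡ Det (ev ρ (element F))
  M-element F = ≡.trans (M-Det F) (Det-cong {H} (pointwise λ u v → ≡.sym (entries u v)))
    where
    sum-entry : ∀ n (f : Fin n → Expr G) u v → at (ev ρ (groupSum n f)) u v ≡ sumFin n (λ i → at (ev ρ (f i)) u v)
    sum-entry zero    f u v = ℤₚ.*-zeroˡ (δ H u v)
    sum-entry (suc n) f u v = cong (λ y → at (ev ρ (f zero)) u v + y) (sum-entry n (f ∘ suc) u v)
    entries : ∀ u v → at (ev ρ (element F)) u v ≡ coeff (suc q) F (Hmul (suc q) u (Hinv (suc q) v))
    entries u v = ≡.trans (sum-entry (size H) (λ i → con (coeff (suc q) F (to H i)) :* var (embed (to H i))) u v) (≡.trans (Σ-cong H (λ g → ≡.trans (scalar-entry (coeff (suc q) F g) (embed g) u v)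
        (cong (λ x → coeff (suc q) F g * δ H x (Hmul (suc q) u (Hinv (suc q) v))) (reduce-embed g))))
      (Σ-δʳ H (coeff (suc q) F) (Hmul (suc q) u (Hinv (suc q) v))))

-- p-th powers in the group ring modulo p and (1 - z)^(p-1)

module GroupRing (q : ℕ) (prime : Prime (suc q)) (2≤q : 2 ℕ.≤ q) where
  open Heisenberg q public
  open Valuations prime public

  E : Algebra
  E = repAlgebra ρ

  open Algebra E
  open AlgebraPowers E
  open Solver E
  open Reasoning

  var-cong : ∀ {g h} → (∀ u → act g u ≡ act h u) → var g ≈ var h
  var-cong h = lift[ ρ ] (Matrices.Fm-cong H H h)

  var-≡ : ∀ {i j k i' j' k'} → i ≡ i' → j ≡ j' → k ≡ k' → var (i , j , k) ≈ var (i' , j' , k')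
  var-≡ refl refl refl = ≈-refl

  var-⋆ : ∀ g h → var g :* var h ≈ var (g ⋆ h)
  var-⋆ g h = lift[ ρ ] (Matrices.≈-trans (Matrices.Fm-∙ H H H (act g) (act h)) (Matrices.Fm-cong H H (act-∘ g h)))

  var-trivial : ∀ {g} → (∀ u → act g u ≡ u) → var g ≈ con (+ 1)
  var-trivial h = lift[ ρ ] (pointwise λ u v → ≡.trans (cong (δ H u) (h v)) (≡.sym (ℤₚ.*-identityˡ (δ H u v))))

  var-1 : var (+ 0 , + 0 , + 0) ≈ con (+ 1)
  var-1 = var-trivial act-1

  triangle : ℕ → ℤ
  triangle zero    = + 0
  triangle (suc n) = triangle n ℤ.+ + n

  -- The exponents of `(x^i y^j z^k)^n`: moving the factors `y^j` past the later `x^i` collects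
  -- `z^(ij)` once for each of the `n(n-1)/2` pairs.
  multiply : ℕ → G → G
  multiply n (i , j , k) = + n ℤ.* i , + n ℤ.* j , + n ℤ.* k ℤ.+ i ℤ.* j ℤ.* triangle n

  var-^ : ∀ g n → var g ^ n ≈ var (multiply n g)
  var-^ (i , j , k) zero    = ≈-sym (≈-trans (var-≡ (ℤₚ.*-zeroˡ i) (ℤₚ.*-zeroˡ j) (≡.trans (cong₂ ℤ._+_ (ℤₚ.*-zeroˡ k) (ℤₚ.*-zeroʳ (i ℤ.* j))) refl)) var-1)
  var-^ (i , j , k) (suc n) = begin
    var (i , j , k) :* var (i , j , k) ^ n                ≈⟨ *-cong₂ (var-^ (i , j , k) n) ⟩
    var (i , j , k) :* var (multiply n (i , j , k))       ≈⟨ var-⋆ (i , j , k) (multiply n (i , j , k)) ⟩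
    var ((i , j , k) ⋆ multiply n (i , j , k))            ≈⟨ var-≡ (arith₁ (+ n) i) (arith₁ (+ n) j) (arith₂ (+ n) i j k (triangle n)) ⟩
    var (multiply (suc n) (i , j , k))                    ∎
    where
    arith₁ : ∀ n i → i ℤ.+ n ℤ.* i ≡ (+ 1 ℤ.+ n) ℤ.* i
    arith₁ = solve-∀
    arith₂ : ∀ n i j k t → k ℤ.+ (n ℤ.* k ℤ.+ i ℤ.* j ℤ.* t) ℤ.+ j ℤ.* (n ℤ.* i) ≡ (+ 1 ℤ.+ n) ℤ.* k ℤ.+ i ℤ.* j ℤ.* (t ℤ.+ n)
    arith₂ = solve-∀

  triangle-double : ∀ n → + 2 ℤ.* triangle (suc n) ≡ + suc n ℤ.* + n
  triangle-double zero    = refl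
  triangle-double (suc n) = ≡.trans (ℤₚ.*-distribˡ-+ (+ 2) (triangle (suc n)) (+ suc n)) (≡.trans (cong (ℤ._+ + 2 ℤ.* + suc n) (triangle-double n)) (arith (+ n)))
    where
    arith : ∀ n → (+ 1 ℤ.+ n) ℤ.* n ℤ.+ + 2 ℤ.* (+ 1 ℤ.+ n) ≡ (+ 1 ℤ.+ (+ 1 ℤ.+ n)) ℤ.* (+ 1 ℤ.+ n)
    arith = solve-∀

  -- `2 · triangle p = p(p-1)` and `p` is not 2. Hence every group element has order dividing `p`,
  -- which fails for `p = 2`.
  p∣triangle : p ∣ˢ triangle (suc q)
  p∣triangle = case euclid (+ 2) (triangle (suc q)) (divides (+ q) (≡.trans (triangle-double q) (ℤₚ.*-comm (+ suc q) (+ q)))) of λ where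
      (inj₁ d) → ⊥-elim (ℕₚ.<⇒≱ (ℕ.s≤s 2≤q) (ℕᵈ.∣⇒≤ (ℤˢ.∣⇒∣ᵤ d)))
      (inj₂ d) → d

  var-^p : ∀ g → var g ^ suc q ≈ con (+ 1)
  var-^p (i , j , k) = ≈-trans (var-^ (i , j , k) (suc q)) (≈-trans (var-cong (act-cong (mod-zero (multiple i)) (mod-zero (multiple j))
    (mod-zero (ℤˢ.∣m∣n⇒∣m+n (multiple k) (ℤˢ.∣n⇒∣m*n (i ℤ.* j) p∣triangle))))) var-1)

  z : G
  z = + 0 , + 0 , + 1

  s : Expr G
  s = con (+ 1) - var z

  central : ∀ c → (∀ g → c :* var g ≈ var g :* c) → Central c
  central c h (con x)  = ≈-sym (ι-central x c)
  central c h (var g)  = h g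
  central c h (a :+ b) = ≈-trans (*-distribˡ c a b) (≈-trans (+-cong (central c h a) (central c h b)) (≈-sym (*-distribʳ c a b)))
  central c h (a :* b) = ≈-trans (≈-sym (*-assoc c a b)) (≈-trans (*-cong₁ (central c h a)) (≈-trans (*-assoc a c b)
    (≈-trans (*-cong₂ (central c h b)) (≈-sym (*-assoc a b c)))))

  z-central : ∀ k → Central (var (+ 0 , + 0 , k))
  z-central k = central _ λ (i' , j' , k') → ≈-trans (var-⋆ (+ 0 , + 0 , k) (i' , j' , k')) (≈-trans
    (var-≡ (ℤₚ.+-comm (+ 0) i') (ℤₚ.+-comm (+ 0) j') (arith k k' i' j'))
    (≈-sym (var-⋆ (i' , j' , k') (+ 0 , + 0 , k))))
    where
    arith : ∀ k k' i' j' → k ℤ.+ k' ℤ.+ + 0 ℤ.* i' ≡ k' ℤ.+ k ℤ.+ j' ℤ.* + 0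
    arith = solve-∀

  s-central : Central s
  s-central a = begin
    s :* a                                      ≈⟨ solve (var z ∷ a ∷ []) ((con (+ 1) :- x₀) :* x₁) (x₁ :- x₀ :* x₁) refl ⟩
    a - var z :* a                              ≈⟨ +-cong₂ (*-cong₂ (z-central (+ 1) a)) ⟩
    a - a :* var z                              ≈⟨ solve (var z ∷ a ∷ []) (x₁ :- x₁ :* x₀) (x₁ :* (con (+ 1) :- x₀)) refl ⟩
    a :* s                                      ∎

  -- The exponent is the alternating form `j i' - j' i`, reduced to a natural number so that
  -- `geometric` exhibits `1 - z^n` as a multiple of `1 - z`.
  var-exchange : ∀ g h → ∃ λ n → var g :* var h ≈ (var h :* var g) :* var z ^ n
  var-exchange g@(i , j , k) h@(i' , j' , k') = toℕ (residue m') , ≈-sym (begin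
    (var h :* var g) :* var z ^ n                      ≈⟨ *-cong₁ (var-⋆ h g) ⟩
    var (h ⋆ g) :* var z ^ n                           ≈⟨ *-cong₂ (≈-trans (var-^ z n) (var-cong (act-cong (≡⇒mod (ℤₚ.*-zeroʳ (+ n))) (≡⇒mod (ℤₚ.*-zeroʳ (+ n)))
                                                            (mod-trans (≡⇒mod (arith₀ (+ n) (triangle n))) (⟪residue⟫ m'))))) ⟩
    var (h ⋆ g) :* var (+ 0 , + 0 , m')                ≈⟨ var-⋆ (h ⋆ g) (+ 0 , + 0 , m') ⟩
    var (h ⋆ g ⋆ (+ 0 , + 0 , m'))                     ≈⟨ var-≡ (arith₁ i i') (arith₁ j j') (arith₂ i j k i' j' k') ⟩
    var (g ⋆ h)                                        ≈⟨ ≈-sym (var-⋆ g h) ⟩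
    var g :* var h                                     ∎)
    where
    m' : ℤ
    m' = j ℤ.* i' ℤ.- j' ℤ.* i
    n : ℕ
    n = toℕ (residue m')
    arith₀ : ∀ n t → n ℤ.* + 1 ℤ.+ + 0 ℤ.* + 0 ℤ.* t ≡ n
    arith₀ = solve-∀
    arith₁ : ∀ i i' → i' ℤ.+ i ℤ.+ + 0 ≡ i ℤ.+ i'
    arith₁ = solve-∀
    arith₂ : ∀ i j k i' j' k' → k' ℤ.+ k ℤ.+ j' ℤ.* i ℤ.+ (j ℤ.* i' ℤ.- j' ℤ.* i) ℤ.+ (j' ℤ.+ j) ℤ.* + 0 ≡ k ℤ.+ k' ℤ.+ j ℤ.* i'
    arith₂ = solve-∀

  private
    S : ∃ Central
    S = s , s-central

  -- The Leibniz rule in each argument reduces to group elements, where `gh - hg = -hg (1 - z^n)`.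
  commutator : ∀ a b → ∃ λ c → a :* b - b :* a ≈ s :* c
  commutator (con x) b = con (+ 0) , ≈-trans (+-cong₁ (ι-central x b)) (≈-trans (a-a≈0 (b :* con x)) (≈-sym (*-zeroʳ s)))
  commutator (var g) (con x) = con (+ 0) , ≈-trans (+-cong₁ (≈-sym (ι-central x (var g)))) (≈-trans (a-a≈0 (con x :* var g)) (≈-sym (*-zeroʳ s)))
  commutator (var g) (var h) = case var-exchange g h of λ where
    (n , e) → con -[1+ 0 ] :* ((var h :* var g) :* geometric (var z) n) , (begin
      var g :* var h - var h :* var g
        ≈⟨ +-cong₁ e ⟩
      (var h :* var g) :* var z ^ n - var h :* var g
        ≈⟨ solve (var h :* var g ∷ var z ^ n ∷ []) (x₀ :* x₁ :- x₀) (con -[1+ 0 ] :* (x₀ :* (con (+ 1) :- x₁))) refl ⟩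
      con -[1+ 0 ] :* ((var h :* var g) :* (con (+ 1) - var z ^ n))
        ≈⟨ *-cong₂ (*-cong₂ (≈-sym ([1-t]*geometric (var z) n))) ⟩
      con -[1+ 0 ] :* ((var h :* var g) :* (s :* geometric (var z) n))
        ≈⟨ solveᶜ (S ∷ []) (var h :* var g ∷ geometric (var z) n ∷ []) (con -[1+ 0 ] :* (x₀ :* (c₀ :* x₁))) (c₀ :* (con -[1+ 0 ] :* (x₀ :* x₁))) refl ⟩
      s :* (con -[1+ 0 ] :* ((var h :* var g) :* geometric (var z) n)) ∎)
  commutator (var g) (a :+ b) = case (commutator (var g) a , commutator (var g) b) of λ where
    ((c , e) , (d , f)) → c :+ d , (begin
      var g :* (a :+ b) - (a :+ b) :* var g
        ≈⟨ solve (var g ∷ a ∷ b ∷ []) (x₀ :* (x₁ :+ x₂) :- (x₁ :+ x₂) :* x₀) ((x₀ :* x₁ :- x₁ :* x₀) :+ (x₀ :* x₂ :- x₂ :* x₀)) refl ⟩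
      (var g :* a - a :* var g) :+ (var g :* b - b :* var g) ≈⟨ +-cong e f ⟩
      s :* c :+ s :* d ≈⟨ ≈-sym (*-distribˡ s c d) ⟩
      s :* (c :+ d) ∎)
  commutator (var g) (a :* b) = case (commutator (var g) a , commutator (var g) b) of λ where
    ((c , e) , (d , f)) → c :* b :+ a :* d , (begin
      var g :* (a :* b) - (a :* b) :* var g
        ≈⟨ solve (var g ∷ a ∷ b ∷ []) (x₀ :* (x₁ :* x₂) :- (x₁ :* x₂) :* x₀) ((x₀ :* x₁ :- x₁ :* x₀) :* x₂ :+ x₁ :* (x₀ :* x₂ :- x₂ :* x₀)) refl ⟩
      (var g :* a - a :* var g) :* b :+ a :* (var g :* b - b :* var g) ≈⟨ +-cong (*-cong₁ e) (*-cong₂ f) ⟩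
      (s :* c) :* b :+ a :* (s :* d)
        ≈⟨ solveᶜ (S ∷ []) (a ∷ b ∷ c ∷ d ∷ []) (c₀ :* x₂ :* x₁ :+ x₀ :* (c₀ :* x₃)) (c₀ :* (x₂ :* x₁ :+ x₀ :* x₃)) refl ⟩
      s :* (c :* b :+ a :* d) ∎)
  commutator (a :+ a') b = case (commutator a b , commutator a' b) of λ where
    ((c , e) , (d , f)) → c :+ d , (begin
      (a :+ a') :* b - b :* (a :+ a')
        ≈⟨ solve (a ∷ a' ∷ b ∷ []) ((x₀ :+ x₁) :* x₂ :- x₂ :* (x₀ :+ x₁)) ((x₀ :* x₂ :- x₂ :* x₀) :+ (x₁ :* x₂ :- x₂ :* x₁)) refl ⟩
      (a :* b - b :* a) :+ (a' :* b - b :* a') ≈⟨ +-cong e f ⟩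
      s :* c :+ s :* d ≈⟨ ≈-sym (*-distribˡ s c d) ⟩
      s :* (c :+ d) ∎)
  commutator (a :* a') b = case (commutator a b , commutator a' b) of λ where
    ((c , e) , (d , f)) → c :* a' :+ a :* d , (begin
      (a :* a') :* b - b :* (a :* a')
        ≈⟨ solve (a ∷ a' ∷ b ∷ []) ((x₀ :* x₁) :* x₂ :- x₂ :* (x₀ :* x₁)) ((x₀ :* x₂ :- x₂ :* x₀) :* x₁ :+ x₀ :* (x₁ :* x₂ :- x₂ :* x₁)) refl ⟩
      (a :* b - b :* a) :* a' :+ a :* (a' :* b - b :* a') ≈⟨ +-cong (*-cong₁ e) (*-cong₂ f) ⟩
      (s :* c) :* a' :+ a :* (s :* d)
        ≈⟨ solveᶜ (S ∷ []) (a ∷ a' ∷ c ∷ d ∷ []) (c₀ :* x₂ :* x₁ :+ x₀ :* (c₀ :* x₃)) (c₀ :* (x₂ :* x₁ :+ x₀ :* x₃)) refl ⟩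
      s :* (c :* a' :+ a :* d) ∎)

  combination : List (ℤ × G) → Expr G
  combination []            = con (+ 0)
  combination ((x , g) ∷ l) = con x :* var g :+ combination l

  private
    combination-++ : ∀ k l → combination (k ++ l) ≈ combination k :+ combination l
    combination-++ []      l = ≈-sym (+-identityˡ _)
    combination-++ (a ∷ k) l = ≈-trans (+-cong₂ (combination-++ k l)) (≈-sym (+-assoc _ _ _))

    scale : ℤ × G → List (ℤ × G) → List (ℤ × G)
    scale (x , g) = List.map (λ (y , h) → x ℤ.* y , g ⋆ h)

    combination-scale : ∀ x g l → combination (scale (x , g) l) ≈ (con x :* var g) :* combination l
    combination-scale x g []            = ≈-sym (*-zeroʳ _)
    combination-scale x g ((y , h) ∷ l) = ≈-trans (+-cong (≈-trans (*-cong (ι-* x y) (≈-sym (var-⋆ g h)))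
        (solveᶜ ((con y , ι-central y) ∷ []) (con x ∷ var g ∷ var h ∷ []) ((x₀ :* c₀) :* (x₁ :* x₂)) ((x₀ :* x₁) :* (c₀ :* x₂)) refl))
        (combination-scale x g l)) (≈-sym (*-distribˡ _ _ _))

    product : List (ℤ × G) → List (ℤ × G) → List (ℤ × G)
    product []      l = []
    product (a ∷ k) l = scale a l ++ product k l

    combination-product : ∀ k l → combination (product k l) ≈ combination k :* combination l
    combination-product []            l = ≈-sym (*-zeroˡ _)
    combination-product ((x , g) ∷ k) l = ≈-trans (combination-++ (scale (x , g) l) (product k l))
      (≈-trans (+-cong (combination-scale x g l) (combination-product k l)) (≈-sym (*-distribʳ _ _ _)))

    linearise : Expr G → List (ℤ × G)
    linearise (con x)  = (x , (+ 0 , + 0 , + 0)) ∷ []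
    linearise (var g)  = (+ 1 , g) ∷ []
    linearise (a :+ b) = linearise a ++ linearise b
    linearise (a :* b) = product (linearise a) (linearise b)

    linearise-correct : ∀ e → e ≈ combination (linearise e)
    linearise-correct (con x)  = ≈-sym (≈-trans (+-identityʳ _) (≈-trans (*-cong₂ var-1) (*-identityʳ _)))
    linearise-correct (var g)  = ≈-sym (≈-trans (+-identityʳ _) (*-identityˡ _))
    linearise-correct (a :+ b) = ≈-trans (+-cong (linearise-correct a) (linearise-correct b)) (≈-sym (combination-++ (linearise a) (linearise b)))
    linearise-correct (a :* b) = ≈-trans (*-cong (linearise-correct a) (linearise-correct b)) (≈-sym (combination-product (linearise a) (linearise b)))

  module Q = Quotient E p (s ^ q) (central-^ q s-central)
  open Q using (_~_; ≈⇒~; _,_by_)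

  frobenius : ∀ a b → (a :+ b) ^ suc q ~ a ^ suc q :+ b ^ suc q
  frobenius a b = ≡.subst₂ _~_ (Q.^-same (a :+ b) (suc q)) (cong₂ _:+_ (Q.^-same a (suc q)) (Q.^-same b (suc q)))
    (Frobenius.frobenius Q.quotient prime Q.p~0 s (λ a → ≈⇒~ (s-central a)) (≡.subst (_~ con (+ 0)) (≡.sym (Q.^-same s q)) Q.τ~0)
      (λ a b → case commutator a b of λ where (c , e) → c , ≈⇒~ e) a b)

  -- `frobenius` splits sums but not products, so the expression is first expanded into terms `x g`,
  -- whose p-th powers are the integers `x^p`.
  power-constant : ∀ e → ∃ λ n → e ^ suc q ~ con n
  power-constant e = case go (linearise e) of λ where
      (n , h) → n , Q.~-trans (≈⇒~ (^-cong (suc q) (linearise-correct e))) h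
    where
    go : ∀ l → ∃ λ n → combination l ^ suc q ~ con n
    go []            = + 0 , ≈⇒~ (*-zeroˡ _)
    go ((x , g) ∷ l) = case go l of λ where
      (n , h) → x ℤ.^ suc q ℤ.+ n , Q.~-trans (frobenius (con x :* var g) (combination l)) (Q.~-trans
        (Q.~-+ (≈⇒~ (≈-trans (^-distrib-* (con x) (var g) (suc q) (ι-central x (var g))) (≈-trans (*-cong₂ (var-^p g)) (≈-trans (*-identityʳ _) (≈-sym (ι-^ x (suc q))))))) h)
        (≈⇒~ (≈-sym (ι-+ (x ℤ.^ suc q) n))))

  ε : Expr G → ℤ
  ε e = Algebra.⟦_⟧ ℤ-algebra e (λ _ → + 1)

  ε-^ : ∀ e n → ε (e ^ n) ≡ ε e ℤ.^ n
  ε-^ e zero    = refl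
  ε-^ e (suc n) = cong (ε e ℤ.*_) (ε-^ e n)

  trivial : G → Mat (fin 1) (fin 1)
  trivial = permutation (fin 1) (λ _ u → u)

  opaque
    unfolding Matrices._∙_ Matrices.Det

    trivial-value : ∀ e → at (ev trivial e) zero zero ≡ ε e
    trivial-value (con x)  = ℤₚ.*-identityʳ x
    trivial-value (var g)  = refl
    trivial-value (a :+ b) = cong₂ ℤ._+_ (trivial-value a) (trivial-value b)
    trivial-value (a :* b) = ≡.trans (ℤₚ.+-identityʳ _) (cong₂ ℤ._*_ (trivial-value a) (trivial-value b))

    Det-trivial : ∀ e → Matrices.Det (ev trivial e) ≡ ε e
    Det-trivial e = ≡.trans (arith (at (ev trivial e) zero zero)) (trivial-value e)
      where
      arith : ∀ u → + 1 ℤ.* (u ℤ.* + 1) ℤ.+ + 0 ≡ u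
      arith = solve-∀

  -- The coordinate sum intertwines every permutation representation with the trivial one, so
  -- augmentations may be compared in any identity there; `u₀` makes the representation nonzero.
  ε-respects : ∀ {I} (act' : G → ∣ I ∣ → ∣ I ∣) (u₀ : ∣ I ∣) {e f} → e ≈[ permutation I act' ] f → ε e ≡ ε f
  ε-respects {I} act' u₀ {e} {f} h = ≡.trans (≡.sym (corner e)) (≡.trans (entry corners zero u₀) (corner f))
    where
    open Matrices hiding (≈-trans; ≈-sym)
    ρ' : G → Mat I I
    ρ' = permutation I act'
    ones : Mat (fin 1) I
    ones = Fm (fin 1) I (λ _ → zero)
    sums : ∀ e → ev trivial e ∙ ones ≈ᴹ ones ∙ ev ρ' e
    sums = intertwine trivial ρ' ones (λ g → Matrices.≈-trans (Fm-∙ (fin 1) (fin 1) I (λ x → x) (λ _ → zero)) (Matrices.≈-sym (Fm-∙ (fin 1) I I (λ _ → zero) (act' g))))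
    corners : ev trivial e ∙ ones ≈ᴹ ev trivial f ∙ ones
    corners = Matrices.≈-trans (sums e) (Matrices.≈-trans (∙-congˡ ones (lower[ ρ' ] h)) (Matrices.≈-sym (sums f)))
    opaque
      unfolding Matrices._∙_

      corner : ∀ e → at (ev trivial e ∙ ones) zero u₀ ≡ ε e
      corner e = ≡.trans (Σ-δʳ (fin 1) (at (ev trivial e) zero) zero) (trivial-value e)

  ε-s^ : ∀ {n} → 1 ℕ.≤ n → ε (s ^ n) ≡ + 0
  ε-s^ {suc n} _ = refl

  1≤q : 1 ℕ.≤ q
  1≤q = ℕₚ.≤-trans (ℕ.s≤s ℕ.z≤n) 2≤q

  -- Applying `ε` to the identity determines `n` modulo `p`, since `1 - z` has augmentation 0.
  power-formula : ∀ e → ∃ λ n → ∃ λ U → ∃ λ W → e ^ suc q ≈ con n :+ (con p :* U :+ s ^ q :* W) × n ≡ ε e ℤ.^ suc q [mod p ]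
  power-formula e = case power-constant e of λ where
    (n , (U , W by h)) → n , U , W , h , mod-sym (mod-trans (≡⇒mod (≡.trans (≡.sym (ε-^ e (suc q))) (≡.trans (ε-respects act (zero , zero , zero) h)
      (cong (λ x → n ℤ.+ (p ℤ.* ε U ℤ.+ x)) (cong (ℤ._* ε W) (ε-s^ 1≤q))))))
      (mod-trans (≡⇒mod (cong (λ x → n ℤ.+ x) (ℤₚ.+-identityʳ (p ℤ.* ε U)))) (multiple-+ n (ε U))))

  rep-^ : ∀ {I J} (ρ₁ : G → Mat I I) (ρ₂ : G → Mat J J) e n → Algebra._^_ (repAlgebra ρ₁) e n ≡ Algebra._^_ (repAlgebra ρ₂) e n
  rep-^ ρ₁ ρ₂ e zero    = refl
  rep-^ ρ₁ ρ₂ e (suc n) = cong (e :*_) (rep-^ ρ₁ ρ₂ e n)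

  -- The common frame for all parts of the regular representation: wherever `(1 - z)^(p-1)` is `p`
  -- times some `A`, the term with `W` is absorbed and `e^p` is an integer modulo `p`.
  module Factor {I : FinSet} (ρ' : G → Mat I I) (transfer : ∀ {e f} → e ≈ f → e ≈[ ρ' ] f)
    (A : Expr G) (s^q : s ^ q ≈[ ρ' ] (con p :* A)) where

    open Matrices using (Det; Det-cong; Det-mod; Det-*ᴹ)

    E' : Algebra
    E' = repAlgebra ρ'
    module E' = Algebra E'

    transfer-^ : ∀ {e n f} → e ^ n ≈ f → e E'.^ n E'.≈ f
    transfer-^ {e} {n} {f} h = ≡.subst (E'._≈ f) (rep-^ ρ ρ' e n) (transfer h)

    power : ∀ e → ∃ λ n → ∃ λ U → e E'.^ suc q E'.≈ con n :+ con p :* U × n ≡ ε e ℤ.^ suc q [mod p ]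
    power e = case power-formula e of λ where
        (n , U , W , h , c) → n , U :+ A :* W , E'.≈-trans (transfer-^ {e} {suc q} h) (E'.≈-trans (E'.+-cong₂ (E'.+-cong₂ (E'.*-cong₁ s^q)))
          (Solver.solveᶜ E' ((con p , E'.ι-central p) ∷ []) (con n ∷ U ∷ A ∷ W ∷ []) (x₀ :+ (c₀ :* x₁ :+ c₀ :* x₂ :* x₃)) (x₀ :+ c₀ :* (x₁ :+ x₂ :* x₃)) refl)) , c

    Det-power : ∀ e n → Det (ev ρ' (e E'.^ n)) ≡ Det (ev ρ' e) ℤ.^ n
    Det-power e n = ≡.trans (cong Det (ev-^ ρ' e n)) (MatrixAlgebra.Det-^ I (ev ρ' e) n)

    Det-scaled : ∀ {e f x n} → e E'.^ n E'.≈ con x :* f → Det (ev ρ' e) ℤ.^ n ≡ x ℤ.^ size I ℤ.* Det (ev ρ' f)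
    Det-scaled {e} {f} {x} {n} h = ≡.trans (≡.sym (Det-power e n)) (≡.trans (Det-cong {I} (Matrices.≈-trans (lower[ ρ' ] h) (MatrixAlgebra.ι-∙ I x (ev ρ' f)))) (Det-*ᴹ {I} x (ev ρ' f)))

    -- `Det(e)^p = Det(e^p)` is congruent modulo `p` to `n^N`, where `n ≡ ε(e)^p` and `N` is the
    -- rank.
    unit : ∀ e → ¬ p ∣ˢ ε e → ¬ p ∣ˢ Det (ev ρ' e)
    unit e h d = case power e of λ where
      (n , U , g , c) → p∤^ (size I) (λ p∣n → p∤^ (suc q) h (∣-respects (mod-sym c) p∣n)) (∣-respects
        (mod-sym (mod-trans (≡⇒mod (≡.trans (≡.sym (Det-power e (suc q))) (Det-cong {I} (lower[ ρ' ] g))))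
          (mod-trans (congruent (Det-mod {I} p (ev ρ' (con n :+ con p :* U)) (ev ρ' (con n)) λ i j →
              difference (mod-trans (≡⇒mod (cong (λ x → at (ev ρ' (con n)) i j ℤ.+ x) (entry (MatrixAlgebra.ι-∙ I p (ev ρ' U)) i j))) (multiple-+ (at (ev ρ' (con n)) i j) (at (ev ρ' U) i j)))))
            (≡⇒mod (MatrixAlgebra.Det-ι I n)))))
        (ℤˢ.∣m⇒∣m*n (Det (ev ρ' e) ℤ.^ q) d))

    nonunit : ∀ e → p ∣ˢ Det (ev ρ' e) → p ∣ˢ ε e
    nonunit e d = case p∣? ε e of λ where
      (yes h) → h
      (no h)  → ⊥-elim (unit e h d)

    zero-power : ∀ e → p ∣ˢ ε e → ∃ λ U → e E'.^ suc q E'.≈ con p :* U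
    zero-power e h = case power e of λ where
      (n , U , g , c) → case ∣-respects c (ℤˢ.∣m⇒∣m*n (ε e ℤ.^ q) h) of λ where
        (divides m' eq) → con m' :+ U , E'.≈-trans g (E'.≈-trans (E'.+-cong₁ (E'.≈-trans (E'.≈-reflexive (cong con eq)) (E'.≈-trans (E'.ι-* m' p) (E'.ι-central m' (con p)))))
          (E'.≈-sym (E'.*-distribˡ (con p) (con m') U)))

    Det-zero : 1 ℕ.≤ size I → ∀ e → p ∣ˢ ε e → p ∣ˢ Det (ev ρ' e)
    Det-zero 1≤N e h = case zero-power e h of λ where
        (U , g) → p∣^ (suc q) (≡.subst (p ∣ˢ_) (≡.sym (Det-scaled {e} {U} {p} {suc q} g)) (ℤˢ.∣m⇒∣m*n (Det (ev ρ' U)) (p∣p^ 1≤N)))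
      where
      p∣p^ : ∀ {N} → 1 ℕ.≤ N → p ∣ˢ p ℤ.^ N
      p∣p^ {suc N} _ = multiple (p ℤ.^ N)

-- Splitting the regular representation along the centre and along lines of the plane

module Decomposition (q : ℕ) (prime : Prime (suc q)) (2≤q : 2 ℕ.≤ q) where
  open GroupRing q prime 2≤q public
  open Matrices using (Det)

  Line Plane : FinSet
  Line  = fin (suc q)
  Plane = Line ⊗ Line

  actᴴ : G → ∣ Plane ⊗ Line ∣ → ∣ Plane ⊗ Line ∣
  actᴴ (i , j , k) ((a , b) , c) = (translate i a , translate j b) , translate (k ℤ.+ j ℤ.* ⟪ a ⟫) c

  actᴾ : G → ∣ Plane ∣ → ∣ Plane ∣
  actᴾ (i , j , k) (a , b) = translate i a , translate j b

  module Assoc = Reindex {G} {H} {Plane ⊗ Line} (≡.sym (ℕₚ.*-assoc (suc q) (suc q) (suc q)))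
    (λ ((a , b) , c) → a , b , c) (λ (a , b , c) → (a , b) , c) (λ _ → refl) act actᴴ (λ _ _ → refl)

  module Centre = Split {G} Plane q actᴴ actᴾ (λ _ _ → refl)

  open Centre using () renaming (ρ₀ to ρᶜ; ρ̄ to ρᴾ) public

  transferᶜ : ∀ {e f} → e ≈[ ρ ] f → e ≈[ ρᶜ ] f
  transferᶜ h = Centre.transfer-sub (Assoc.transfer h)

  transferᴾ : ∀ {e f} → e ≈[ ρ ] f → e ≈[ ρᴾ ] f
  transferᴾ h = Centre.transfer-quo (Assoc.transfer h)

  Det-centre : ∀ e → Det (ev ρ e) ≡ Det (ev ρᶜ e) ℤ.* Det (ev ρᴾ e)
  Det-centre e = ≡.trans (≡.sym (Assoc.Det-reindexed e)) (Centre.Det-split e)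

  module E = Algebra E

  opaque
    [1-g]^q : ∀ g → ∃ λ A → (con (+ 1) E.- var g) E.^ q E.≈ AlgebraPowers.geometric E (var g) (suc q) :+ con p :* A
    [1-g]^q g = GeometricMod.[1-t]^q-mod-p E prime (var g)

  norm : G → Expr G
  norm g = AlgebraPowers.geometric E (var g) (suc q)

  norm-invariant : ∀ g k → norm g :* var (multiply k g) E.≈ norm g
  norm-invariant g k = E.≈-trans (E.*-cong₂ (E.≈-sym (var-^ g k))) (AlgebraPowers.geometric-invariant E (var g) (suc q) (var-^p g) k)

  -- `1 + z + … + z^(p-1)` absorbs powers of `z`, and these connect all points of a fibre.
  norm-zᶜ : norm z ≈[ ρᶜ ] con (+ 0)
  norm-zᶜ = Centre.annihilates (norm z) λ (a , b) c → multiply (toℕ (suc c)) z , moves a b c , Assoc.transfer (norm-invariant z (toℕ (suc c)))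
    where
    moves : ∀ a b (c : Fin q) → actᴴ (multiply (toℕ (suc c)) z) ((a , b) , zero) ≡ ((a , b) , suc c)
    moves a b c = cong₂ _,_ (cong₂ _,_ (≡.trans (cong (λ x → translate x a) (ℤₚ.*-zeroʳ n)) (translate-0 a)) (≡.trans (cong (λ x → translate x b) (ℤₚ.*-zeroʳ n)) (translate-0 b)))
      (≡.trans (cong residue (arith n (triangle (toℕ (suc c))) ⟪ a ⟫)) (residue-⟪⟫ (suc c)))
      where
      n : ℤ
      n = ⟪ suc c ⟫
      arith : ∀ n t a → n ℤ.* + 1 ℤ.+ + 0 ℤ.* + 0 ℤ.* t ℤ.+ n ℤ.* + 0 ℤ.* a ℤ.+ + 0 ≡ n
      arith = solve-∀

  s^qᶜ : (s E.^ q) ≈[ ρᶜ ] (con p :* proj₁ ([1-g]^q z))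
  s^qᶜ = Eᶜ.≈-trans (transferᶜ (proj₂ ([1-g]^q z))) (Eᶜ.≈-trans (Eᶜ.+-cong₁ norm-zᶜ) (Eᶜ.+-identityˡ _))
    where module Eᶜ = Algebra (repAlgebra ρᶜ)

  module Factorᶜ = Factor ρᶜ transferᶜ (proj₁ ([1-g]^q z)) s^qᶜ

  -- On everything derived from the plane, `z` acts trivially: `s` becomes 0, `Factor` applies with
  -- `A = 0`, and all expressions commute.
  module PlaneFactor {I : FinSet} (ρ' : G → Mat I I) (transfer' : ∀ {e f} → e ≈[ ρᴾ ] f → e ≈[ ρ' ] f) where

    transferᴴ : ∀ {e f} → e ≈[ ρ ] f → e ≈[ ρ' ] f
    transferᴴ h = transfer' (transferᴾ h)

    private
      module E₁ = Algebra (repAlgebra ρ')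

    s≈0 : s ≈[ ρ' ] con (+ 0)
    s≈0 = E₁.≈-trans (E₁.+-cong₂ (E₁.*-cong₂ z≈1)) (Solver.solve (repAlgebra ρ') [] (con (+ 1) :+ con -[1+ 0 ] :* con (+ 1)) (con (+ 0)) refl)
      where
      z≈1 : var z ≈[ ρ' ] con (+ 1)
      z≈1 = transfer' (lift[ ρᴾ ] (pointwise λ u v → ≡.trans (cong (δ Plane u) (cong₂ _,_ (translate-0 (proj₁ v)) (translate-0 (proj₂ v)))) (≡.sym (ℤₚ.*-identityˡ (δ Plane u v)))))

    s^n≈0 : ∀ {n} → 1 ℕ.≤ n → (s E.^ n) ≈[ ρ' ] (con p :* con (+ 0))
    s^n≈0 {suc n} _ = E₁.≈-trans (E₁.*-cong₁ s≈0) (E₁.≈-trans (E₁.*-zeroˡ _) (E₁.≈-sym (E₁.*-zeroʳ (con p))))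

    open Factor ρ' transferᴴ (con (+ 0)) (s^n≈0 1≤q) public

    commutative : ∀ a b → a :* b E'.≈ b :* a
    commutative a b = case commutator a b of λ where
      (c , h) → E'.≈-trans (AlgebraPowers.a-b≈c⇒a≈b+c E' (transferᴴ h)) (E'.≈-trans (E'.+-cong₂ (E'.≈-trans (E'.*-cong₁ s≈0) (E'.*-zeroˡ c))) (E'.+-identityʳ _))

  module Factorᴾ = PlaneFactor ρᴾ id

  -- Coordinates (l , m) = (a i + b j , c i + d j) on the plane, split along l.
  module Coordinates (a b c d : ℤ) (unimodular : a ℤ.* d ℤ.- b ℤ.* c ≡ + 1) where

    functional : G → ℤ
    functional (i , j , k) = a ℤ.* i ℤ.+ b ℤ.* j

    cofunctional : G → ℤ
    cofunctional (i , j , k) = c ℤ.* i ℤ.+ d ℤ.* j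

    act′ : G → ∣ Plane ∣ → ∣ Plane ∣
    act′ g (l , m) = translate (functional g) l , translate (cofunctional g) m

    actᴸ : G → ∣ Line ∣ → ∣ Line ∣
    actᴸ g l = translate (functional g) l

    private
      -- `ψ` passes to the new coordinates and `φ` back, by the adjugate of a matrix of determinant
      -- 1.
      φ ψ : ∣ Plane ∣ → ∣ Plane ∣
      φ (l , m) = residue (d ℤ.* ⟪ l ⟫ ℤ.- b ℤ.* ⟪ m ⟫) , residue (ℤ.- c ℤ.* ⟪ l ⟫ ℤ.+ a ℤ.* ⟪ m ⟫)
      ψ (i , j) = residue (a ℤ.* ⟪ i ⟫ ℤ.+ b ℤ.* ⟪ j ⟫) , residue (c ℤ.* ⟪ i ⟫ ℤ.+ d ℤ.* ⟪ j ⟫)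

      unimodular-* : ∀ {x y} → y ≡ (a ℤ.* d ℤ.- b ℤ.* c) ℤ.* x → y ≡ x
      unimodular-* {x} e = ≡.trans e (≡.trans (cong (ℤ._* x) unimodular) (ℤₚ.*-identityˡ x))

      ψφ : ∀ u → ψ (φ u) ≡ u
      ψφ (l , m) = cong₂ _,_
        (≡.trans (residue-cong (mod-trans (mod-+ (mod-*ˡ a (⟪residue⟫ (d ℤ.* ⟪ l ⟫ ℤ.- b ℤ.* ⟪ m ⟫))) (mod-*ˡ b (⟪residue⟫ (ℤ.- c ℤ.* ⟪ l ⟫ ℤ.+ a ℤ.* ⟪ m ⟫))))
          (≡⇒mod (unimodular-* (arith₁ a b c d ⟪ l ⟫ ⟪ m ⟫))))) (residue-⟪⟫ l))
        (≡.trans (residue-cong (mod-trans (mod-+ (mod-*ˡ c (⟪residue⟫ (d ℤ.* ⟪ l ⟫ ℤ.- b ℤ.* ⟪ m ⟫))) (mod-*ˡ d (⟪residue⟫ (ℤ.- c ℤ.* ⟪ l ⟫ ℤ.+ a ℤ.* ⟪ m ⟫))))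
          (≡⇒mod (unimodular-* (arith₂ a b c d ⟪ l ⟫ ⟪ m ⟫))))) (residue-⟪⟫ m))
        where
        arith₁ : ∀ a b c d l m → a ℤ.* (d ℤ.* l ℤ.- b ℤ.* m) ℤ.+ b ℤ.* (ℤ.- c ℤ.* l ℤ.+ a ℤ.* m) ≡ (a ℤ.* d ℤ.- b ℤ.* c) ℤ.* l
        arith₁ = solve-∀
        arith₂ : ∀ a b c d l m → c ℤ.* (d ℤ.* l ℤ.- b ℤ.* m) ℤ.+ d ℤ.* (ℤ.- c ℤ.* l ℤ.+ a ℤ.* m) ≡ (a ℤ.* d ℤ.- b ℤ.* c) ℤ.* m
        arith₂ = solve-∀

      equivariant : ∀ g u → actᴾ g (φ u) ≡ φ (act′ g u)
      equivariant g@(i , j , k) (l , m) = cong₂ _,_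
        (residue-cong (mod-trans (mod-+ˡ i (⟪residue⟫ (d ℤ.* ⟪ l ⟫ ℤ.- b ℤ.* ⟪ m ⟫))) (mod-trans
          (≡⇒mod (≡.trans (cong (ℤ._+ (d ℤ.* ⟪ l ⟫ ℤ.- b ℤ.* ⟪ m ⟫)) (≡.sym (unimodular-* refl))) (arith₁ a b c d i j ⟪ l ⟫ ⟪ m ⟫)))
          (mod-sym (mod-+ (mod-*ˡ d (⟪residue⟫ (functional g ℤ.+ ⟪ l ⟫))) (mod-neg (mod-*ˡ b (⟪residue⟫ (cofunctional g ℤ.+ ⟪ m ⟫)))))))))
        (residue-cong (mod-trans (mod-+ˡ j (⟪residue⟫ (ℤ.- c ℤ.* ⟪ l ⟫ ℤ.+ a ℤ.* ⟪ m ⟫))) (mod-trans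
          (≡⇒mod (≡.trans (cong (ℤ._+ (ℤ.- c ℤ.* ⟪ l ⟫ ℤ.+ a ℤ.* ⟪ m ⟫)) (≡.sym (unimodular-* refl))) (arith₂ a b c d i j ⟪ l ⟫ ⟪ m ⟫)))
          (mod-sym (mod-+ (mod-*ˡ (ℤ.- c) (⟪residue⟫ (functional g ℤ.+ ⟪ l ⟫))) (mod-*ˡ a (⟪residue⟫ (cofunctional g ℤ.+ ⟪ m ⟫))))))))
        where
        arith₁ : ∀ a b c d i j l m → (a ℤ.* d ℤ.- b ℤ.* c) ℤ.* i ℤ.+ (d ℤ.* l ℤ.- b ℤ.* m) ≡ d ℤ.* (a ℤ.* i ℤ.+ b ℤ.* j ℤ.+ l) ℤ.- b ℤ.* (c ℤ.* i ℤ.+ d ℤ.* j ℤ.+ m)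
        arith₁ = solve-∀
        arith₂ : ∀ a b c d i j l m → (a ℤ.* d ℤ.- b ℤ.* c) ℤ.* j ℤ.+ (ℤ.- c ℤ.* l ℤ.+ a ℤ.* m) ≡ ℤ.- c ℤ.* (a ℤ.* i ℤ.+ b ℤ.* j ℤ.+ l) ℤ.+ a ℤ.* (c ℤ.* i ℤ.+ d ℤ.* j ℤ.+ m)
        arith₂ = solve-∀

    module Change = Reindex {G} {Plane} {Plane} refl φ ψ ψφ actᴾ act′ equivariant
    module Fibre = Split {G} Line q act′ actᴸ (λ _ _ → refl)

    open Fibre using () renaming (ρ₀ to ρᴿ; ρ̄ to ρᴸ) public

    module Factorᴿ = PlaneFactor ρᴿ (λ h → Fibre.transfer-sub (Change.transfer h))
    module Factorᴸ = PlaneFactor ρᴸ (λ h → Fibre.transfer-quo (Change.transfer h))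

    Det-plane : ∀ e → Det (ev ρᴾ e) ≡ Det (ev ρᴿ e) ℤ.* Det (ev ρᴸ e)
    Det-plane e = ≡.trans (≡.sym (Change.Det-reindexed e)) (Fibre.Det-split e)

-- The lower bound p² + 3

module LowerBound (q : ℕ) (prime : Prime (suc q)) (2≤q : 2 ℕ.≤ q) where
  open Decomposition q prime 2≤q public
  open Matrices using (Det)

  -- The derivation over `ε` that extends `f`. For `f = functional` it is, modulo `p`, the
  -- derivative at `t = 1` of the image in ℤ[⟨t⟩].
  ∂ : (G → ℤ) → Expr G → ℤ
  ∂ f (con x)   = + 0
  ∂ f (var g)   = f g
  ∂ f (e :+ e') = ∂ f e ℤ.+ ∂ f e'
  ∂ f (e :* e') = ε e ℤ.* ∂ f e' ℤ.+ ∂ f e ℤ.* ε e'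

  ∂-linear : ∀ a b f h e → ∂ (λ g → a ℤ.* f g ℤ.+ b ℤ.* h g) e ≡ a ℤ.* ∂ f e ℤ.+ b ℤ.* ∂ h e
  ∂-linear a b f h (con x)   = arith a b
    where
    arith : ∀ a b → + 0 ≡ a ℤ.* + 0 ℤ.+ b ℤ.* + 0
    arith = solve-∀
  ∂-linear a b f h (var g)   = refl
  ∂-linear a b f h (e :+ e') = ≡.trans (cong₂ ℤ._+_ (∂-linear a b f h e) (∂-linear a b f h e')) (arith a b (∂ f e) (∂ h e) (∂ f e') (∂ h e'))
    where
    arith : ∀ a b x y x' y' → (a ℤ.* x ℤ.+ b ℤ.* y) ℤ.+ (a ℤ.* x' ℤ.+ b ℤ.* y') ≡ a ℤ.* (x ℤ.+ x') ℤ.+ b ℤ.* (y ℤ.+ y')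
    arith = solve-∀
  ∂-linear a b f h (e :* e') = ≡.trans (cong₂ (λ u v → ε e ℤ.* u ℤ.+ v ℤ.* ε e') (∂-linear a b f h e') (∂-linear a b f h e))
    (arith a b (ε e) (ε e') (∂ f e) (∂ h e) (∂ f e') (∂ h e'))
    where
    arith : ∀ a b u v x y x' y' → u ℤ.* (a ℤ.* x' ℤ.+ b ℤ.* y') ℤ.+ (a ℤ.* x ℤ.+ b ℤ.* y) ℤ.* v ≡ a ℤ.* (u ℤ.* x' ℤ.+ x ℤ.* v) ℤ.+ b ℤ.* (u ℤ.* y' ℤ.+ y ℤ.* v)
    arith = solve-∀

  ε-power : ∀ {I} (ρ' : G → Mat I I) e n → ε (Algebra._^_ (repAlgebra ρ') e n) ≡ ε e ℤ.^ n
  ε-power ρ' e n = ≡.trans (cong ε (rep-^ ρ' ρ e n)) (ε-^ e n)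

  y : G
  y = + 0 , + 1 , + 0

  xDegree yDegree : G → ℤ
  xDegree (i , j , k) = i
  yDegree (i , j , k) = j

  lower-centre : ∀ e → p ∣ˢ ε e → p ℤ.^ (suc q ℕ.* q) ∣ˢ Det (ev ρᶜ e)
  lower-centre e h = case Factorᶜ.zero-power e h of λ where
    (U , g) → root-divides q (suc q ℕ.* q) (Det (ev ρᶜ e)) (≡.subst₂ (λ k D → p ℤ.^ k ∣ˢ D) (ℕₚ.*-assoc (suc q) (suc q) q)
      (≡.sym (Factorᶜ.Det-scaled {e} {U} {p} {suc q} g)) (ℤˢ.∣m⇒∣m*n (Det (ev ρᶜ U)) ℤˢ.∣-refl))

  module _ (a b c d : ℤ) (unimodular : a ℤ.* d ℤ.- b ℤ.* c ≡ + 1) where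
    open Coordinates a b c d unimodular

    -- `e^p = pY` is taken on the whole plane, where augmentations can be compared:
    -- `ε(e)^p = p ε(Y)` gives `p | ε(Y)`. Then `D^p` is divisible by `p^(p(p-1)+1)`, and rounding
    -- up yields `p^p`.
    lower-rest : ∀ e → p ∣ˢ ε e → p ℤ.^ suc q ∣ˢ Det (ev ρᴿ e)
    lower-rest e h = case Factorᴾ.zero-power e h of λ where
        (Y , g) → root-divisible (suc q) q (Det (ev ρᴿ e)) (≡.subst₂ (λ k D → p ℤ.^ k ∣ˢ D) (ℕₚ.+-comm (suc q ℕ.* q) 1)
          (≡.sym (Factorᴿ.Det-scaled {e} {Y} {p} {suc q} (transfer-power e Y g)))
          (combine {suc q ℕ.* q} {1} ℤˢ.∣-refl (≡.subst (_∣ˢ Det (ev ρᴿ Y)) (≡.sym (ℤₚ.*-identityʳ p)) (Factorᴿ.Det-zero (ℕₚ.≤-trans 1≤q (ℕₚ.m≤m+n q (q ℕ.* q))) Y (p∣εY Y g)))))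
      where
      transfer-power : ∀ e Y → Algebra._^_ (repAlgebra ρᴾ) e (suc q) ≈[ ρᴾ ] con p :* Y → Algebra._^_ (repAlgebra ρᴿ) e (suc q) ≈[ ρᴿ ] con p :* Y
      transfer-power e Y g = ≡.subst (λ u → u ≈[ ρᴿ ] con p :* Y) (rep-^ ρᴾ ρᴿ e (suc q)) (Fibre.transfer-sub (Change.transfer g))
      p∣εY : ∀ Y → Algebra._^_ (repAlgebra ρᴾ) e (suc q) ≈[ ρᴾ ] con p :* Y → p ∣ˢ ε Y
      p∣εY Y g = case (h , ≡.trans (≡.sym (ε-power ρᴾ e (suc q))) (ε-respects actᴾ (zero , zero) g)) of λ where
          (divides m eq , eq') → go 1≤q m eq eq'
        where
        go : ∀ {n} → 1 ℕ.≤ n → ∀ m → ε e ≡ m ℤ.* p → ε e ℤ.^ suc n ≡ p ℤ.* ε Y → p ∣ˢ ε Y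
        go {suc n} _ m eq eq' = divides (m ℤ.* m ℤ.* ε e ℤ.^ n) (≡.sym (ℤₚ.*-cancelˡ-≡ p (m ℤ.* m ℤ.* ε e ℤ.^ n ℤ.* p) (ε Y)
          (≡.trans (≡.trans (arith m p (ε e ℤ.^ n)) (cong (λ u → u ℤ.* (u ℤ.* ε e ℤ.^ n)) (≡.sym eq))) eq')))
          where
          arith : ∀ m p r → p ℤ.* (m ℤ.* m ℤ.* r ℤ.* p) ≡ m ℤ.* p ℤ.* (m ℤ.* p ℤ.* r)
          arith = solve-∀

    -- A generator `t` of the quotient: `functional g₀ = ad - bc = 1`.
    g₀ : G
    g₀ = d , ℤ.- c , + 0

    private
      functional-g₀ : ∀ n → functional (multiply n g₀) ≡ + n
      functional-g₀ n = ≡.trans (arith a b c d (+ n)) (≡.trans (cong (ℤ._* + n) unimodular) (ℤₚ.*-identityˡ (+ n)))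
        where
        arith : ∀ a b c d n → a ℤ.* (n ℤ.* d) ℤ.+ b ℤ.* (n ℤ.* ℤ.- c) ≡ (a ℤ.* d ℤ.- b ℤ.* c) ℤ.* n
        arith = solve-∀

    module Eᴸ = Algebra (repAlgebra ρᴸ)
    open Solver (repAlgebra ρᴸ)
    private module Pow = AlgebraPowers (repAlgebra ρᴸ)

    τ : Expr G
    τ = var g₀ Eᴸ.- con (+ 1)

    -- The exponent of `t` is determined only modulo `p`; the term with `C` absorbs this ambiguity.
    TaylorForm : Expr G → ℤ → ℤ → Set
    TaylorForm e u v = ∃ λ C → ∃ λ B → e ≈[ ρᴸ ] con u :+ con v :* τ :+ (con p :* (C :* τ) :+ τ Eᴸ.^ 2 :* B)

    taylor : ∀ e → TaylorForm e (ε e) (∂ functional e)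
    taylor (con u) = con (+ 0) , con (+ 0) , solveᶜ ((con p , Eᴸ.ι-central p) ∷ []) (con u ∷ τ ∷ []) x₀
      (x₀ :+ con (+ 0) :* x₁ :+ (c₀ :* (con (+ 0) :* x₁) :+ x₁ :* (x₁ :* con (+ 1)) :* con (+ 0))) refl
    taylor (var g) = form (Pow.taylor-^ (var g₀) n) (difference (⟪residue⟫ (functional g)))
      where
      n : ℕ
      n = toℕ (residue (functional g))
      power : var g ≈[ ρᴸ ] var g₀ Eᴸ.^ n
      power = Eᴸ.≈-sym (Eᴸ.≈-trans (Factorᴸ.transfer-^ {var g₀} {n} (var-^ g₀ n)) (lift[ ρᴸ ] (Matrices.Fm-cong Line Line λ l →
        translate-cong (mod-trans (≡⇒mod (functional-g₀ n)) (⟪residue⟫ (functional g))) l)))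
      ℤ-shift : ∀ {k} → + n ℤ.- functional g ≡ k ℤ.* p → + n ≡ functional g ℤ.+ k ℤ.* p
      ℤ-shift {k} e = ≡.trans (arith (+ n) (functional g)) (cong (λ u → functional g ℤ.+ u) e)
        where
        arith : ∀ n f → n ≡ f ℤ.+ (n ℤ.- f)
        arith = solve-∀
      form : (∃ λ B → var g₀ Eᴸ.^ n ≈[ ρᴸ ] con (+ 1) :+ con (+ n) :* τ :+ τ Eᴸ.^ 2 :* B) → p ∣ˢ + n ℤ.- functional g → TaylorForm (var g) (+ 1) (functional g)
      form (B , h) (divides k e) = con k , B , Eᴸ.≈-trans power (Eᴸ.≈-trans h (Eᴸ.≈-trans (Eᴸ.+-cong₁ (Eᴸ.+-cong₂ (Eᴸ.*-cong₁ (Eᴸ.≈-trans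
            (Eᴸ.≈-reflexive (cong con (ℤ-shift {k} e))) (Eᴸ.≈-trans (Eᴸ.ι-+ (functional g) (k ℤ.* p)) (Eᴸ.+-cong₂ (Eᴸ.ι-* k p)))))))
          (solveᶜ ((con p , Eᴸ.ι-central p) ∷ []) (con (functional g) ∷ con k ∷ τ ∷ B ∷ [])
            (con (+ 1) :+ (x₀ :+ x₁ :* c₀) :* x₂ :+ x₂ :* (x₂ :* con (+ 1)) :* x₃)
            (con (+ 1) :+ x₀ :* x₂ :+ (c₀ :* (x₁ :* x₂) :+ x₂ :* (x₂ :* con (+ 1)) :* x₃)) refl)))
    taylor (e :+ e') = case (taylor e , taylor e') of λ where
        ((C , B , h) , (C' , B' , h')) → C :+ C' , B :+ B' , Eᴸ.≈-trans (Eᴸ.+-cong h h') (Eᴸ.≈-trans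
            (solveᶜ ((con p , Eᴸ.ι-central p) ∷ (con (ε e) , Eᴸ.ι-central (ε e)) ∷ (con (ε e') , Eᴸ.ι-central (ε e')) ∷ [])
              (con (∂ functional e) ∷ con (∂ functional e') ∷ τ ∷ C ∷ B ∷ C' ∷ B' ∷ [])
              ((c₁ :+ x₀ :* x₂ :+ (c₀ :* (x₃ :* x₂) :+ x₂ :* (x₂ :* con (+ 1)) :* x₄)) :+ (c₂ :+ x₁ :* x₂ :+ (c₀ :* (x₅ :* x₂) :+ x₂ :* (x₂ :* con (+ 1)) :* x₆)))
              ((c₁ :+ c₂) :+ (x₀ :+ x₁) :* x₂ :+ (c₀ :* ((x₃ :+ x₅) :* x₂) :+ x₂ :* (x₂ :* con (+ 1)) :* (x₄ :+ x₆))) refl)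
            (Eᴸ.+-cong₁ (Eᴸ.+-cong (Eᴸ.≈-sym (Eᴸ.ι-+ (ε e) (ε e'))) (Eᴸ.*-cong₁ (Eᴸ.≈-sym (Eᴸ.ι-+ (∂ functional e) (∂ functional e')))))))
    taylor (e :* e') = case (taylor e , taylor e') of λ where
        ((C , B , h) , (C' , B' , h')) → con (ε e) :* C' :+ C :* con (ε e') ,
            (con (∂ functional e) :+ con p :* C) :* (con (∂ functional e') :+ con p :* C') :+ con (ε e) :* B' :+ B :* con (ε e')
              :+ τ :* ((con (∂ functional e) :+ con p :* C) :* B' :+ B :* (con (∂ functional e') :+ con p :* C')) :+ τ :* τ :* B :* B' ,
            Eᴸ.≈-trans (Eᴸ.*-cong h h') (Eᴸ.≈-trans
            (solveᶜ (scalar p ∷ scalar (ε e) ∷ scalar (ε e') ∷ scalar (∂ functional e) ∷ scalar (∂ functional e') ∷ Z τ ∷ Z C ∷ Z C' ∷ Z B ∷ Z B' ∷ []) []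
              ((c₁ :+ c₃ :* c₅ :+ (c₀ :* (c₆ :* c₅) :+ c₅ :* (c₅ :* con (+ 1)) :* c₈)) :* (c₂ :+ c₄ :* c₅ :+ (c₀ :* (c₇ :* c₅) :+ c₅ :* (c₅ :* con (+ 1)) :* c₉)))
              (c₁ :* c₂ :+ (c₁ :* c₄ :+ c₃ :* c₂) :* c₅ :+ (c₀ :* ((c₁ :* c₇ :+ c₆ :* c₂) :* c₅) :+ c₅ :* (c₅ :* con (+ 1)) :*
                ((c₃ :+ c₀ :* c₆) :* (c₄ :+ c₀ :* c₇) :+ c₁ :* c₉ :+ c₈ :* c₂ :+ c₅ :* ((c₃ :+ c₀ :* c₆) :* c₉ :+ c₈ :* (c₄ :+ c₀ :* c₇)) :+ c₅ :* c₅ :* c₈ :* c₉))) refl)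
            (Eᴸ.+-cong₁ (Eᴸ.+-cong (Eᴸ.≈-sym (Eᴸ.ι-* (ε e) (ε e'))) (Eᴸ.*-cong₁ (Eᴸ.≈-sym (Eᴸ.≈-trans (Eᴸ.ι-+ _ _) (Eᴸ.+-cong (Eᴸ.ι-* (ε e) (∂ functional e')) (Eᴸ.ι-* (∂ functional e) (ε e')))))))))
      where
      scalar : ℤ → ∃ Eᴸ.Central
      scalar u = con u , Eᴸ.ι-central u
      Z : Expr G → ∃ Eᴸ.Central
      Z u = u , Factorᴸ.commutative u

    private
      τ^p : ∃ λ U → τ Eᴸ.^ suc q ≈[ ρᴸ ] con p :* U
      τ^p = Factorᴸ.zero-power τ (divides (+ 0) refl)

    -- The binomial expansion leaves `w^p` and multiples of `p²`; moreover `w^p = (τ^p)² B^p`, where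
    -- `p` divides `τ^p` because `ε(τ) = 0`.
    square-power : ∀ A B → ∃ λ Y → (con p :* A :+ τ Eᴸ.^ 2 :* B) Eᴸ.^ suc q ≈[ ρᴸ ] con (p ℤ.^ 2) :* Y
    square-power A B = case (Pow.binomial₂ p A w q (Factorᴸ.commutative A w) , τ^p) of λ where
        ((V , h) , (U , h')) → U Eᴸ.^ 2 :* B Eᴸ.^ suc q :+ A :* w Eᴸ.^ q :+ V , Eᴸ.≈-trans h (Eᴸ.≈-trans
          (Eᴸ.+-cong₁ (Eᴸ.+-cong₁ (Eᴸ.≈-trans (w^p) (Eᴸ.*-cong₁ (Pow-cong U h')))))
          (Eᴸ.≈-trans (solveᶜ ((con p , Eᴸ.ι-central p) ∷ []) (U ∷ B Eᴸ.^ suc q ∷ A :* w Eᴸ.^ q ∷ V ∷ [])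
              (((c₀ :* x₀) :* ((c₀ :* x₀) :* con (+ 1))) :* x₁ :+ c₀ :* (c₀ :* x₂) :+ c₀ :* (c₀ :* x₃))
              (c₀ :* (c₀ :* con (+ 1)) :* ((x₀ :* (x₀ :* con (+ 1))) :* x₁ :+ x₂ :+ x₃)) refl)
            (Eᴸ.*-cong₁ (Eᴸ.≈-sym (Pow.ι-^ p 2)))))
      where
      w : Expr G
      w = τ Eᴸ.^ 2 :* B
      Pow-cong : ∀ U → τ Eᴸ.^ suc q ≈[ ρᴸ ] con p :* U → (τ Eᴸ.^ suc q) Eᴸ.^ 2 ≈[ ρᴸ ] (con p :* U) Eᴸ.^ 2
      Pow-cong U h' = Eᴸ.^-cong 2 h'
      w^p : w Eᴸ.^ suc q ≈[ ρᴸ ] (τ Eᴸ.^ suc q) Eᴸ.^ 2 :* B Eᴸ.^ suc q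
      w^p = Eᴸ.≈-trans (Pow.^-distrib-* (τ Eᴸ.^ 2) B (suc q) (Factorᴸ.commutative _ _)) (Eᴸ.*-cong₁
        (Eᴸ.≈-trans (Eᴸ.≈-sym (Pow.^-* τ (suc q) 2)) (Eᴸ.≈-trans (Eᴸ.≈-reflexive (cong (τ Eᴸ.^_) (ℕₚ.*-comm (suc q) 2))) (Pow.^-* τ 2 (suc q)))))

    -- The hypotheses reduce the Taylor form to `pA + τ²B`, so `e^p = p²Y`. As `p ≥ 3`, `p³` divides
    -- `ε(e)^p`, hence `p | ε(Y)`; rounding up in `D^p = p^(2p) Det Y` yields the exponent 3.
    lower-line : ∀ e → p ∣ˢ ε e → p ∣ˢ ∂ functional e → p ℤ.^ 3 ∣ˢ Det (ev ρᴸ e)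
    lower-line e hε@(divides m eq) (divides n eq') = case taylor e of λ where
        (C , B , h) → case square-power (con m :+ con n :* τ :+ C :* τ) B of λ where
          (Y , g) → finish Y (Eᴸ.≈-trans (Eᴸ.^-cong (suc q) (Eᴸ.≈-trans h (Eᴸ.≈-trans (Eᴸ.+-cong₁ (Eᴸ.+-cong (factor eq) (Eᴸ.*-cong₁ (factor eq'))))
            (solveᶜ ((con p , Eᴸ.ι-central p) ∷ []) (con m ∷ con n ∷ τ ∷ C ∷ B ∷ [])
              (x₀ :* c₀ :+ x₁ :* c₀ :* x₂ :+ (c₀ :* (x₃ :* x₂) :+ x₂ :* (x₂ :* con (+ 1)) :* x₄))
              (c₀ :* (x₀ :+ x₁ :* x₂ :+ x₃ :* x₂) :+ x₂ :* (x₂ :* con (+ 1)) :* x₄) refl)))) g)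
      where
      factor : ∀ {u m} → u ≡ m ℤ.* p → con u ≈[ ρᴸ ] con m :* con p
      factor {u} {m} refl = Eᴸ.ι-* m p
      finish : ∀ Y → e Eᴸ.^ suc q ≈[ ρᴸ ] con (p ℤ.^ 2) :* Y → p ℤ.^ 3 ∣ˢ Det (ev ρᴸ e)
      finish Y g = root-divisible (suc q) 2 (Det (ev ρᴸ e)) (≡.subst₂ (λ k D → p ℤ.^ k ∣ˢ D) (ℕₚ.+-comm (suc q ℕ.* 2) 1)
          (≡.sym (≡.trans (Factorᴸ.Det-scaled {e} {Y} {p ℤ.^ 2} {suc q} g) (cong (ℤ._* Det (ev ρᴸ Y)) (^-power p (suc q) 2))))
          (combine {suc q ℕ.* 2} {1} ℤˢ.∣-refl (≡.subst (_∣ˢ Det (ev ρᴸ Y)) (≡.sym (ℤₚ.*-identityʳ p)) (Factorᴸ.Det-zero (ℕ.s≤s ℕ.z≤n) Y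
            (p∣εY 2≤q (≡.trans (≡.sym (ε-power ρᴸ e (suc q))) (ε-respects actᴸ zero g)))))))
        where
        p∣εY : ∀ {n} → 2 ℕ.≤ n → ε e ℤ.^ suc n ≡ p ℤ.^ 2 ℤ.* ε Y → p ∣ˢ ε Y
        p∣εY {suc (suc n)} (ℕ.s≤s (ℕ.s≤s _)) e₁ = divides (m ℤ.* m ℤ.* m ℤ.* ε e ℤ.^ n) (≡.sym (cancel-p^ 2
          (≡.trans (≡.trans (arith m p (ε e ℤ.^ n)) (cong (λ u → u ℤ.* (u ℤ.* (u ℤ.* ε e ℤ.^ n))) (≡.sym eq))) e₁)))
          where
          arith : ∀ m p r → p ℤ.* (p ℤ.* + 1) ℤ.* (m ℤ.* m ℤ.* m ℤ.* r ℤ.* p) ≡ m ℤ.* p ℤ.* (m ℤ.* p ℤ.* (m ℤ.* p ℤ.* r))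
          arith = solve-∀

    lower-plane : ∀ e → p ∣ˢ ε e → p ∣ˢ ∂ functional e → p ℤ.^ (suc q ℕ.+ 3) ∣ˢ Det (ev ρᴾ e)
    lower-plane e h h' = ≡.subst (p ℤ.^ (suc q ℕ.+ 3) ∣ˢ_) (≡.sym (Det-plane e)) (combine {suc q} {3} (lower-rest e h) (lower-line e h h'))

  -- The derivative along `a i + b j` is `aα + bβ`. It vanishes modulo `p` for `(1 , 0)` if `p | α`,
  -- and otherwise for `a = -β/α` and `b = 1`.
  plane-bound : ∀ e → p ∣ˢ ε e → p ℤ.^ (suc q ℕ.+ 3) ∣ˢ Det (ev ρᴾ e)
  plane-bound e h = case p∣? α of λ where
      (yes p∣α) → lower-plane (+ 1) (+ 0) (+ 0) (+ 1) refl e h (≡.subst (p ∣ˢ_) (≡.sym (≡.trans (∂-linear (+ 1) (+ 0) xDegree yDegree e) (arith₁ α β))) p∣α)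
      (no p∤α)  → case inverse-mod prime (λ d → p∤α (∣-respects (mod-sym (⟪residue⟫ α)) (ℤˢ.∣ᵤ⇒∣ d))) of λ where
        -- `v` is the inverse of `α` modulo `p`, and the row `(-1 , 0)` completes `(a , 1)` to
        -- determinant 1.
        (v , w , eq) → lower-plane (ℤ.- β ℤ.* v) (+ 1) (-[1+ 0 ]) (+ 0) (arith₂ (ℤ.- β ℤ.* v)) e h
          (≡.subst (p ∣ˢ_) (≡.sym (∂-linear (ℤ.- β ℤ.* v) (+ 1) xDegree yDegree e))
            (∣-respects (mod-+ʳ (+ 1 ℤ.* β) (mod-*ˡ (ℤ.- β ℤ.* v) (mod-sym (⟪residue⟫ α)))) (divides (β ℤ.* w) (solution v w eq))))
    where
    α β : ℤ
    α = ∂ xDegree e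
    β = ∂ yDegree e
    arith₁ : ∀ a b → + 1 ℤ.* a ℤ.+ + 0 ℤ.* b ≡ a
    arith₁ = solve-∀
    arith₂ : ∀ a → a ℤ.* + 0 ℤ.- + 1 ℤ.* -[1+ 0 ] ≡ + 1
    arith₂ = solve-∀
    solution : ∀ v w → v ℤ.* ⟪ residue α ⟫ ℤ.+ w ℤ.* p ≡ + 1 → ℤ.- β ℤ.* v ℤ.* ⟪ residue α ⟫ ℤ.+ + 1 ℤ.* β ≡ β ℤ.* w ℤ.* p
    solution v w eq = ≡.trans (arith β v w ⟪ residue α ⟫ p) (≡.trans (cong (λ u → β ℤ.* w ℤ.* p ℤ.+ β ℤ.* (+ 1 ℤ.- u)) eq) (arith′ (β ℤ.* w ℤ.* p) β))
      where
      arith : ∀ b v w n p → ℤ.- b ℤ.* v ℤ.* n ℤ.+ + 1 ℤ.* b ≡ b ℤ.* w ℤ.* p ℤ.+ b ℤ.* (+ 1 ℤ.- (v ℤ.* n ℤ.+ w ℤ.* p))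
      arith = solve-∀
      arith′ : ∀ a b → a ℤ.+ b ℤ.* (+ 1 ℤ.- + 1) ≡ a
      arith′ = solve-∀

  exponent : suc q ℕ.* q ℕ.+ (suc q ℕ.+ 3) ≡ suc q ℕ.* suc q ℕ.+ 3
  exponent = arith q
    where
    arith : ∀ q → suc q ℕ.* q ℕ.+ (suc q ℕ.+ 3) ≡ suc q ℕ.* suc q ℕ.+ 3
    arith = ℕSolver.solve-∀

  lower-bound : ∀ e → p ∣ˢ Det (ev ρ e) → p ℤ.^ (suc q ℕ.* suc q ℕ.+ 3) ∣ˢ Det (ev ρ e)
  lower-bound e d = ≡.subst (p ℤ.^ (suc q ℕ.* suc q ℕ.+ 3) ∣ˢ_) (≡.sym (Det-centre e))
      (≡.subst (λ k → p ℤ.^ k ∣ˢ Det (ev ρᶜ e) ℤ.* Det (ev ρᴾ e)) exponent (combine {suc q ℕ.* q} {suc q ℕ.+ 3} (lower-centre e p∣ε) (plane-bound e p∣ε)))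
    where
    p∣ε : p ∣ˢ ε e
    p∣ε = case euclid (Det (ev ρᶜ e)) (Det (ev ρᴾ e)) (≡.subst (p ∣ˢ_) (Det-centre e) d) of λ where
      (inj₁ h) → Factorᶜ.nonunit e h
      (inj₂ h) → Factorᴾ.nonunit e h

-- The p-th power of a sum of elements that commute up to a root of unity

-- If ab = ζba with ζ a primitive p-th root of unity, then (a + b)^p = a^p + b^p: comparing coefficients in
-- (b + aT)(b + aT)^p = (b + aT)^p(b + aT) gives (1 - ζ^i) b c_i = 0 for the i-th coefficient of (b + aT)^p, 0 < i < p.
module QCommuting (A : Algebra) where
  open Algebra A
  open Solver A
  open AlgebraPowers A
  open Reasoning

  module _ (q : ℕ) (a b ζ : Carrier) (ζ-central : Central ζ) (ab : a * b ≈ ζ * (b * a)) (ζ^p≈1 : ζ ^ suc q ≈ ι (+ 1))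
    (primitive-root : ∀ i → i ℕ.< q → ∀ c → ζ ^ suc i * c ≈ c → c ≈ ι (+ 0)) (regular : ∀ c → b * c ≈ ι (+ 0) → c ≈ ι (+ 0)) where
    open Sequences A a b

    private
      Z : ∃ Central
      Z = ζ , ζ-central

      shift-commute : ∀ f → (∀ i → f i * b ≈ ζ ^ i * (b * f i)) → ∀ i → shift f i * a * b ≈ ζ ^ i * (b * (shift f i * a))
      shift-commute f h zero    = solve (a ∷ b ∷ []) (con (+ 0) :* x₀ :* x₁) (con (+ 1) :* (x₁ :* (con (+ 0) :* x₀))) refl
      shift-commute f h (suc i) = begin
        f i * a * b                   ≈⟨ *-assoc _ _ _ ⟩
        f i * (a * b)                 ≈⟨ *-cong₂ ab ⟩
        f i * (ζ * (b * a))           ≈⟨ solveᶜ (Z ∷ []) (f i ∷ a ∷ b ∷ []) (x₀ :* (c₀ :* (x₂ :* x₁))) (c₀ :* (x₀ :* x₂ :* x₁)) refl ⟩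
        ζ * (f i * b * a)             ≈⟨ *-cong₂ (*-cong₁ (h i)) ⟩
        ζ * (ζ ^ i * (b * f i) * a)   ≈⟨ solveᶜ (Z ∷ (ζ ^ i , central-^ i ζ-central) ∷ []) (f i ∷ a ∷ b ∷ []) (c₀ :* (c₁ :* (x₂ :* x₀) :* x₁)) (c₀ :* c₁ :* (x₂ :* (x₀ :* x₁))) refl ⟩
        ζ ^ suc i * (b * (f i * a))   ∎

      power-commute : ∀ n i → power n i * b ≈ ζ ^ i * (b * power n i)
      power-commute zero zero    = solve (b ∷ []) (con (+ 1) :* x₀) (con (+ 1) :* (x₀ :* con (+ 1))) refl
      power-commute zero (suc i) = solve (b ∷ ζ ^ suc i ∷ []) (con (+ 0) :* x₀) (x₁ :* (x₀ :* con (+ 0))) refl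
      power-commute (suc n) i = begin
        (power n i * b + shift (power n) i * a) * b                       ≈⟨ *-distribʳ _ _ _ ⟩
        power n i * b * b + shift (power n) i * a * b                     ≈⟨ +-cong (*-cong₁ (power-commute n i)) (shift-commute (power n) (power-commute n) i) ⟩
        ζ ^ i * (b * power n i) * b + ζ ^ i * (b * (shift (power n) i * a))
          ≈⟨ solveᶜ ((ζ ^ i , central-^ i ζ-central) ∷ []) (power n i ∷ shift (power n) i ∷ a ∷ b ∷ []) (c₀ :* (x₃ :* x₀) :* x₃ :+ c₀ :* (x₃ :* (x₁ :* x₂))) (c₀ :* (x₃ :* (x₀ :* x₃ :+ x₁ :* x₂))) refl ⟩
        ζ ^ i * (b * (power n i * b + shift (power n) i * a))             ∎

      ab^ : ∀ n → a * b ^ n ≈ ζ ^ n * (b ^ n * a)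
      ab^ zero    = solve (a ∷ []) (x₀ :* con (+ 1)) (con (+ 1) :* (con (+ 1) :* x₀)) refl
      ab^ (suc n) = begin
        a * (b * b ^ n)               ≈⟨ ≈-sym (*-assoc _ _ _) ⟩
        a * b * b ^ n                 ≈⟨ *-cong₁ ab ⟩
        ζ * (b * a) * b ^ n           ≈⟨ solve (ζ ∷ a ∷ b ∷ b ^ n ∷ []) (x₀ :* (x₂ :* x₁) :* x₃) (x₀ :* (x₂ :* (x₁ :* x₃))) refl ⟩
        ζ * (b * (a * b ^ n))         ≈⟨ *-cong₂ (*-cong₂ (ab^ n)) ⟩
        ζ * (b * (ζ ^ n * (b ^ n * a))) ≈⟨ solveᶜ (Z ∷ (ζ ^ n , central-^ n ζ-central) ∷ []) (a ∷ b ∷ b ^ n ∷ []) (c₀ :* (x₁ :* (c₁ :* (x₂ :* x₀)))) (c₀ :* c₁ :* (x₁ :* x₂ :* x₀)) refl ⟩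
        ζ ^ suc n * (b ^ suc n * a)   ∎

      cancel : ∀ i → i ℕ.< q → b * power (suc q) (suc i) ≈ power (suc q) (suc i) * b → power (suc q) (suc i) ≈ ι (+ 0)
      cancel i i<q h = regular _ (primitive-root i i<q _ (≈-trans (≈-sym (power-commute (suc q) (suc i))) (≈-sym h)))

      middle : ∀ i → i ℕ.< q → power (suc q) (suc i) ≈ ι (+ 0)
      -- For `i = 0` the coefficient is `b^p`, which commutes with `a` as `ζ^p = 1`. Afterwards it
      -- is a zero supplied by `middle`, which in turn needs the preceding coefficient to commute
      -- with `a`.
      commutes : ∀ i → i ℕ.< q → a * power (suc q) i ≈ power (suc q) i * a

      middle i i<q = cancel i i<q (begin
        b * c                                                     ≈⟨ solve (b * c ∷ a * power (suc q) i ∷ []) x₀ ((x₀ :+ x₁) :- x₁) refl ⟩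
        (b * c + a * power (suc q) i) - a * power (suc q) i       ≈⟨ +-cong₁ (left-power (suc q) (suc i)) ⟩
        (c * b + power (suc q) i * a) - a * power (suc q) i       ≈⟨ +-cong₁ (+-cong₂ (≈-sym (commutes i i<q))) ⟩
        (c * b + a * power (suc q) i) - a * power (suc q) i       ≈⟨ solve (c * b ∷ a * power (suc q) i ∷ []) ((x₀ :+ x₁) :- x₁) x₀ refl ⟩
        c * b                                                     ∎)
        where
        c : Carrier
        c = power (suc q) (suc i)

      commutes zero    i<q = begin
        a * power (suc q) 0                ≈⟨ *-cong₂ (power-first (suc q)) ⟩
        a * b ^ suc q                      ≈⟨ ab^ (suc q) ⟩
        ζ ^ suc q * (b ^ suc q * a)        ≈⟨ ≈-trans (*-cong₁ ζ^p≈1) (*-identityˡ _) ⟩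
        b ^ suc q * a                      ≈⟨ *-cong₁ (≈-sym (power-first (suc q))) ⟩
        power (suc q) 0 * a                ∎
      commutes (suc i) i<q = ≈-trans (*-cong₂ (middle i (ℕₚ.<-trans (ℕₚ.n<1+n i) i<q))) (≈-trans (solve (a ∷ []) (x₀ :* con (+ 0)) (con (+ 0) :* x₀) refl)
        (*-cong₁ (≈-sym (middle i (ℕₚ.<-trans (ℕₚ.n<1+n i) i<q)))))

    q-frobenius : (a + b) ^ suc q ≈ a ^ suc q + b ^ suc q
    q-frobenius = power-ends q middle

-- Determinants of cyclic block matrices

module Chains (B : FinSet) where
  open Int using (_+_; _*_; -_; _-_)
  open Matrices hiding (+-cong; *-cong)
  open Algebra (matrixAlgebra B) using (_^_)

  first : ∀ {n} → Fin n → ℤ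
  first zero    = + 1
  first (suc _) = + 0

  last : ∀ {n} → Fin (suc n) → ℤ
  last {zero}  zero    = + 1
  last {suc n} zero    = + 0
  last {suc n} (suc i) = last i

  superdiagonal : ∀ {n} → Fin n → Fin n → ℤ
  superdiagonal i       zero    = + 0
  superdiagonal zero    (suc j) = first j
  superdiagonal (suc i) (suc j) = superdiagonal i j

  -- The block matrix 1 - X, where X has N on the superdiagonal and C in the lower left corner.
  chain : ∀ k → Mat B B → Mat B B → Mat (fin (suc k) ⊗ B) (fin (suc k) ⊗ B)
  chain k C N = mat λ (i , u) (j , v) → δ (fin (suc k) ⊗ B) (i , u) (j , v) - superdiagonal i j * at N u v - last i * first j * at C u v

  1-_ : ∀ {I} → Mat I I → Mat I I
  1- X = 1ᴹ +ᴹ -[1+ 0 ] *ᴹ X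

  private
    rest : ℕ → FinSet
    rest k = fin (suc k) ⊗ B

    topRow : ∀ k → Mat B B → Mat B (rest k)
    topRow k N = mat λ u (j , v) → - (first j * at N u v)

    leftColumn : ∀ k → Mat B B → Mat (rest k) B
    leftColumn k C = mat λ (i , u) v → - (last i * at C u v)

    remainder : ∀ k → Mat B B → Mat (rest k) (rest k)
    remainder k N = mat λ (i , u) (j , v) → δ (rest k) (i , u) (j , v) - superdiagonal i j * at N u v

    block-chain : ∀ k C N → Mat (B ⊕ rest k) (B ⊕ rest k)
    block-chain k C N = block 1ᴹ (topRow k N) (leftColumn k C) (remainder k N)

    φ : ∀ k → ∣ B ⊕ fin (suc k) ⊗ B ∣ → ∣ fin (suc (suc k)) ⊗ B ∣
    φ k (inj₁ u)       = zero , u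
    φ k (inj₂ (i , u)) = suc i , u

    ψ : ∀ k → ∣ fin (suc (suc k)) ⊗ B ∣ → ∣ B ⊕ fin (suc k) ⊗ B ∣
    ψ k (zero , u)  = inj₁ u
    ψ k (suc i , u) = inj₂ (i , u)

    blocks : ∀ k C N i j → at (chain (suc k) C N) (φ k i) (φ k j) ≡ at (block-chain k C N) i j
    blocks k C N (inj₁ u) (inj₁ v) = ≡.trans (arith (δ (fin (suc (suc k)) ⊗ B) (zero , u) (zero , v)) (at N u v) (at C u v))
      (δ-⇔ (fin (suc (suc k)) ⊗ B) B {zero , u} {zero , v} {u} {v} (λ { refl → refl }) (λ { refl → refl }))
      where
      arith : ∀ d n c → d - + 0 * n - + 0 * + 1 * c ≡ d
      arith = solve-∀
    blocks k C N (inj₁ u) (inj₂ (j , v)) = ≡.trans (cong (λ d → d - first j * at N u v - + 0 * + 0 * at C u v) (δ-≢ (fin (suc (suc k)) ⊗ B) {zero , u} {suc j , v} (λ ())))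
      (arith (first j * at N u v) (at C u v))
      where
      arith : ∀ x c → + 0 - x - + 0 * + 0 * c ≡ - x
      arith = solve-∀
    blocks k C N (inj₂ (i , u)) (inj₁ v) = ≡.trans (cong (λ d → d - + 0 * at N u v - last i * + 1 * at C u v) (δ-≢ (fin (suc (suc k)) ⊗ B) {suc i , u} {zero , v} (λ ())))
      (arith (last i) (at N u v) (at C u v))
      where
      arith : ∀ l n c → + 0 - + 0 * n - l * + 1 * c ≡ - (l * c)
      arith = solve-∀
    blocks k C N (inj₂ (i , u)) (inj₂ (j , v)) = ≡.trans (arith (δ (fin (suc (suc k)) ⊗ B) (suc i , u) (suc j , v)) (superdiagonal i j * at N u v) (last i) (at C u v))
      (cong (_- superdiagonal i j * at N u v) (δ-⇔ (fin (suc (suc k)) ⊗ B) (fin (suc k) ⊗ B) {suc i , u} {suc j , v} {i , u} {j , v} (λ { refl → refl }) (λ { refl → refl })))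
      where
      arith : ∀ d x l c → d - x - l * + 0 * c ≡ d - x
      arith = solve-∀

  opaque
    unfolding _∙_

    eliminated : ∀ k C N u v → at (remainder k N +ᴹ (-[1+ 0 ] *ᴹ (leftColumn k C ∙ topRow k N))) u v ≡ at (chain k (C ∙ N) N) u v
    eliminated k C N (i , u) (j , v) = ≡.trans (cong (λ x → D + -[1+ 0 ] * x) (≡.trans
        (Σ-cong B (λ t → arith₁ (last i) (first j) (at C u t) (at N t v))) (Σ-*ˡ B (last i * first j) (λ t → at C u t * at N t v))))
      (arith₂ D (last i * first j * at (C ∙ N) u v))
      where
      D : ℤ
      D = δ (fin (suc k) ⊗ B) (i , u) (j , v) - superdiagonal i j * at N u v
      arith₁ : ∀ l f c n → - (l * c) * - (f * n) ≡ l * f * (c * n)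
      arith₁ = solve-∀
      arith₂ : ∀ d x → d + -[1+ 0 ] * x ≡ d - x
      arith₂ = solve-∀

  -- Eliminating the first block row and column shortens the chain and turns the corner `C` into
  -- `C ∙ N`: the removed index joined the corner to the first superdiagonal block.
  Det-chain : ∀ k C N → Det (chain k C N) ≡ Det (1- (C ∙ (N ^ k)))
  Det-chain zero C N = ≡.trans (≡.sym (Det-reindex {fin 1 ⊗ B} {B} (ℕₚ.+-identityʳ (size B)) (zero ,_) proj₂ (λ _ → refl) (λ { (zero , u) → refl }) (chain 0 C N)))
    (Det-cong {B} (pointwise λ u v → ≡.trans (arith (δ (fin 1 ⊗ B) (zero , u) (zero , v)) (at N u v) (at C u v))
      (cong₂ (λ d x → d + -[1+ 0 ] * x) (δ-⇔ (fin 1 ⊗ B) B {zero , u} {zero , v} {u} {v} (λ { refl → refl }) (λ { refl → refl })) (≡.sym (entry (Algebra.*-identityʳ (matrixAlgebra B) C) u v)))))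
    where
    arith : ∀ d n c → d - + 0 * n - + 1 * + 1 * c ≡ d + -[1+ 0 ] * c
    arith = solve-∀
  Det-chain (suc k) C N = ≡.trans (≡.sym (Det-reindex {fin (suc (suc k)) ⊗ B} {B ⊕ fin (suc k) ⊗ B} refl (φ k) (ψ k) ψφ φψ (chain (suc k) C N)))
    (≡.trans (Det-cong {B ⊕ fin (suc k) ⊗ B} (pointwise (blocks k C N)))
      (≡.trans (Det-Schur {B} {fin (suc k) ⊗ B} (topRow k N) (leftColumn k C) (remainder k N)) (≡.trans (Det-cong {fin (suc k) ⊗ B} (pointwise (eliminated k C N)))
        (≡.trans (Det-chain k (C ∙ N) N) (Det-cong {B} (Matrices.+-cong (≈-refl {A = 1ᴹ}) (Matrices.*-cong -[1+ 0 ] (∙-assoc C N (N ^ k)))))))))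
    where
    ψφ : ∀ x → ψ k (φ k x) ≡ x
    ψφ (inj₁ u)       = refl
    ψφ (inj₂ (i , u)) = refl
    φψ : ∀ x → φ k (ψ k x) ≡ x
    φψ (zero , u)  = refl
    φψ (suc i , u) = refl

ℤ-^ : ∀ x n → Algebra._^_ ℤ-algebra x n ≡ x ℤ.^ n
ℤ-^ x zero    = refl
ℤ-^ x (suc n) = cong (x ℤ.*_) (ℤ-^ x n)

-- The choice of μ

module FermatQuotients (q : ℕ) (prime : Prime (suc q)) (2≤q : 2 ℕ.≤ q) where
  open Int using (_+_; _*_; -_; _-_; _^_)
  open Valuations prime

  even-q : ∃ λ k → q ≡ k ℕ.+ k
  even-q = case parity q of λ where
      (inj₁ h)       → h
      (inj₂ (k , e)) → case prime⇒irreducible prime (ℕᵈ.divides (suc k) (≡.trans (cong suc e) (double k))) of λ where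
        (inj₂ 2≡p) → ⊥-elim (ℕₚ.<⇒≢ (ℕ.s≤s 2≤q) 2≡p)
    where
    double : ∀ k → suc (suc (k ℕ.+ k)) ≡ suc k ℕ.* 2
    double k = ≡.trans (cong (2 ℕ.+_) (cong (k ℕ.+_) (≡.sym (ℕₚ.+-identityʳ k)))) (cong (2 ℕ.+_) (ℕₚ.*-comm 2 k))
    parity : ∀ n → (∃ λ k → n ≡ k ℕ.+ k) ⊎ (∃ λ k → n ≡ suc (k ℕ.+ k))
    parity zero    = inj₁ (0 , refl)
    parity (suc n) = case parity n of λ where
      (inj₁ (k , e)) → inj₂ (k , cong suc e)
      (inj₂ (k , e)) → inj₁ (suc k , cong suc (≡.trans e (≡.sym (ℕₚ.+-suc k k))))

  neg-^ : ∀ x → (- x) ^ suc q ≡ - x ^ suc q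
  neg-^ x = case even-q of λ where
      (k , e) → ≡.trans (cong (- x *_) (≡.trans (cong ((- x) ^_) e) (≡.trans (even k) (cong (x ^_) (≡.sym e))))) (≡.sym (ℤₚ.neg-distribˡ-* x (x ^ q)))
    where
    even : ∀ k → (- x) ^ (k ℕ.+ k) ≡ x ^ (k ℕ.+ k)
    even zero    = refl
    even (suc k) = ≡.trans (cong (λ n → (- x) ^ suc n) (ℕₚ.+-suc k k)) (≡.trans (≡.trans (cong (λ y → - x * (- x * y)) (even k)) (arith x (x ^ (k ℕ.+ k))))
      (cong (λ n → x ^ suc n) (≡.sym (ℕₚ.+-suc k k))))
      where
      arith : ∀ x y → - x * (- x * y) ≡ x * (x * y)
      arith = solve-∀

  [1-t]^p : ∀ t → (+ 1 - t) ^ suc q ≡ + 1 - t ^ suc q [mod p ]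
  [1-t]^p t = case GeometricMod.[1-t]^q-mod-p ℤ-algebra prime t of λ where
      (U , h) → mod-trans (≡⇒mod (expand U h)) (multiple-+ (+ 1 - t ^ suc q) ((+ 1 - t) * U))
    where
    open AlgebraPowers ℤ-algebra using (geometric; [1-t]*geometric)
    minus : ∀ a b → a + -[1+ 0 ] * b ≡ a - b
    minus = solve-∀
    expand : ∀ U → Algebra._^_ ℤ-algebra (+ 1 + -[1+ 0 ] * t) q ≡ geometric t (suc q) + p * U → (+ 1 - t) ^ suc q ≡ (+ 1 - t ^ suc q) + p * ((+ 1 - t) * U)
    expand U h = begin
      (+ 1 - t) * (+ 1 - t) ^ q                              ≡⟨ cong₂ _*_ (≡.sym (minus (+ 1) t)) (≡.trans (cong (_^ q) (≡.sym (minus (+ 1) t))) (≡.trans (≡.sym (ℤ-^ _ q)) h)) ⟩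
      (+ 1 + -[1+ 0 ] * t) * (geometric t (suc q) + p * U)   ≡⟨ ℤₚ.*-distribˡ-+ (+ 1 + -[1+ 0 ] * t) (geometric t (suc q)) (p * U) ⟩
      (+ 1 + -[1+ 0 ] * t) * geometric t (suc q) + (+ 1 + -[1+ 0 ] * t) * (p * U)
        ≡⟨ cong₂ _+_ (≡.trans ([1-t]*geometric t (suc q)) (≡.trans (cong (λ x → + 1 + -[1+ 0 ] * x) (ℤ-^ t (suc q))) (minus (+ 1) (t ^ suc q)))) (arith t p U) ⟩
      (+ 1 - t ^ suc q) + p * ((+ 1 - t) * U)                ∎
      where
      open ≡.≡-Reasoning
      arith : ∀ t p U → (+ 1 + -[1+ 0 ] * t) * (p * U) ≡ p * ((+ 1 - t) * U)
      arith = solve-∀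

  [p+w]^p : ∀ w → (p + w) ^ suc q ≡ w ^ suc q [mod p ^ 2 ]
  [p+w]^p w = case AlgebraPowers.binomial₂ ℤ-algebra p (+ 1) w q (ℤₚ.*-comm (+ 1) w) of λ where
      (V , h) → mod-trans (≡⇒mod (expand V h)) (multiple-+ (w ^ suc q) (Algebra._^_ ℤ-algebra w q + V))
    where
    expand : ∀ V → Algebra._^_ ℤ-algebra (p * + 1 + w) (suc q) ≡ Algebra._^_ ℤ-algebra w (suc q) + p * (p * (+ 1 * Algebra._^_ ℤ-algebra w q)) + p * (p * V) →
      (p + w) ^ suc q ≡ w ^ suc q + p ^ 2 * (Algebra._^_ ℤ-algebra w q + V)
    expand V h = ≡.trans (cong (λ x → (x + w) ^ suc q) (≡.sym (ℤₚ.*-identityʳ p))) (≡.trans (≡.sym (ℤ-^ (p * + 1 + w) (suc q)))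
      (≡.trans h (≡.trans (cong (λ x → x + p * (p * (+ 1 * Algebra._^_ ℤ-algebra w q)) + p * (p * V)) (ℤ-^ w (suc q))) (arith (w ^ suc q) p (Algebra._^_ ℤ-algebra w q) V))))
      where
      arith : ∀ a p x V → a + p * (p * (+ 1 * x)) + p * (p * V) ≡ a + p * (p * + 1) * (x + V)
      arith = solve-∀

  -- `1 - α^p - β^p` for `α = 1 + m` and `β = p - m`, the coefficients of the example.
  defect : ℤ → ℤ
  defect m = + 1 - (+ 1 + m) ^ suc q - (p - m) ^ suc q

  p∣defect : ∀ m → p ∣ˢ defect m
  p∣defect m = ∣-respects (mod-trans (mod-+ (mod-+ˡ (+ 1) (mod-neg (mod-trans (≡⇒mod (cong (_^ suc q) (arith₁ m))) ([1-t]^p (- m)))))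
      (mod-neg (mod-^ {x = p - m} {y = - m} (suc q) (congruent (divides (+ 1) (arith₂ p m)))))) (≡⇒mod (arith₃ ((- m) ^ suc q)))) (divides (+ 0) refl)
    where
    arith₁ : ∀ m → + 1 + m ≡ + 1 - (- m)
    arith₁ = solve-∀
    arith₂ : ∀ p m → (p - m) - (- m) ≡ + 1 * p
    arith₂ = solve-∀
    arith₃ : ∀ x → + 1 - (+ 1 - x) - x ≡ + 0
    arith₃ = solve-∀

  -- Modulo `p²`, `(p - m)^p ≡ -m^p` because `p` is odd.
  defect-step : ∀ m → p ^ 2 ∣ˢ defect m → (+ 1 + m) ^ suc q ≡ + 1 + m ^ suc q [mod p ^ 2 ]
  defect-step m d = mod-sym (mod-trans (mod-trans (≡⇒mod (arith (m ^ suc q) ((+ 1 + m) ^ suc q))) (mod-+ˡ ((+ 1 + m) ^ suc q)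
      (mod-trans (mod-+ˡ (+ 1 - (+ 1 + m) ^ suc q) (mod-sym (mod-neg (mod-trans ([p+w]^p (- m)) (≡⇒mod (neg-^ m)))))) (mod-zero d))))
      (≡⇒mod (ℤₚ.+-identityʳ ((+ 1 + m) ^ suc q))))
    where
    arith : ∀ x y → + 1 + x ≡ y + (+ 1 - y - - x)
    arith = solve-∀

  p^2∤p : ¬ p ^ 2 ∣ˢ p
  p^2∤p d = exactly-∤ {1} {p ^ 1} (exactly-p^ 1) (≡.subst (p ^ 2 ∣ˢ_) (≡.sym (ℤₚ.*-identityʳ p)) d)

  p^2∣p^p : p ^ 2 ∣ˢ p ^ suc q
  p^2∣p^p = weaken (ℕₚ.≤-trans 2≤q (ℕₚ.n≤1+n q)) ℤˢ.∣-refl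

  -- If all defects vanished mod p², telescoping would give j^p ≡ j mod p² for all j ≤ p, which fails for j = p.
  some-defect : ∃ λ (i : Fin (suc q)) → ¬ p ^ 2 ∣ˢ defect (+ toℕ i)
  some-defect = Finₚ.¬∀⟶∃¬ (suc q) (λ i → p ^ 2 ∣ˢ defect (+ toℕ i)) (λ i → p ^ 2 ℤˢ.∣? defect (+ toℕ i)) λ all →
      p^2∤p (∣-respects (mod-sym (telescope all (suc q) ℕₚ.≤-refl)) p^2∣p^p)
    where
    telescope : (∀ i → p ^ 2 ∣ˢ defect (+ toℕ i)) → ∀ j → j ℕ.≤ suc q → (+ j) ^ suc q ≡ + j [mod p ^ 2 ]
    telescope all zero    h = ≡⇒mod refl
    telescope all (suc j) h = mod-trans (defect-step (+ j) (≡.subst (λ k → p ^ 2 ∣ˢ defect (+ k)) (Finₚ.toℕ-fromℕ< h) (all (Fin.fromℕ< h))))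
      (mod-+ˡ (+ 1) (telescope all j (ℕₚ.≤-trans (ℕₚ.n≤1+n j) h)))

  -- `μ = 0` and `μ = p - 1` have defect `-p^p` and are thereby excluded. So `μ` and `μ + 1` are
  -- prime to `p`, which later makes `μ(μ+1)/2` prime to `p`.
  record Choice : Set where
    field
      μ    : ℕ
      μ≤q  : μ ℕ.≤ q
      w    : ℤ
      p*w  : defect (+ μ) ≡ p * w
      p∤w  : ¬ p ∣ˢ w
      p∤μ  : ¬ p ∣ˢ + μ
      p∤sμ : ¬ p ∣ˢ + suc μ

  choice : Choice
  choice = case some-defect of λ where
      (i , ∤) → case p∣defect (+ toℕ i) of λ where
        (divides w e) → record
          { μ = toℕ i ; μ≤q = Finₚ.toℕ≤pred[n] i ; w = w ; p*w = ≡.trans e (ℤₚ.*-comm w p)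
          ; p∤w = λ { (divides v f) → ∤ (divides v (≡.trans e (≡.trans (cong (_* p) f) (arith v p)))) }
          ; p∤μ = λ d → ∤ (≡.subst (λ k → p ^ 2 ∣ˢ defect (+ k)) (≡.sym (small (Finₚ.toℕ<n i) (ℤˢ.∣⇒∣ᵤ d))) defect-0)
          ; p∤sμ = λ d → ∤ (≡.subst (λ k → p ^ 2 ∣ˢ defect (+ k)) (≡.sym (large (ℕ.s≤s (Finₚ.toℕ≤pred[n] i)) (ℤˢ.∣⇒∣ᵤ d))) defect-q) }
    where
    arith : ∀ v p → v * p * p ≡ v * (p * (p * + 1))
    arith = solve-∀
    small : ∀ {k} → k ℕ.< suc q → suc q ℕᵈ.∣ k → k ≡ 0
    small {zero}  lt d = refl
    small {suc k} lt d = ⊥-elim (ℕₚ.<⇒≱ lt (ℕᵈ.∣⇒≤ d))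
    large : ∀ {k} → suc k ℕ.≤ suc q → suc q ℕᵈ.∣ suc k → k ≡ q
    large h d = ℕₚ.≤-antisym (ℕₚ.≤-pred h) (ℕₚ.≤-pred (ℕᵈ.∣⇒≤ d))
    defect-0 : p ^ 2 ∣ˢ defect (+ 0)
    defect-0 = ≡.subst (p ^ 2 ∣ˢ_) (≡.sym (≡.trans (cong₂ (λ x y → + 1 - x - y ^ suc q) (ℤₚ.^-zeroˡ (suc q)) (ℤₚ.+-identityʳ p)) (ℤₚ.+-identityˡ (- p ^ suc q)))) (ℤˢ.∣m⇒∣-m p^2∣p^p)
    defect-q : p ^ 2 ∣ˢ defect (+ q)
    defect-q = ≡.subst (p ^ 2 ∣ˢ_) (≡.sym (≡.trans (cong (λ x → + 1 - p ^ suc q - x) (≡.trans (cong (_^ suc q) (arith′ (+ q))) (ℤₚ.^-zeroˡ (suc q)))) (arith″ (p ^ suc q)))) (ℤˢ.∣m⇒∣-m p^2∣p^p)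
      where
      arith′ : ∀ q → (+ 1 + q) - q ≡ + 1
      arith′ = solve-∀
      arith″ : ∀ x → + 1 - x - + 1 ≡ - x
      arith″ = solve-∀

-- The example on the part where the norm of z vanishes

module Example (q : ℕ) (prime : Prime (suc q)) (2≤q : 2 ℕ.≤ q) where
  open LowerBound q prime 2≤q public
  open FermatQuotients q prime 2≤q using (module Choice; choice)
  open Choice choice
  open Matrices using (Det)

  -- μ is chosen such that 1 - α^p - β^p is divisible by p but not by p², while α + β = 1 + p and
  -- 1 - αt^μ - βt^(μ+1) has a double root at t = 1 modulo p.
  α β : ℤ
  α = + suc μ
  β = p ℤ.- + μ

  gᴬ gᴮ : G
  gᴬ = -[1+ 0 ] , + μ , + 0
  gᴮ = -[1+ 0 ] , + suc μ , + 0

  A B N F : Expr G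
  A = con α :* var gᴬ
  B = con β :* var gᴮ
  N = A :+ B
  F = con (+ 1) E.- N

  module Eᶜ = Algebra (repAlgebra ρᶜ)
  private
    module Powᴱ = AlgebraPowers E

  torsion-free : ∀ {u c} → u ≢ + 0 → con u :* c ≈[ ρᶜ ] con (+ 0) → c ≈[ ρᶜ ] con (+ 0)
  torsion-free {u} {c} u≢0 h = lift[ ρᶜ ] (pointwise λ i j → case ℤₚ.i*j≡0⇒i≡0∨j≡0 u (≡.trans (≡.sym (entry (MatrixAlgebra.ι-∙ Centre.K u (ev ρᶜ c)) i j))
      (≡.trans (entry (lower[ ρᶜ ] h) i j) (ℤₚ.*-zeroˡ (δ Centre.K i j)))) of λ where
    (inj₁ u≡0) → ⊥-elim (u≢0 u≡0)
    (inj₂ c≡0) → ≡.trans c≡0 (≡.sym (ℤₚ.*-zeroˡ (δ Centre.K i j))))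

  -- Inverting `i + 1` modulo `p` gives `z c = c`, so `1 + z + … + z^(p-1)` multiplies `c` by `p`.
  -- But it is 0 on this part, and integer matrices have no torsion.
  primitive-z : ∀ i → i ℕ.< q → ∀ c → var z Eᶜ.^ suc i :* c ≈[ ρᶜ ] c → c ≈[ ρᶜ ] con (+ 0)
  primitive-z i i<q c h = case inverse-mod prime (λ d → ℕₚ.<⇒≱ (ℕ.s≤s i<q) (ℕᵈ.∣⇒≤ d)) of λ where
      (v , w , eq) → torsion-free (λ ()) (Eᶜ.≈-trans (Eᶜ.≈-sym (norm-fixed (fixed v w eq) (suc q))) (Eᶜ.≈-trans (Eᶜ.*-cong₁ norm-zᶜ) (Eᶜ.*-zeroˡ c)))
    where
    iterated : ∀ j → (var z E.^ suc i) E.^ j :* c ≈[ ρᶜ ] c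
    iterated zero    = Eᶜ.*-identityˡ c
    iterated (suc j) = Eᶜ.≈-trans (Eᶜ.*-assoc _ _ _) (Eᶜ.≈-trans (Eᶜ.*-cong₂ (iterated j)) (≡.subst (λ u → u :* c ≈[ ρᶜ ] c) (rep-^ ρᶜ ρ (var z) (suc i)) h))
    fixed : ∀ v w → v ℤ.* + suc i ℤ.+ w ℤ.* p ≡ + 1 → var z :* c ≈[ ρᶜ ] c
    fixed v w eq = Eᶜ.≈-trans (Eᶜ.*-cong₁ (transferᶜ (E.≈-sym (E.≈-trans (E.≈-sym (Powᴱ.^-* (var z) j (suc i))) (E.≈-trans (var-^ z (j ℕ.* suc i))
        (var-cong (act-cong (≡⇒mod (ℤₚ.*-zeroʳ (+ (j ℕ.* suc i)))) (≡⇒mod (ℤₚ.*-zeroʳ (+ (j ℕ.* suc i)))) unit-exponent))))))) (iterated j)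
      where
      j : ℕ
      j = toℕ (residue v)
      arith : ∀ n t → n ℤ.* + 1 ℤ.+ + 0 ℤ.* + 0 ℤ.* t ≡ n
      arith = solve-∀
      unit-exponent : + (j ℕ.* suc i) ℤ.* + 1 ℤ.+ + 0 ℤ.* + 0 ℤ.* triangle (j ℕ.* suc i) ≡ + 1 [mod p ]
      unit-exponent = mod-trans (≡⇒mod (≡.trans (arith (+ (j ℕ.* suc i)) (triangle (j ℕ.* suc i))) (ℤₚ.pos-* j (suc i))))
        (mod-trans (mod-*ʳ (+ suc i) (⟪residue⟫ v)) (mod-sym (congruent (divides w (≡.trans (cong (ℤ._- v ℤ.* + suc i) (≡.sym eq)) (arith′ (v ℤ.* + suc i) (w ℤ.* p)))))))
        where
        arith′ : ∀ x y → x ℤ.+ y ℤ.- x ≡ y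
        arith′ = solve-∀
    norm-fixed : var z :* c ≈[ ρᶜ ] c → ∀ n → Powᴱ.geometric (var z) n :* c ≈[ ρᶜ ] con (+ n) :* c
    norm-fixed h zero    = Eᶜ.≈-refl
    norm-fixed h (suc n) = Eᶜ.≈-trans (Eᶜ.*-distribʳ _ _ _) (Eᶜ.≈-trans (Eᶜ.+-cong (norm-fixed h n) (power-fixed n))
        (Eᶜ.≈-trans (Eᶜ.+-comm _ _) (Eᶜ.≈-trans (Eᶜ.+-cong₁ (Eᶜ.≈-sym (Eᶜ.*-identityˡ c))) (Eᶜ.≈-trans (Eᶜ.≈-sym (Eᶜ.*-distribʳ _ _ _)) (Eᶜ.*-cong₁ (Eᶜ.≈-sym (Eᶜ.ι-+ (+ 1) (+ n))))))))
      where
      power-fixed : ∀ n → var z E.^ n :* c ≈[ ρᶜ ] c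
      power-fixed zero    = Eᶜ.*-identityˡ c
      power-fixed (suc n) = Eᶜ.≈-trans (Eᶜ.*-assoc _ _ _) (Eᶜ.≈-trans (Eᶜ.*-cong₂ (power-fixed n)) h)

  monomial-^p : ∀ u g → (con u :* var g) Eᶜ.^ suc q ≈[ ρᶜ ] con (u ℤ.^ suc q)
  monomial-^p u g = Factorᶜ.transfer-^ {con u :* var g} {suc q} (E.≈-trans (Powᴱ.^-distrib-* (con u) (var g) (suc q) (E.ι-central u (var g)))
    (E.≈-trans (E.*-cong₂ (var-^p g)) (E.≈-trans (E.*-identityʳ _) (E.≈-sym (Powᴱ.ι-^ u (suc q))))))

  N^p : N Eᶜ.^ suc q ≈[ ρᶜ ] con (α ℤ.^ suc q) :+ con (β ℤ.^ suc q)
  N^p = Eᶜ.≈-trans (QCommuting.q-frobenius (repAlgebra ρᶜ) q A B (var z) (λ c → transferᶜ (z-central (+ 1) c)) (transferᶜ AB)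
      (Factorᶜ.transfer-^ {var z} {suc q} (var-^p z)) primitive-z regular)
      (Eᶜ.+-cong (monomial-^p α gᴬ) (monomial-^p β gᴮ))
    where
    AB : A :* B E.≈ var z :* (B :* A)
    AB = E.≈-trans (Solver.solveᶜ E (scalar α ∷ scalar β ∷ []) (var gᴬ ∷ var gᴮ ∷ []) ((c₀ :* x₀) :* (c₁ :* x₁)) (c₀ :* (c₁ :* (x₀ :* x₁))) refl)
      (E.≈-trans (E.*-cong₂ (E.*-cong₂ (E.≈-trans (var-⋆ gᴬ gᴮ) (E.≈-trans (var-≡ refl (arith₁ (+ μ)) (arith₂ (+ μ)))
          (E.≈-sym (E.≈-trans (E.*-cong₂ (var-⋆ gᴮ gᴬ)) (var-⋆ z (gᴮ ⋆ gᴬ))))))))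
        (Solver.solveᶜ E (scalar α ∷ scalar β ∷ []) (var gᴬ ∷ var gᴮ ∷ var z ∷ []) (c₀ :* (c₁ :* (x₂ :* (x₁ :* x₀)))) (x₂ :* ((c₁ :* x₁) :* (c₀ :* x₀))) refl))
      where
      scalar : ∀ u → ∃ E.Central
      scalar u = con u , E.ι-central u
      arith₁ : ∀ m → m ℤ.+ (+ 1 ℤ.+ m) ≡ + 0 ℤ.+ ((+ 1 ℤ.+ m) ℤ.+ m)
      arith₁ = solve-∀
      arith₂ : ∀ m → + 0 ℤ.+ + 0 ℤ.+ m ℤ.* -[1+ 0 ] ≡ + 1 ℤ.+ (+ 0 ℤ.+ + 0 ℤ.+ (+ 1 ℤ.+ m) ℤ.* -[1+ 0 ]) ℤ.+ + 0 ℤ.* (-[1+ 0 ] ℤ.+ -[1+ 0 ])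
      arith₂ = solve-∀
    -- `B` is invertible up to the integer `β`, which is nonzero because `p` does not divide `μ`.
    regular : ∀ c → B :* c ≈[ ρᶜ ] con (+ 0) → c ≈[ ρᶜ ] con (+ 0)
    regular c h = torsion-free {β} {c} β≢0 (Eᶜ.≈-trans (Eᶜ.≈-sym (Eᶜ.≈-trans (Eᶜ.≈-sym (Eᶜ.*-assoc _ _ c)) (Eᶜ.*-cong₁ (transferᶜ inverse)))) (Eᶜ.≈-trans (Eᶜ.*-cong₂ h) (Eᶜ.*-zeroʳ _)))
      where
      inverse : var gᴮ E.^ q :* B E.≈ con β
      inverse = E.≈-trans (Solver.solveᶜ E ((con β , E.ι-central β) ∷ []) (var gᴮ ∷ var gᴮ E.^ q ∷ []) (x₁ :* (c₀ :* x₀)) (c₀ :* (x₁ :* x₀)) refl)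
        (E.≈-trans (E.*-cong₂ (E.≈-trans (E.≈-sym (Powᴱ.^-sucʳ (var gᴮ) q)) (var-^p gᴮ))) (E.*-identityʳ _))
      β≢0 : β ≢ + 0
      β≢0 e = p∤μ (divides (+ 1) (≡.trans (≡.sym (ℤₚ.i-j≡0⇒i≡j p (+ μ) e)) (≡.sym (ℤₚ.*-identityˡ p))))

  ε-N : ε N ≡ + 1 ℤ.+ p
  ε-N = arith (+ μ) p
    where
    arith : ∀ m p → (+ 1 ℤ.+ m) ℤ.* + 1 ℤ.+ (p ℤ.- m) ℤ.* + 1 ≡ + 1 ℤ.+ p
    arith = solve-∀

  ε-F : ε F ≡ ℤ.- p
  ε-F = ≡.trans (cong (λ u → + 1 ℤ.+ -[1+ 0 ] ℤ.* u) ε-N) (arith p)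
    where
    arith : ∀ p → + 1 ℤ.+ -[1+ 0 ] ℤ.* (+ 1 ℤ.+ p) ≡ ℤ.- p
    arith = solve-∀

  -- On this part `F^p = (1 - N^p) + p F U = p (w + F U)`. As `ε(F) = -p`, the augmentation of the
  -- second factor is `w` modulo `p`, so its determinant is prime to `p`.
  exact-centre : Exactly (suc q ℕ.* q) (Det (ev ρᶜ F))
  exact-centre = case GeometricMod.[1-t]^p-mod-p E prime N of λ where
      (U , h) → exactly-root q (suc q ℕ.* q) (Det (ev ρᶜ F)) (exactly (Det (ev ρᶜ (con w :+ F :* U)))
        (≡.trans (Factorᶜ.Det-scaled {F} {con w :+ F :* U} {p} {suc q} (F^p U h)) (cong (λ k → p ℤ.^ k ℤ.* Det (ev ρᶜ (con w :+ F :* U))) (ℕₚ.*-assoc (suc q) (suc q) q)))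
        (Factorᶜ.unit (con w :+ F :* U) λ d → p∤w (∣-respects (mod-sym (mod-trans (≡⇒mod (≡.trans (cong (λ u → w ℤ.+ u ℤ.* ε U) ε-F) (arith w p (ε U)))) (multiple-+ w (ℤ.- ε U)))) d)))
    where
    arith : ∀ w p u → w ℤ.+ ℤ.- p ℤ.* u ≡ w ℤ.+ p ℤ.* ℤ.- u
    arith = solve-∀
    F^p : ∀ U → F E.^ suc q E.≈ (con (+ 1) E.- N E.^ suc q) :+ con p :* (F :* U) → F Eᶜ.^ suc q ≈[ ρᶜ ] con p :* (con w :+ F :* U)
    F^p U h = Eᶜ.≈-trans (Factorᶜ.transfer-^ {F} {suc q} h) (Eᶜ.≈-trans (Eᶜ.+-cong₁ (Eᶜ.≈-trans (Eᶜ.+-cong₂ (Eᶜ.*-cong₂ (≡.subst (λ u → u ≈[ ρᶜ ] con (α ℤ.^ suc q) :+ con (β ℤ.^ suc q)) (rep-^ ρᶜ ρ N (suc q)) N^p)))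
      (Eᶜ.≈-trans collect (Eᶜ.≈-trans (Eᶜ.≈-reflexive (cong con p*w)) (Eᶜ.ι-* p w))))) (Eᶜ.≈-sym (Eᶜ.*-distribˡ _ _ _)))
      where
      collect : con (+ 1) Eᶜ.- (con (α ℤ.^ suc q) :+ con (β ℤ.^ suc q)) ≈[ ρᶜ ] con (+ 1 ℤ.- α ℤ.^ suc q ℤ.- β ℤ.^ suc q)
      collect = Eᶜ.≈-sym (Eᶜ.≈-trans (Eᶜ.≈-reflexive (cong con (arith′ (α ℤ.^ suc q) (β ℤ.^ suc q)))) (Eᶜ.≈-trans (Eᶜ.ι-+ _ _) (Eᶜ.+-cong₂ (Eᶜ.≈-trans (Eᶜ.ι-* -[1+ 0 ] _) (Eᶜ.*-cong₂ (Eᶜ.ι-+ (α ℤ.^ suc q) (β ℤ.^ suc q)))))))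
        where
        arith′ : ∀ a b → + 1 ℤ.- a ℤ.- b ≡ + 1 ℤ.+ -[1+ 0 ] ℤ.* (a ℤ.+ b)
        arith′ = solve-∀

-- The example on the plane: elimination of x

module ExamplePlane (q : ℕ) (prime : Prime (suc q)) (2≤q : 2 ℕ.≤ q) where
  open Example q prime 2≤q public
  open FermatQuotients q prime 2≤q using (module Choice; choice)
  open Choice choice
  open Matrices using (Det; Det-cong)
  -- The retained coordinate is the exponent of `y`, so the line is acted on by ⟨y⟩ and `x` moves
  -- along the fibres.
  open Coordinates (+ 0) (+ 1) -[1+ 0 ] (+ 0) refl
  private
    module Powᴱ = AlgebraPowers E

  -- On the plane, `F = 1 - x⁻¹ Gx`.
  Gx : Expr G
  Gx = con α :* var (+ 0 , + μ , + 0) :+ con β :* var (+ 0 , + suc μ , + 0)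

  module _ where
    open Chains Line
    open Int using (_+_; _*_; -_; _-_)

    private
      δ-suc : ∀ {n} (i j : Fin n) → δ (fin (suc n)) (suc i) (suc j) ≡ δ (fin n) i j
      δ-suc {n} i j = δ-⇔ (fin (suc n)) (fin n) Finₚ.suc-injective (cong suc)

      δ-last : ∀ {n} (i : Fin (suc n)) → δ (fin (suc n)) i (Fin.fromℕ n) ≡ last i
      δ-last {zero}  zero    = refl
      δ-last {suc n} zero    = δ-≢ (fin (suc (suc n))) {zero} {Fin.fromℕ (suc n)} (λ ())
      δ-last {suc n} (suc i) = ≡.trans (δ-suc i (Fin.fromℕ n)) (δ-last i)

      δ-inject₁ : ∀ {n} (i : Fin (suc n)) (j : Fin n) → δ (fin (suc n)) i (Fin.inject₁ j) ≡ superdiagonal i (suc j)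
      δ-inject₁ zero    zero    = refl
      δ-inject₁ {suc n} zero (suc j) = δ-≢ (fin (suc (suc n))) {zero} {Fin.inject₁ (suc j)} (λ ())
      δ-inject₁ {suc n} (suc i) zero    = δ-≢ (fin (suc (suc n))) {suc i} {zero} (λ ())
      δ-inject₁ {suc n} (suc i) (suc j) = ≡.trans (δ-suc i (Fin.inject₁ j)) (δ-inject₁ i j)

      -- The matrix of `x⁻¹` is the superdiagonal together with the corner where 0 wraps around to
      -- `p - 1`.
      cyclic : ∀ (i j : Fin (suc q)) → δ Line i (translate -[1+ 0 ] j) ≡ superdiagonal i j + last i * first j
      cyclic i zero    = ≡.trans (cong (δ Line i) previous) (≡.trans (δ-last i) (arith (last i)))
        where
        arith : ∀ x → x ≡ + 0 + x * + 1
        arith = solve-∀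
        previous : translate -[1+ 0 ] zero ≡ Fin.fromℕ q
        previous = ⟪⟫-injective _ _ (mod-trans (⟪residue⟫ -[1+ 0 ]) (congruent (divides -[1+ 0 ] (≡.trans (cong (λ n → -[1+ 0 ] - + n) (Finₚ.toℕ-fromℕ q)) (arith′ (+ q))))))
          where
          arith′ : ∀ q → -[1+ 0 ] - q ≡ -[1+ 0 ] * (+ 1 + q)
          arith′ = solve-∀
      cyclic i (suc j) = ≡.trans (cong (δ Line i) previous) (≡.trans (δ-inject₁ i j) (arith (superdiagonal i (suc j)) (last i)))
        where
        arith : ∀ s x → s ≡ s + x * + 0
        arith = solve-∀
        previous : translate -[1+ 0 ] (suc j) ≡ Fin.inject₁ j
        previous = ⟪⟫-injective _ _ (mod-trans (⟪residue⟫ (-[1+ 0 ] + ⟪ suc j ⟫)) (≡⇒mod (cong +_ (≡.sym (Finₚ.toℕ-inject₁ j)))))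

      δ-pair : ∀ (i j k l : Fin (suc q)) → δ Plane (i , j) (k , l) ≡ δ Line i k * δ Line j l
      δ-pair i j k l = case decEq Line i k of λ where
        (no i≢k)   → ≡.trans (δ-≢ Plane {i , j} {k , l} (i≢k ∘ cong proj₁)) (≡.sym (cong (_* δ Line j l) (δ-≢ Line i≢k)))
        (yes refl) → ≡.trans (δ-⇔ Plane Line {i , j} {i , l} {j} {l} (cong proj₂) (cong (i ,_))) (≡.sym (≡.trans (cong (_* δ Line j l) (δ-refl Line i)) (ℤₚ.*-identityˡ _)))

      scaled : ∀ {I} (ρ' : G → Mat I I) u e i j → at (ev ρ' (con u :* e)) i j ≡ u * at (ev ρ' e) i j
      scaled {I} ρ' u e i j = entry (MatrixAlgebra.ι-∙ I u (ev ρ' e)) i j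

      g : Mat Line Line
      g = ev ρᴸ Gx

      shiftᴸ : ∀ n b b' → at (ρᴸ (+ 0 , n , + 0)) b b' ≡ δ Line b (translate n b')
      shiftᴸ n b b' = cong (δ Line b) (translate-cong (≡⇒mod (arith n)) b')
        where
        arith : ∀ n → + 0 * + 0 + + 1 * n ≡ n
        arith = solve-∀

      entries : ∀ u v → at (ev ρᴾ F) u v ≡ at (chain q g g) u v
      entries (a , b) (a' , b') = begin
        + 1 * D + at (ev ρᴾ (con -[1+ 0 ] :* N)) (a , b) (a' , b')
          ≡⟨ cong (λ x → + 1 * D + x) (≡.trans (scaled ρᴾ -[1+ 0 ] N (a , b) (a' , b')) (cong (-[1+ 0 ] *_) (cong₂ _+_ (monomial α (+ μ)) (monomial β (+ suc μ))))) ⟩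
        + 1 * D + -[1+ 0 ] * (α * (T * δ Line b (translate (+ μ) b')) + β * (T * δ Line b (translate (+ suc μ) b')))
          ≡⟨ arith D α β (superdiagonal a a') (last a * first a') (δ Line b (translate (+ μ) b')) (δ Line b (translate (+ suc μ) b')) ⟩
        D - superdiagonal a a' * Y - last a * first a' * Y
          ≡⟨ cong (λ y → D - superdiagonal a a' * y - last a * first a' * y) (≡.sym g-entry) ⟩
        D - superdiagonal a a' * at g b b' - last a * first a' * at g b b' ∎
        where
        open ≡.≡-Reasoning
        D T Y : ℤ
        D = δ Plane (a , b) (a' , b')
        T = superdiagonal a a' + last a * first a'
        Y = α * δ Line b (translate (+ μ) b') + β * δ Line b (translate (+ suc μ) b')
        monomial : ∀ u n → at (ev ρᴾ (con u :* var (-[1+ 0 ] , n , + 0))) (a , b) (a' , b') ≡ u * (T * δ Line b (translate n b'))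
        monomial u n = ≡.trans (scaled ρᴾ u (var (-[1+ 0 ] , n , + 0)) (a , b) (a' , b')) (cong (u *_) (≡.trans (δ-pair a b (translate -[1+ 0 ] a') (translate n b'))
          (cong (_* δ Line b (translate n b')) (cyclic a a'))))
        g-entry : at g b b' ≡ Y
        g-entry = cong₂ _+_ (≡.trans (scaled ρᴸ α (var (+ 0 , + μ , + 0)) b b') (cong (α *_) (shiftᴸ (+ μ) b b')))
          (≡.trans (scaled ρᴸ β (var (+ 0 , + suc μ , + 0)) b b') (cong (β *_) (shiftᴸ (+ suc μ) b b')))
        arith : ∀ d α β s l x y → + 1 * d + -[1+ 0 ] * (α * ((s + l) * x) + β * ((s + l) * y)) ≡ d - s * (α * x + β * y) - l * (α * x + β * y)
        arith = solve-∀

    -- `x⁻¹ Gx` is a block cycle whose blocks all equal the action `g` of `Gx` on the line;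
    -- elimination leaves `1 - g^p`, the relative norm of `F` over ℤ[⟨y⟩].
    Det-plane-chain : Det (ev ρᴾ F) ≡ Det (ev ρᴸ (con (+ 1) E.- Gx E.^ suc q))
    Det-plane-chain = ≡.trans (Det-cong {Plane} (pointwise entries)) (≡.trans (Det-chain q g g) (Det-cong {Line} (pointwise λ i j → ≡.sym
      (cong₂ _+_ (ℤₚ.*-identityˡ (δ Line i j)) (≡.trans (scaled ρᴸ -[1+ 0 ] (Gx E.^ suc q) i j) (cong (-[1+ 0 ] *_) (cong (λ X → at X i j)
        (≡.trans (cong (ev ρᴸ) (rep-^ ρ ρᴸ Gx (suc q))) (ev-^ ρᴸ Gx (suc q))))))))))

  actᵀ : G → ∣ fin 1 ⊗ Line ∣ → ∣ fin 1 ⊗ Line ∣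
  actᵀ g (o , l) = o , actᴸ g l

  fin1-η : ∀ {X : Set} (u : Fin 1 × X) → (zero , proj₂ u) ≡ u
  fin1-η (zero , _) = refl

  module Unit = Reindex {G} {Line} {fin 1 ⊗ Line} (≡.sym (ℕₚ.+-identityʳ (suc q))) proj₂ (zero ,_) fin1-η actᴸ actᵀ (λ _ _ → refl)
  -- The line is fibred over one point. The quotient is the trivial representation, with determinant
  -- `ε`; the remaining `ρˢ` of rank `p - 1` plays the role of the cyclotomic integers, with `1 - y`
  -- as uniformiser.
  module Trivial = Split {G} (fin 1) q actᵀ (λ _ o → o) (λ _ _ → refl)

  open Trivial using () renaming (ρ₀ to ρˢ) public

  module Factorˢ = PlaneFactor ρˢ (λ h → Trivial.transfer-sub (Unit.transfer (Fibre.transfer-quo (Change.transfer h))))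

  Det-line : ∀ e → Det (ev ρᴸ e) ≡ Det (ev ρˢ e) ℤ.* ε e
  Det-line e = ≡.trans (≡.sym (Unit.Det-reindexed e)) (≡.trans (Trivial.Det-split e) (cong (Det (ev ρˢ e) ℤ.*_) (Det-trivial e)))

  private
    module Eˢ = Algebra (repAlgebra ρˢ)

  norm-yˢ : norm y ≈[ ρˢ ] con (+ 0)
  norm-yˢ = Trivial.annihilates (norm y) λ o c → multiply (toℕ (suc c)) y , moves o c ,
      Unit.transfer (Fibre.transfer-quo (Change.transfer (transferᴾ (norm-invariant y (toℕ (suc c))))))
    where
    moves : ∀ o (c : Fin q) → actᵀ (multiply (toℕ (suc c)) y) (o , zero) ≡ (o , suc c)
    moves o c = cong (o ,_) (≡.trans (cong residue (arith ⟪ suc c ⟫)) (residue-⟪⟫ (suc c)))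
      where
      arith : ∀ n → + 0 ℤ.* (n ℤ.* + 0) ℤ.+ + 1 ℤ.* (n ℤ.* + 1) ℤ.+ + 0 ≡ n
      arith = solve-∀

  sʸ A₁ : Expr G
  sʸ = con (+ 1) E.- var y
  A₁ = proj₁ ([1-g]^q y)

  sʸ^q : sʸ Eˢ.^ q ≈[ ρˢ ] con p :* A₁
  sʸ^q = Eˢ.≈-trans (Factorˢ.transfer-^ {sʸ} {q} (proj₂ ([1-g]^q y))) (Eˢ.≈-trans (Eˢ.+-cong₁ norm-yˢ) (Eˢ.+-identityˡ _))

  ε-geometric-1 : ∀ g n → ε (Powᴱ.geometric (var g) n) ≡ + n
  ε-geometric-1 g zero    = refl
  ε-geometric-1 g (suc n) = ≡.trans (cong₂ ℤ._+_ (ε-geometric-1 g n) (≡.trans (ε-^ (var g) n) (ℤₚ.^-zeroˡ n))) (ℤₚ.+-comm (+ n) (+ 1))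

  -- The augmentation of `(1 - y)^(p-1) = norm y + p A₁` reads `0 = p + p ε(A₁)`.
  ε-A₁ : ε A₁ ≡ -[1+ 0 ]
  ε-A₁ = ℤₚ.*-cancelˡ-≡ p (ε A₁) -[1+ 0 ] (≡.trans (arith p (ε A₁)) (≡.trans (cong (ℤ._- p) (≡.sym augmented)) (arith′ p)))
    where
    augmented : + 0 ≡ p ℤ.+ p ℤ.* ε A₁
    augmented = ≡.trans (≡.sym (≡.trans (ε-^ sʸ q) (zero-^ 1≤q))) (≡.trans (ε-respects act (zero , zero , zero) (proj₂ ([1-g]^q y))) (cong (ℤ._+ p ℤ.* ε A₁) (ε-geometric-1 y (suc q))))
      where
      zero-^ : ∀ {n} → 1 ℕ.≤ n → (+ 0) ℤ.^ n ≡ + 0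
      zero-^ {suc n} _ = refl
    arith : ∀ p a → p ℤ.* a ≡ p ℤ.+ p ℤ.* a ℤ.- p
    arith = solve-∀
    arith′ : ∀ p → + 0 ℤ.- p ≡ p ℤ.* -[1+ 0 ]
    arith′ = solve-∀

  E₁ κʸ : Expr G
  E₁ = con (+ 1) E.- Gx
  κʸ = Powᴱ.κ (var y) μ

  -- `β = p - μ` splits `1 - Gx` into the polynomial of `double-root` and the remainder
  -- `-p y^(μ+1)`.
  E₁-expansion : E₁ E.≈ sʸ :* (sʸ :* κʸ) E.- con p :* var y E.^ suc μ
  E₁-expansion = E.≈-trans (E.+-cong₂ (E.*-cong₂ (E.+-cong (E.*-cong₂ (y-power μ)) (E.*-cong (E.≈-trans (E.≈-reflexive (cong con (ℤₚ.+-comm p (ℤ.- + μ)))) (β-split)) (y-power (suc μ))))))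
      (E.≈-trans (Solver.solveᶜ E (scalar α ∷ scalar (+ μ) ∷ scalar p ∷ []) (var y E.^ μ ∷ var y E.^ suc μ ∷ [])
          (con (+ 1) :- (c₀ :* x₀ :+ (con -[1+ 0 ] :* c₁ :+ c₂) :* x₁)) ((con (+ 1) :- c₀ :* x₀ :+ c₁ :* x₁) :- c₂ :* x₁) refl)
        (E.+-cong₁ (Powᴱ.double-root (var y) μ)))
    where
    scalar : ∀ u → ∃ E.Central
    scalar u = con u , E.ι-central u
    β-split : con (ℤ.- + μ ℤ.+ p) E.≈ con -[1+ 0 ] :* con (+ μ) :+ con p
    β-split = E.≈-trans (E.ι-+ (ℤ.- + μ) p) (E.+-cong₁ (E.≈-trans (E.≈-reflexive (cong con (≡.sym (ℤₚ.-1*i≡-i (+ μ))))) (E.ι-* -[1+ 0 ] (+ μ))))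
    y-power : ∀ n → var (+ 0 , + n , + 0) E.≈ var y E.^ n
    y-power n = E.≈-sym (E.≈-trans (var-^ y n) (var-≡ (ℤₚ.*-zeroʳ (+ n)) (ℤₚ.*-identityʳ (+ n)) (arith (+ n) (triangle n))))
      where
      arith : ∀ n t → n ℤ.* + 0 ℤ.+ + 0 ℤ.* + 1 ℤ.* t ≡ + 0
      arith = solve-∀

  ε-κ : ∀ n → ε (Powᴱ.κ (var y) n) ≡ triangle (suc n)
  ε-κ zero    = refl
  ε-κ (suc n) = cong₂ ℤ._+_ (ε-κ n) (≡.trans (cong (+ suc n ℤ.*_) (≡.trans (ε-^ (var y) n) (ℤₚ.^-zeroˡ n))) (ℤₚ.*-identityʳ (+ suc n)))

  p∤triangle : ¬ p ∣ˢ triangle (suc μ)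
  p∤triangle d = p∤* p∤sμ p∤μ (≡.subst (p ∣ˢ_) (triangle-double μ) (ℤˢ.∣n⇒∣m*n (+ 2) d))

-- Exact valuations on the line, and the coefficients of the example

module Exactness (q : ℕ) (prime : Prime (suc q)) (2≤q : 2 ℕ.≤ q) where
  open ExamplePlane q prime 2≤q public
  open FermatQuotients q prime 2≤q using (module Choice; choice)
  open Choice choice
  open Matrices using (Det; Det-cong; Det-∙)
  private
    module Powᴱ = AlgebraPowers E
    module Eˢ = Algebra (repAlgebra ρˢ)
    module Powˢ = AlgebraPowers (repAlgebra ρˢ)

  Γ X : Expr G
  Γ = Powᴱ.geometric Gx (suc q)
  X = con (+ 1) E.- Gx E.^ suc q

  opaque
    E₁^q : ∃ λ U → E₁ E.^ q E.≈ Γ :+ con p :* U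
    E₁^q = GeometricMod.[1-t]^q-mod-p E prime Gx

  U₂ : Expr G
  U₂ = proj₁ E₁^q

  X-factors : X E.≈ E₁ :* Γ
  X-factors = E.≈-sym (Powᴱ.[1-t]*geometric Gx (suc q))

  ε-E₁ : ε E₁ ≡ ℤ.- p
  ε-E₁ = ε-F

  p^2∣p* : ∀ {x} → p ∣ˢ x → p ℤ.^ 2 ∣ˢ p ℤ.* x
  p^2∣p* (divides k e) = divides k (≡.trans (cong (p ℤ.*_) e) (arith p k))
    where
    arith : ∀ p k → p ℤ.* (k ℤ.* p) ≡ k ℤ.* (p ℤ.* (p ℤ.* + 1))
    arith = solve-∀

  [1+p]^n : ∀ n → (+ 1 ℤ.+ p) ℤ.^ n ≡ + 1 ℤ.+ p ℤ.* + n [mod p ℤ.^ 2 ]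
  [1+p]^n zero    = ≡⇒mod (≡.sym (cong (λ x → + 1 ℤ.+ x) (ℤₚ.*-zeroʳ p)))
  [1+p]^n (suc n) = mod-trans (mod-*ˡ (+ 1 ℤ.+ p) ([1+p]^n n)) (mod-trans (≡⇒mod (arith p (+ n))) (multiple-+ (+ 1 ℤ.+ p ℤ.* + suc n) (+ n)))
    where
    arith : ∀ p n → (+ 1 ℤ.+ p) ℤ.* (+ 1 ℤ.+ p ℤ.* n) ≡ (+ 1 ℤ.+ p ℤ.* (+ 1 ℤ.+ n)) ℤ.+ p ℤ.* (p ℤ.* + 1) ℤ.* n
    arith = solve-∀

  ε-geometric : ∀ n → ε (Powᴱ.geometric Gx n) ≡ + n ℤ.+ p ℤ.* triangle n [mod p ℤ.^ 2 ]
  ε-geometric zero    = ≡⇒mod (≡.sym (≡.trans (ℤₚ.+-identityˡ (p ℤ.* + 0)) (ℤₚ.*-zeroʳ p)))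
  ε-geometric (suc n) = mod-trans (mod-+ (ε-geometric n) (mod-trans (≡⇒mod (≡.trans (ε-^ Gx n) (cong (ℤ._^ n) ε-N))) ([1+p]^n n))) (≡⇒mod (arith p (+ n) (triangle n)))
    where
    arith : ∀ p n t → (n ℤ.+ p ℤ.* t) ℤ.+ (+ 1 ℤ.+ p ℤ.* n) ≡ (+ 1 ℤ.+ n) ℤ.+ p ℤ.* (t ℤ.+ n)
    arith = solve-∀

  -- `ε(Gx) = 1 + p`, and the sum of `(1 + p)^n` over `n < p` is `p + p · p(p-1)/2` modulo `p²`.
  ε-Γ : ε Γ ≡ p [mod p ℤ.^ 2 ]
  ε-Γ = mod-trans (ε-geometric (suc q)) (mod-trans (mod-+ˡ p (mod-zero (p^2∣p* p∣triangle))) (≡⇒mod (ℤₚ.+-identityʳ p)))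

  exact-Γ : Exactly 1 (ε Γ)
  exact-Γ = case difference ε-Γ of λ where
      (divides c e) → exactly (+ 1 ℤ.+ p ℤ.* c) (≡.trans (arith₁ (ε Γ) p) (≡.trans (cong (ℤ._+ p) e) (arith₂ p c)))
        (λ d → p∤1 (∣-respects (mod-sym (multiple-+ (+ 1) c)) d))
    where
    arith₁ : ∀ g p → g ≡ (g ℤ.- p) ℤ.+ p
    arith₁ = solve-∀
    arith₂ : ∀ p c → c ℤ.* (p ℤ.* (p ℤ.* + 1)) ℤ.+ p ≡ p ℤ.* + 1 ℤ.* (+ 1 ℤ.+ p ℤ.* c)
    arith₂ = solve-∀

  -- Compare augmentations in `E₁^(p-1) = Γ + p U₂`: `p²` divides the left side `(-p)^(p-1)` but not
  -- `ε(Γ)`.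
  p∤U₂ : ¬ p ∣ˢ ε U₂
  p∤U₂ d = exactly-∤ exact-Γ (≡.subst (p ℤ.^ 2 ∣ˢ_) (arith (ε Γ) (p ℤ.* ε U₂))
      (ℤˢ.∣m∣n⇒∣m-n (≡.subst (p ℤ.^ 2 ∣ˢ_) (≡.trans (≡.sym (≡.trans (ε-^ E₁ q) (cong (ℤ._^ q) ε-E₁))) (ε-respects act (zero , zero , zero) (proj₂ E₁^q))) (p^2∣-p^ 2≤q)) (p^2∣p* d)))
    where
    arith : ∀ g u → g ℤ.+ u ℤ.- u ≡ g
    arith = solve-∀
    p^2∣-p^ : ∀ {n} → 2 ℕ.≤ n → p ℤ.^ 2 ∣ˢ (ℤ.- p) ℤ.^ n
    p^2∣-p^ {suc (suc n)} (ℕ.s≤s (ℕ.s≤s _)) = divides ((ℤ.- p) ℤ.^ n) (arith′ p ((ℤ.- p) ℤ.^ n))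
      where
      arith′ : ∀ p x → ℤ.- p ℤ.* (ℤ.- p ℤ.* x) ≡ x ℤ.* (p ℤ.* (p ℤ.* + 1))
      arith′ = solve-∀

  -- `r = p - 3`, the exponent that remains when `(1 - y)²` is split off from `(1 - y)^(p-1)`.
  r : ℕ
  r = proj₁ (ℕₚ.m≤n⇒∃[o]m+o≡n 2≤q)

  2+r≡q : 2 ℕ.+ r ≡ q
  2+r≡q = proj₂ (ℕₚ.m≤n⇒∃[o]m+o≡n 2≤q)

  -- Multiplication by `A₁` trades `p A₁` for `(1 - y)^(p-1)` and so replaces division in the
  -- cyclotomic integers. `κ″` and `V` are the cofactors in `A₁ E₁ = (1 - y)² κ″` and
  -- `A₁^(p-1) X = p E₁ V`.
  T κ″ V : Expr G
  T = var y E.^ suc μ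
  κ″ = κʸ :* A₁ E.- T :* sʸ Eˢ.^ r
  V = con p :* (A₁ :* (A₁ :* κ″ Eˢ.^ q)) E.- A₁ Eˢ.^ q :* U₂

  private
    open Solver (repAlgebra ρˢ)

    Z : Expr G → ∃ Eˢ.Central
    Z e = e , Factorˢ.commutative e

  A₁E₁ : A₁ :* E₁ ≈[ ρˢ ] sʸ :* (sʸ :* κ″)
  A₁E₁ = Eˢ.≈-trans (Eˢ.*-cong₂ (Factorˢ.transferᴴ E₁-expansion)) (Eˢ.≈-trans
      (solveᶜ (Z A₁ ∷ Z sʸ ∷ Z κʸ ∷ Z (con p) ∷ Z T ∷ []) [] (c₀ :* (c₁ :* (c₁ :* c₂) :- c₃ :* c₄)) (c₁ :* (c₁ :* (c₂ :* c₀)) :- c₄ :* (c₃ :* c₀)) refl)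
      (Eˢ.≈-trans (Eˢ.+-cong₂ (Eˢ.*-cong₂ (Eˢ.*-cong₂ (Eˢ.≈-trans (Eˢ.≈-sym sʸ^q) (Eˢ.≈-reflexive (cong (sʸ Eˢ.^_) (≡.sym 2+r≡q)))))))
        (solveᶜ (Z A₁ ∷ Z sʸ ∷ Z κʸ ∷ Z (sʸ Eˢ.^ r) ∷ Z T ∷ []) [] (c₁ :* (c₁ :* (c₂ :* c₀)) :- c₄ :* (c₁ :* (c₁ :* c₃))) (c₁ :* (c₁ :* (c₂ :* c₀ :- c₄ :* c₃))) refl)))

  A₁^qE₁^q : A₁ Eˢ.^ q :* E₁ Eˢ.^ q ≈[ ρˢ ] (con p :* A₁) :* ((con p :* A₁) :* κ″ Eˢ.^ q)
  A₁^qE₁^q = Eˢ.≈-trans (Eˢ.≈-sym (Powˢ.^-distrib-* A₁ E₁ q (Factorˢ.commutative A₁ E₁))) (Eˢ.≈-trans (Eˢ.^-cong q A₁E₁)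
    (Eˢ.≈-trans (Powˢ.^-distrib-* sʸ (sʸ :* κ″) q (Factorˢ.commutative sʸ (sʸ :* κ″))) (Eˢ.*-cong sʸ^q
      (Eˢ.≈-trans (Powˢ.^-distrib-* sʸ κ″ q (Factorˢ.commutative sʸ κ″)) (Eˢ.*-cong₁ sʸ^q)))))

  -- Write `Γ` as `E₁^(p-1) - p U₂`. After multiplication by `A₁^(p-1)` the first term is divisible
  -- by `p²`, so one factor `p` comes out and `U₂` governs the rest modulo `p`.
  A₁^qX : A₁ Eˢ.^ q :* X ≈[ ρˢ ] con p :* (E₁ :* V)
  A₁^qX = Eˢ.≈-trans (Eˢ.*-cong₂ (Eˢ.≈-trans (Factorˢ.transferᴴ X-factors) (Eˢ.*-cong₂ Γ-formula))) (Eˢ.≈-trans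
      (solveᶜ (Z (A₁ Eˢ.^ q) ∷ Z E₁ ∷ Z (E₁ Eˢ.^ q) ∷ Z (con p) ∷ Z U₂ ∷ []) [] (c₀ :* (c₁ :* (c₂ :- c₃ :* c₄))) (c₁ :* ((c₀ :* c₂) :- c₃ :* (c₀ :* c₄))) refl)
      (Eˢ.≈-trans (Eˢ.*-cong₂ (Eˢ.+-cong₁ A₁^qE₁^q))
        (solveᶜ (Z (A₁ Eˢ.^ q) ∷ Z E₁ ∷ Z A₁ ∷ Z (con p) ∷ Z U₂ ∷ Z (κ″ Eˢ.^ q) ∷ []) []
          (c₁ :* ((c₃ :* c₂) :* ((c₃ :* c₂) :* c₅) :- c₃ :* (c₀ :* c₄))) (c₃ :* (c₁ :* (c₃ :* (c₂ :* (c₂ :* c₅)) :- c₀ :* c₄))) refl)))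
    where
    Γ-formula : Γ ≈[ ρˢ ] E₁ Eˢ.^ q Eˢ.- con p :* U₂
    Γ-formula = Eˢ.≈-sym (Powˢ.a≈b+c⇒a-b≈c (Eˢ.≈-trans (Factorˢ.transfer-^ {E₁} {q} (proj₂ E₁^q)) (Eˢ.+-comm _ _)))

  p∤-1 : ¬ p ∣ˢ -[1+ 0 ]
  p∤-1 d = p∤1 (ℤˢ.∣m⇒∣-m d)

  unit-A₁ : ¬ p ∣ˢ Det (ev ρˢ A₁)
  unit-A₁ = Factorˢ.unit A₁ (λ d → p∤-1 (≡.subst (p ∣ˢ_) ε-A₁ d))

  unit-V : ¬ p ∣ˢ Det (ev ρˢ V)
  unit-V = Factorˢ.unit V λ d → p∤* (p∤^ q p∤-1) p∤U₂ (≡.subst (p ∣ˢ_) (≡.trans (arith (p ℤ.* ε (A₁ :* (A₁ :* κ″ Eˢ.^ q))) (ε (A₁ Eˢ.^ q)) (ε U₂))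
      (cong (ℤ._* ε U₂) (≡.trans (ε-power ρˢ A₁ q) (cong (ℤ._^ q) ε-A₁)))) (ℤˢ.∣m∣n⇒∣m-n (multiple (ε (A₁ :* (A₁ :* κ″ Eˢ.^ q)))) d))
    where
    arith : ∀ x a u → x ℤ.- (x ℤ.+ -[1+ 0 ] ℤ.* (a ℤ.* u)) ≡ a ℤ.* u
    arith = solve-∀

  -- `ε(κ″) = -μ(μ+1)/2 - 0^(p-3)`: the last term survives only for `p = 3`, which is treated
  -- separately.
  unit-κ″ : ¬ p ∣ˢ Det (ev ρˢ κ″)
  unit-κ″ = Factorˢ.unit κ″ λ d → nonzero r refl (≡.subst (p ∣ˢ_) value d)
    where
    value : ε κ″ ≡ triangle (suc μ) ℤ.* -[1+ 0 ] ℤ.+ -[1+ 0 ] ℤ.* (+ 1 ℤ.* (+ 0) ℤ.^ r)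
    value = cong₂ (λ a b → a ℤ.+ -[1+ 0 ] ℤ.* b) (cong₂ ℤ._*_ (ε-κ μ) ε-A₁) (cong₂ ℤ._*_ (≡.trans (ε-^ (var y) (suc μ)) (ℤₚ.^-zeroˡ (suc μ))) (ε-power ρˢ sʸ r))
    nonzero : ∀ n → r ≡ n → ¬ p ∣ˢ triangle (suc μ) ℤ.* -[1+ 0 ] ℤ.+ -[1+ 0 ] ℤ.* (+ 1 ℤ.* (+ 0) ℤ.^ n)
    nonzero (suc n) _ d = p∤triangle (≡.subst (p ∣ˢ_) (arith (triangle (suc μ))) (ℤˢ.∣m⇒∣-m d))
      where
      arith : ∀ t → ℤ.- (t ℤ.* -[1+ 0 ] ℤ.+ -[1+ 0 ] ℤ.* (+ 1 ℤ.* + 0)) ≡ t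
      arith = solve-∀
    nonzero zero r≡0 d = small q≡2 μ μ≤q p∤μ p∤sμ d
      where
      q≡2 : q ≡ 2
      q≡2 = ≡.trans (≡.sym 2+r≡q) (cong (2 ℕ.+_) r≡0)
      -- For p = 3 only μ = 1 is possible.
      small : q ≡ 2 → ∀ n → n ℕ.≤ q → ¬ p ∣ˢ + n → ¬ p ∣ˢ + suc n → ¬ p ∣ˢ triangle (suc n) ℤ.* -[1+ 0 ] ℤ.+ -[1+ 0 ] ℤ.* (+ 1 ℤ.* + 1)
      small e zero n≤q h h' d = h (divides (+ 0) refl)
      small refl (suc zero) n≤q h h' d = ℕₚ.<⇒≱ {2} {3} (ℕ.s≤s (ℕ.s≤s (ℕ.s≤s ℕ.z≤n))) (ℕᵈ.∣⇒≤ (ℤˢ.∣⇒∣ᵤ d))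
      small refl (suc (suc zero)) n≤q h h' d = h' (divides (+ 1) refl)
      small refl (suc (suc (suc n))) (ℕ.s≤s (ℕ.s≤s ())) h h' d

  N₁ : ℕ
  N₁ = size Trivial.K

  -- On rank `p - 1`, `Det(1 - y)^(p-1) = p^(p-1) Det A₁`, where `Det A₁` is prime to `p`.
  exact-s : Exactly 1 (Det (ev ρˢ sʸ))
  exact-s = root 1≤q (exactly (Det (ev ρˢ A₁)) (≡.trans (Factorˢ.Det-scaled {sʸ} {A₁} {p} {q} sʸ^q)
      (cong (λ k → p ℤ.^ k ℤ.* Det (ev ρˢ A₁)) (≡.trans (ℕₚ.+-identityʳ q) (≡.sym (ℕₚ.*-identityʳ q))))) unit-A₁)
    where
    root : ∀ {n} → 1 ℕ.≤ n → Exactly (n ℕ.* 1) (Det (ev ρˢ sʸ) ℤ.^ n) → Exactly 1 (Det (ev ρˢ sʸ))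
    root {suc n} _ h = exactly-root n 1 (Det (ev ρˢ sʸ)) h

  Det-* : ∀ a b → Det (ev ρˢ (a :* b)) ≡ Det (ev ρˢ a) ℤ.* Det (ev ρˢ b)
  Det-* a b = Det-∙ {Trivial.K} (ev ρˢ a) (ev ρˢ b)

  Det-≈ : ∀ {a b} → a ≈[ ρˢ ] b → Det (ev ρˢ a) ≡ Det (ev ρˢ b)
  Det-≈ h = Det-cong {Trivial.K} (lower[ ρˢ ] h)

  exact-E₁ : Exactly 2 (Det (ev ρˢ E₁))
  exact-E₁ = exactly-cancel 2 0 (Det (ev ρˢ E₁)) (Det (ev ρˢ A₁)) (exactly-unit unit-A₁) (≡.subst (Exactly 2) determinants (exactly-* exact-s (exactly-* exact-s (exactly-unit unit-κ″))))
    where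
    determinants : Det (ev ρˢ sʸ) ℤ.* (Det (ev ρˢ sʸ) ℤ.* Det (ev ρˢ κ″)) ≡ Det (ev ρˢ E₁) ℤ.* Det (ev ρˢ A₁)
    determinants = ≡.sym (≡.trans (ℤₚ.*-comm (Det (ev ρˢ E₁)) (Det (ev ρˢ A₁))) (≡.trans (≡.sym (Det-* A₁ E₁)) (≡.trans (Det-≈ A₁E₁)
      (≡.trans (Det-* sʸ (sʸ :* κ″)) (cong (Det (ev ρˢ sʸ) ℤ.*_) (Det-* sʸ κ″))))))

  -- The scalar `p` contributes `p - 1`, the rank, and `E₁` contributes 2; `A₁` and `V` have
  -- determinants prime to `p`.
  exact-X : Exactly (N₁ ℕ.+ 2) (Det (ev ρˢ X))
  exact-X = exactly-cancel (N₁ ℕ.+ 2) 0 (Det (ev ρˢ X)) (Det (ev ρˢ A₁) ℤ.^ q) (exactly-unit (p∤^ q unit-A₁))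
      (≡.subst₂ Exactly (≡.sym (ℕₚ.+-assoc N₁ 2 0)) determinants (exactly-* (exactly-p^ N₁) (exactly-* exact-E₁ (exactly-unit unit-V))))
    where
    determinants : p ℤ.^ N₁ ℤ.* (Det (ev ρˢ E₁) ℤ.* Det (ev ρˢ V)) ≡ Det (ev ρˢ X) ℤ.* Det (ev ρˢ A₁) ℤ.^ q
    determinants = ≡.sym (≡.trans (ℤₚ.*-comm (Det (ev ρˢ X)) (Det (ev ρˢ A₁) ℤ.^ q)) (≡.trans (cong (ℤ._* Det (ev ρˢ X)) (≡.sym (Factorˢ.Det-power A₁ q)))
      (≡.trans (≡.sym (Det-* (A₁ Eˢ.^ q) X)) (≡.trans (Det-≈ A₁^qX) (≡.trans (Det-* (con p) (E₁ :* V)) (cong₂ ℤ._*_ (MatrixAlgebra.Det-ι Trivial.K p) (Det-* E₁ V)))))))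

  exact-ε-X : Exactly 2 (ε X)
  exact-ε-X = ≡.subst (Exactly 2) (≡.sym (≡.trans (ε-respects act (zero , zero , zero) X-factors) (cong (ℤ._* ε Γ) ε-E₁))) (exactly-* exact-p exact-Γ)
    where
    exact-p : Exactly 1 (ℤ.- p)
    exact-p = exactly -[1+ 0 ] (arith p) p∤-1
      where
      arith : ∀ p → ℤ.- p ≡ p ℤ.* + 1 ℤ.* -[1+ 0 ]
      arith = solve-∀

  -- `p - 1 + 2` from `ρˢ` and 2 from the augmentation: the exponent `p + 3` of the lower bound is
  -- attained.
  exact-plane : Exactly (N₁ ℕ.+ 2 ℕ.+ 2) (Det (ev ρᴾ F))
  exact-plane = ≡.subst (Exactly (N₁ ℕ.+ 2 ℕ.+ 2)) (≡.sym (≡.trans Det-plane-chain (Det-line X))) (exactly-* exact-X exact-ε-X)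

  exact-F : Exactly (suc q ℕ.* suc q ℕ.+ 3) (Det (ev ρ F))
  exact-F = ≡.subst₂ Exactly (arith q) (≡.sym (Det-centre F)) (exactly-* exact-centre exact-plane)
    where
    arith : ∀ q → suc q ℕ.* q ℕ.+ (q ℕ.+ 0 ℕ.+ 2 ℕ.+ 2) ≡ suc q ℕ.* suc q ℕ.+ 3
    arith = ℕSolver.solve-∀

  -- Bracketed like the evaluation of `F`, so that the entries of the two determinants match term by
  -- term.
  coefficients : Coeffs (suc q)
  coefficients a b c = + 1 ℤ.* δ H (reduce (+ 0 , + 0 , + 0)) (a , b , c) ℤ.+
    -[1+ 0 ] ℤ.* (α ℤ.* δ H (reduce gᴬ) (a , b , c) ℤ.+ β ℤ.* δ H (reduce gᴮ) (a , b , c))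

  M-coefficients : M (suc q) coefficients ≡ Det (ev ρ F)
  M-coefficients = ≡.trans (M-Det coefficients) (Det-cong {H} (pointwise λ u v → ≡.sym (cong₂ ℤ._+_
    (cong (+ 1 ℤ.*_) (≡.trans (cong (δ H u) (≡.sym (act-1 v))) (ρ-entry (+ 0 , + 0 , + 0) u v)))
    (≡.trans (entry (MatrixAlgebra.ι-∙ H -[1+ 0 ] (ev ρ N)) u v) (cong (-[1+ 0 ] ℤ.*_) (cong₂ ℤ._+_ (scalar-entry α gᴬ u v) (scalar-entry β gᴮ u v)))))))

-- Passage to natural powers and unsigned divisibility

open import Data.Nat using (NonZero; _≤_; _^_; _+_; _*_)
open import Data.Integer.Divisibility using (_∣_)

pos-^ : ∀ m n → + (m ^ n) ≡ (+ m) ℤ.^ n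
pos-^ m zero    = refl
pos-^ m (suc n) = ≡.trans (ℤₚ.pos-* m (m ^ n)) (cong (+ m ℤ.*_) (pos-^ m n))

theorem4 : (p : ℕ) .{{_ : NonZero p}} → Prime p → 3 ≤ p →
    ((F : Coeffs p) → (+ p) ∣ M p F → (+ (p ^ (p * p + 3))) ∣ M p F)
    × ∃ (λ (F : Coeffs p) →
        (+ (p ^ (p * p + 3))) ∣ M p F × ¬ ((+ (p ^ (p * p + 4))) ∣ M p F))
theorem4 (suc q) p-prime (ℕ.s≤s 2≤q) =
    (λ F p∣M → ℤˢ.∣⇒∣ᵤ (≡.subst₂ _∣ˢ_ (≡.sym (pos-^ (suc q) (suc q * suc q + 3))) (≡.sym (M-element F))
      (lower-bound (element F) (≡.subst (+ suc q ∣ˢ_) (M-element F) (ℤˢ.∣ᵤ⇒∣ p∣M)))))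
  , coefficients
  , ℤˢ.∣⇒∣ᵤ (≡.subst₂ _∣ˢ_ (≡.sym (pos-^ (suc q) (suc q * suc q + 3))) (≡.sym M-coefficients) (exactly-∣ exact-F))
  , λ d → exactly-∤ exact-F (≡.subst₂ _∣ˢ_ (≡.trans (pos-^ (suc q) (suc q * suc q + 4)) (cong ((+ suc q) ℤ.^_) (ℕₚ.+-suc (suc q * suc q) 3))) M-coefficients (ℤˢ.∣ᵤ⇒∣ d))
  where open Exactness q p-prime 2≤q
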